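{- Let $s,t\geq 1$ be integers and let $p,q,l$ be three distinct primes with $p,q$ odd, $p\equiv 3 \pmod 4$, $\mathrm{ord}_{p^s}(l)=\phi(p^s)/2$, $\mathrm{ord}_{q^t}(l)=\phi(q^t)$ and $\gcd(\phi(p^s),\phi(q^t))=2$. Let $0\leq i\leq s-1$ and $0\leq j<j'\leq t$. Then in the ring $\mathbb{F}_l[x]/\langle x^{p^sq^t}-1\rangle$: (i) If $q$ is a quadratic residue modulo $p$, then \[\chi_{ij}^*\chi_{ij'}=\frac{p-3}{4}p^{s-i-1}\phi(q^{t-j'})(\chi_{ij}+\chi_{ij}^*)+\frac{\phi(p^{s-i})}{2}\phi(q^{t-j'})\Big(\sum_{i< k\leq s-1}(\chi_{kj}+\chi_{kj}^*)+\chi_{sj}\Big).\] (ii) If $q$ is a quadratic nonresidue modulo $p$ and $2\nmid j'-j$, then \[\chi_{ij}^*\chi_{ij'}=\frac{p-3}{4}p^{s-i-1}\phi(q^{t-j'})\chi_{ij}^*+\frac{p+1}{4}p^{s-i-1}\phi(q^{t-j'})\chi_{ij}.\] (iii) If $q$ is a quadratic nonresidue modulo $p$ and $2\mid j'-j$, then \[\chi_{ij}^*\chi_{ij'}=\frac{p-3}{4}p^{s-i-1}\phi(q^{t-j'})(\chi_{ij}+\chi_{ij}^*)+\frac{\phi(p^{s-i})}{2}\phi(q^{t-j'})\Big(\sum_{i< k\leq s-1}(\chi_{kj}+\chi_{kj}^*)+\chi_{sj}\Big).\]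
   Context: Here $\phi$ is Euler's phi function (with $\phi(1)=1$) and $\mathrm{ord}_m(k)$ is the multiplicative order of $k$ modulo $m$. Put $n=p^sq^t$. Fix an integer $g$ that is a primitive root both modulo $p^s$ and modulo $q^t$. For an integer $\gamma$, $C_\gamma=\{\gamma l^r \bmod n: r\geq 0\}\subseteq \mathbb{Z}_n$ is the $l$-cyclotomic coset modulo $n$ containing $\gamma$. For $0\leq i\leq s$, $0\leq j\leq t$ set $C_{ij}=C_{p^iq^j}$ and $C_{ij}^*=C_{p^iq^jg}$; in particular $C_{sj}=C_{sj}^*$ and $C_{st}=C_0=\{0\}$. Define elements of $\mathbb{F}_l[x]/\langle x^{n}-1\rangle$ by $\chi_{ij}=\sum_{\alpha\in C_{ij}}x^\alpha$ and $\chi_{ij}^*=\sum_{\alpha\in C_{ij}^*}x^\alpha$; in particular $\chi_{sj}=\chi_{sj}^*$ and $\chi_{st}=1$. Integer coefficients are read in $\mathbb{F}_l$, and empty sums are $0$. -}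

module Defs where

open import Algebra.Bundles using (AbelianGroup; CommutativeRing)
open import Data.Fin using (Fin; toℕ; fromℕ<)
open import Data.Fin.Properties using (nonZeroIndex; any?; pigeonhole; toℕ-fromℕ<; toℕ<n)
open import Data.Integer as ℤ using (ℤ; +_; 1ℤ)
import Data.Integer.Properties as ℤ
open import Data.Integer.DivMod using (_%ℕ_; _/ℕ_; n%ℕd<d; a≡a%ℕn+[a/ℕn]*n)
open import Data.Integer.Divisibility.Signed using (_∣_; _∣?_; divides)
open import Data.Integer.Tactic.RingSolver using (solve-∀)
open import Data.List using (List; []; _∷_; map; foldr; filter; length; replicate; upTo; allFin; _++_)
open import Data.Nat as ℕ using (ℕ; zero; suc; _≤_; _<_; _∸_)
import Data.Nat.Properties as ℕ
open import Data.Nat.Coprimality using (Coprime; coprime?)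
open import Data.Nat.Induction using (<-rec)
open import Data.Product using (∃; ∃-syntax; _×_; _,_; proj₂)
open import Level using (0ℓ; _⊔_)
open import Relation.Binary.PropositionalEquality as ≡ using (_≡_)
open import Relation.Nullary using (Dec; yes; no; ¬_)
open import Relation.Nullary.Decidable using (map′)
import Algebra.Properties.CommutativeSemigroup as CommutativeSemigroupProperties
import Algebra.Properties.Ring as RingProperties
import Algebra.Consequences.Setoid as Consequences
import Relation.Binary.Reasoning.Setoid as SetoidReasoning

infix 4 _≡_[mod_]

_≡_[mod_] : ℤ → ℤ → ℕ → Set
a ≡ b [mod m ] = + m ∣ a ℤ.- b

φ : ℕ → ℕ
φ n = length (filter (λ a → coprime? a n) (map suc (upTo n)))

-- HasOrder m k d says that ord_m(k) is defined and equal to d; such a d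
-- exists exactly when k is a unit modulo m.
record HasOrder (m : ℕ) (k : ℤ) (d : ℕ) : Set where
  field
    positive : 1 ≤ d
    power    : k ℤ.^ d ≡ 1ℤ [mod m ]
    minimal  : ∀ e → 1 ≤ e → k ℤ.^ e ≡ 1ℤ [mod m ] → d ≤ e

PrimitiveRoot : ℕ → ℤ → Set
PrimitiveRoot m g = HasOrder m g (φ m)

QuadraticResidue : ℕ → ℕ → Set
QuadraticResidue m a = Coprime a m × ∃[ x ] x ℤ.* x ≡ + a [mod m ]

QuadraticNonresidue : ℕ → ℕ → Set
QuadraticNonresidue m a = Coprime a m × ¬ (∃[ x ] x ℤ.* x ≡ + a [mod m ])

module _ {c ℓ} (R : CommutativeRing c ℓ) where

  open CommutativeRing R

  record CongruentModulo (a x y : Carrier) : Set (c ⊔ ℓ) where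
    constructor congruent
    field
      cofactor : Carrier
      equality : x - y ≈ cofactor * a

  private
    module Quotient (a : Carrier) where
      open SetoidReasoning setoid
      open RingProperties ring
        using (-‿distribˡ-*; -‿+-comm; //-rightDividesˡ; //-rightDividesʳ; \\-leftDividesʳ)
      open CommutativeSemigroupProperties +-commutativeSemigroup using (interchange)
      open CommutativeSemigroupProperties *-commutativeSemigroup using (xy∙z≈xz∙y)

      infix 4 _∼_
      _∼_ : Carrier → Carrier → Set (c ⊔ ℓ)
      _∼_ = CongruentModulo a

      ≈⇒∼ : ∀ {x y} → x ≈ y → x ∼ y
      ≈⇒∼ {x} {y} x≈y = congruent 0# (begin
        x - y   ≈⟨ +-congʳ x≈y ⟩
        y - y   ≈⟨ -‿inverseʳ y ⟩
        0#      ≈⟨ zeroˡ a ⟨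
        0# * a  ∎)

      fromSum : ∀ {x y} u → x ≈ u * a + y → x ∼ y
      fromSum {x} {y} u e = congruent u (begin
        x - y           ≈⟨ +-congʳ e ⟩
        u * a + y - y   ≈⟨ //-rightDividesʳ y (u * a) ⟩
        u * a           ∎)

      toSum : ∀ {x y} ((congruent u _) : x ∼ y) → x ≈ u * a + y
      toSum {x} {y} (congruent u e) = begin
        x           ≈⟨ //-rightDividesˡ y x ⟨
        x - y + y   ≈⟨ +-congʳ e ⟩
        u * a + y   ∎

      ∼-sym : ∀ {x y} → x ∼ y → y ∼ x
      ∼-sym {x} {y} x∼y@(congruent u _) = fromSum (- u) (begin
        y                        ≈⟨ \\-leftDividesʳ (u * a) y ⟨
        - (u * a) + (u * a + y)  ≈⟨ +-cong (-‿distribˡ-* u a) (sym (toSum x∼y)) ⟩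
        - u * a + x              ∎)

      ∼-trans : ∀ {x y z} → x ∼ y → y ∼ z → x ∼ z
      ∼-trans {x} {y} {z} x∼y@(congruent u _) y∼z@(congruent v _) = fromSum (u + v) (begin
        x                    ≈⟨ toSum x∼y ⟩
        u * a + y            ≈⟨ +-congˡ (toSum y∼z) ⟩
        u * a + (v * a + z)  ≈⟨ +-assoc (u * a) (v * a) z ⟨
        u * a + v * a + z    ≈⟨ +-congʳ (distribʳ a u v) ⟨
        (u + v) * a + z      ∎)

      ∼-+-cong : ∀ {x y u v} → x ∼ y → u ∼ v → x + u ∼ y + v
      ∼-+-cong {x} {y} {u} {v} x∼y@(congruent r _) u∼v@(congruent s _) = fromSum (r + s) (begin
        x + u                      ≈⟨ +-cong (toSum x∼y) (toSum u∼v) ⟩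
        (r * a + y) + (s * a + v)  ≈⟨ interchange (r * a) y (s * a) v ⟩
        (r * a + s * a) + (y + v)  ≈⟨ +-congʳ (distribʳ a r s) ⟨
        (r + s) * a + (y + v)      ∎)

      ∼-*-congʳ : ∀ u {x y} → x ∼ y → x * u ∼ y * u
      ∼-*-congʳ u {x} {y} x∼y@(congruent r _) = fromSum (r * u) (begin
        x * u              ≈⟨ *-congʳ (toSum x∼y) ⟩
        (r * a + y) * u    ≈⟨ distribʳ u (r * a) y ⟩
        r * a * u + y * u  ≈⟨ +-congʳ (xy∙z≈xz∙y r a u) ⟩
        r * u * a + y * u  ∎)

      ∼-*-cong : ∀ {x y u v} → x ∼ y → u ∼ v → x * u ∼ y * v
      ∼-*-cong {x} {y} {u} {v} x∼y u∼v =
        ∼-trans (∼-*-congʳ u x∼y)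
          (∼-trans (≈⇒∼ (*-comm y u)) (∼-trans (∼-*-congʳ y u∼v) (≈⇒∼ (*-comm v y))))

      ∼-neg-cong : ∀ {x y} → x ∼ y → - x ∼ - y
      ∼-neg-cong {x} {y} x∼y@(congruent u _) = fromSum (- u) (begin
        - x              ≈⟨ -‿cong (toSum x∼y) ⟩
        - (u * a + y)    ≈⟨ -‿+-comm (u * a) y ⟨
        - (u * a) + - y  ≈⟨ +-congʳ (-‿distribˡ-* u a) ⟩
        - u * a + - y    ∎)

  infixl 7 _/⟨_⟩

  _/⟨_⟩ : Carrier → CommutativeRing c (c ⊔ ℓ)
  _/⟨_⟩ a = record
    { Carrier = Carrier
    ; _≈_ = CongruentModulo a
    ; _+_ = _+_
    ; _*_ = _*_
    ; -_  = -_
    ; 0#  = 0#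
    ; 1#  = 1#
    ; isCommutativeRing = record
      { isRing = record
        { +-isAbelianGroup = record
          { isGroup = record
            { isMonoid = record
              { isSemigroup = record
                { isMagma = record
                  { isEquivalence = record
                    { refl  = ≈⇒∼ (refl)
                    ; sym   = ∼-sym
                    ; trans = ∼-trans
                    }
                  ; ∙-cong = ∼-+-cong
                  }
                ; assoc = λ x y z → ≈⇒∼ (+-assoc x y z)
                }
              ; identity = (λ x → ≈⇒∼ (+-identityˡ x)) , (λ x → ≈⇒∼ (+-identityʳ x))
              }
            ; inverse = (λ x → ≈⇒∼ (-‿inverseˡ x)) , (λ x → ≈⇒∼ (-‿inverseʳ x))
            ; ⁻¹-cong = ∼-neg-cong
            }
          ; comm = λ x y → ≈⇒∼ (+-comm x y)
          }
        ; *-cong     = ∼-*-cong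
        ; *-assoc    = λ x y z → ≈⇒∼ (*-assoc x y z)
        ; *-identity = (λ x → ≈⇒∼ (*-identityˡ x)) , (λ x → ≈⇒∼ (*-identityʳ x))
        ; distrib    = (λ x y z → ≈⇒∼ (distribˡ x y z)) , (λ x y z → ≈⇒∼ (distribʳ x y z))
        }
      ; *-comm = λ x y → ≈⇒∼ (*-comm x y)
      }
    }
    where open Quotient a

-- Coefficient lists start with the constant coefficient; trailing zeros are
-- allowed and ignored by the equality.
module Polynomials {c ℓ} (R : CommutativeRing c ℓ) where

  open CommutativeRing R
  private module R = CommutativeRing R

  Poly : Set c
  Poly = List Carrier

  coeff : Poly → ℕ → Carrier
  coeff []      _       = 0#
  coeff (a ∷ f) zero    = a
  coeff (a ∷ f) (suc k) = coeff f k

  infix  4 _≈ₚ_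
  infixl 6 _+ₚ_
  infixl 7 _*ₚ_
  infixr 8 _·ₚ_

  record _≈ₚ_ (f g : Poly) : Set ℓ where
    constructor coefficientwise
    field
      at : ∀ k → coeff f k ≈ coeff g k

  open _≈ₚ_ public

  _+ₚ_ : Poly → Poly → Poly
  []      +ₚ g       = g
  (a ∷ f) +ₚ []      = a ∷ f
  (a ∷ f) +ₚ (b ∷ g) = a + b ∷ f +ₚ g

  _·ₚ_ : Carrier → Poly → Poly
  a ·ₚ f = map (a *_) f

  -ₚ_ : Poly → Poly
  -ₚ_ = map (-_)

  _*ₚ_ : Poly → Poly → Poly
  []      *ₚ g = []
  (a ∷ f) *ₚ g = a ·ₚ g +ₚ (0# ∷ f *ₚ g)

  1ₚ : Poly
  1ₚ = 1# ∷ []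

  X^_ : ℕ → Poly
  X^ k = replicate k 0# ++ 1# ∷ []

  coeff-+ : ∀ f g k → coeff (f +ₚ g) k ≈ coeff f k + coeff g k
  coeff-+ []      g       k       = sym (+-identityˡ _)
  coeff-+ (a ∷ f) []      k       = sym (+-identityʳ _)
  coeff-+ (a ∷ f) (b ∷ g) zero    = R.refl
  coeff-+ (a ∷ f) (b ∷ g) (suc k) = coeff-+ f g k

  coeff-· : ∀ a f k → coeff (a ·ₚ f) k ≈ a * coeff f k
  coeff-· a []      k       = sym (zeroʳ a)
  coeff-· a (b ∷ f) zero    = R.refl
  coeff-· a (b ∷ f) (suc k) = coeff-· a f k

  coeff-neg : ∀ f k → coeff (-ₚ f) k ≈ - coeff f k
  coeff-neg []      k       = sym -0#≈0#
    where open RingProperties ring using (-0#≈0#)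
  coeff-neg (a ∷ f) zero    = R.refl
  coeff-neg (a ∷ f) (suc k) = coeff-neg f k

  private
    ≈ₚ-refl : ∀ {f} → f ≈ₚ f
    ≈ₚ-refl = coefficientwise λ _ → R.refl

    ≈ₚ-sym : ∀ {f g} → f ≈ₚ g → g ≈ₚ f
    ≈ₚ-sym e = coefficientwise λ k → sym (at e k)

    ≈ₚ-trans : ∀ {f g h} → f ≈ₚ g → g ≈ₚ h → f ≈ₚ h
    ≈ₚ-trans e e′ = coefficientwise λ k → trans (at e k) (at e′ k)

    ∷-cong : ∀ {a b f g} → a ≈ b → f ≈ₚ g → (a ∷ f) ≈ₚ (b ∷ g)
    ∷-cong e e′ = coefficientwise λ { zero → e ; (suc k) → at e′ k }

    0∷[] : (0# ∷ []) ≈ₚ []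
    0∷[] = coefficientwise λ { zero → R.refl ; (suc k) → R.refl }

    +ₚ-cong : ∀ {f f′ g g′} → f ≈ₚ f′ → g ≈ₚ g′ → f +ₚ g ≈ₚ f′ +ₚ g′
    +ₚ-cong {f} {f′} {g} {g′} e e′ = coefficientwise λ k →
      trans (coeff-+ f g k) (trans (+-cong (at e k) (at e′ k)) (sym (coeff-+ f′ g′ k)))

    +ₚ-assoc : ∀ f g h → (f +ₚ g) +ₚ h ≈ₚ f +ₚ (g +ₚ h)
    +ₚ-assoc f g h = coefficientwise λ k →
      trans (coeff-+ (f +ₚ g) h k) (trans (+-congʳ (coeff-+ f g k))
        (trans (+-assoc _ _ _)
          (sym (trans (coeff-+ f (g +ₚ h) k) (+-congˡ (coeff-+ g h k))))))

    +ₚ-comm : ∀ f g → f +ₚ g ≈ₚ g +ₚ f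
    +ₚ-comm f g = coefficientwise λ k →
      trans (coeff-+ f g k) (trans (+-comm _ _) (sym (coeff-+ g f k)))

    +ₚ-identityʳ : ∀ f → f +ₚ [] ≈ₚ f
    +ₚ-identityʳ f = +ₚ-comm f []

    -ₚ-cong : ∀ {f g} → f ≈ₚ g → -ₚ f ≈ₚ -ₚ g
    -ₚ-cong {f} {g} e = coefficientwise λ k →
      trans (coeff-neg f k) (trans (-‿cong (at e k)) (sym (coeff-neg g k)))

    -ₚ-inverseʳ : ∀ f → f +ₚ (-ₚ f) ≈ₚ []
    -ₚ-inverseʳ f = coefficientwise λ k →
      trans (coeff-+ f (-ₚ f) k) (trans (+-congˡ (coeff-neg f k)) (-‿inverseʳ _))

    -ₚ-inverseˡ : ∀ f → (-ₚ f) +ₚ f ≈ₚ []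
    -ₚ-inverseˡ f = ≈ₚ-trans (+ₚ-comm (-ₚ f) f) (-ₚ-inverseʳ f)

  +ₚ-0-abelianGroup : AbelianGroup c ℓ
  +ₚ-0-abelianGroup = record
    { Carrier = Poly
    ; _≈_ = _≈ₚ_
    ; _∙_ = _+ₚ_
    ; ε   = []
    ; _⁻¹ = -ₚ_
    ; isAbelianGroup = record
      { isGroup = record
        { isMonoid = record
          { isSemigroup = record
            { isMagma = record
              { isEquivalence = record { refl = ≈ₚ-refl ; sym = ≈ₚ-sym ; trans = ≈ₚ-trans }
              ; ∙-cong = +ₚ-cong
              }
            ; assoc = +ₚ-assoc
            }
          ; identity = (λ _ → ≈ₚ-refl) , +ₚ-identityʳ
          }
        ; inverse = -ₚ-inverseˡ , -ₚ-inverseʳ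
        ; ⁻¹-cong = -ₚ-cong
        }
      ; comm = +ₚ-comm
      }
    }

  private
    open module G = AbelianGroup +ₚ-0-abelianGroup
      using () renaming (setoid to setoidₚ; ∙-congˡ to +ₚ-congˡ; ∙-congʳ to +ₚ-congʳ)
    open SetoidReasoning setoidₚ
    open CommutativeSemigroupProperties G.commutativeSemigroup
      using (interchange; x∙yz≈y∙xz)

    ·-cong : ∀ {a b f g} → a ≈ b → f ≈ₚ g → a ·ₚ f ≈ₚ b ·ₚ g
    ·-cong {a} {b} {f} {g} e e′ = coefficientwise λ k →
      trans (coeff-· a f k) (trans (*-cong e (at e′ k)) (sym (coeff-· b g k)))

    ·-distribˡ : ∀ a f g → a ·ₚ (f +ₚ g) ≈ₚ a ·ₚ f +ₚ a ·ₚ g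
    ·-distribˡ a f g = coefficientwise λ k →
      trans (coeff-· a (f +ₚ g) k) (trans (*-congˡ (coeff-+ f g k)) (trans (distribˡ a _ _)
        (sym (trans (coeff-+ (a ·ₚ f) (a ·ₚ g) k) (+-cong (coeff-· a f k) (coeff-· a g k))))))

    ·-assoc : ∀ a b f → a ·ₚ b ·ₚ f ≈ₚ (a * b) ·ₚ f
    ·-assoc a b f = coefficientwise λ k →
      trans (coeff-· a (b ·ₚ f) k) (trans (*-congˡ (coeff-· b f k))
        (trans (sym (*-assoc a b _)) (sym (coeff-· (a * b) f k))))

    ·-zeroˡ : ∀ f → 0# ·ₚ f ≈ₚ []
    ·-zeroˡ f = coefficientwise λ k → trans (coeff-· 0# f k) (zeroˡ _)

    ·-identityˡ : ∀ f → 1# ·ₚ f ≈ₚ f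
    ·-identityˡ f = coefficientwise λ k → trans (coeff-· 1# f k) (*-identityˡ _)

    shift-+ : ∀ f g → (0# ∷ f +ₚ g) ≈ₚ (0# ∷ f) +ₚ (0# ∷ g)
    shift-+ f g = ∷-cong (sym (+-identityˡ 0#)) ≈ₚ-refl

    shift-* : ∀ f g → (0# ∷ f) *ₚ g ≈ₚ (0# ∷ f *ₚ g)
    shift-* f g = +ₚ-congʳ (·-zeroˡ g)

    *ₚ-[] : ∀ f → f *ₚ [] ≈ₚ []
    *ₚ-[] []      = ≈ₚ-refl
    *ₚ-[] (a ∷ f) = ≈ₚ-trans (∷-cong R.refl (*ₚ-[] f)) 0∷[]

    *ₚ-∷ : ∀ f b g → f *ₚ (b ∷ g) ≈ₚ b ·ₚ f +ₚ (0# ∷ f *ₚ g)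
    *ₚ-∷ []      b g = ≈ₚ-sym 0∷[]
    *ₚ-∷ (a ∷ f) b g = ∷-cong (+-congʳ (*-comm a b)) (begin
      a ·ₚ g +ₚ f *ₚ (b ∷ g)              ≈⟨ +ₚ-congˡ (*ₚ-∷ f b g) ⟩
      a ·ₚ g +ₚ (b ·ₚ f +ₚ (0# ∷ f *ₚ g)) ≈⟨ x∙yz≈y∙xz (a ·ₚ g) (b ·ₚ f) _ ⟩
      b ·ₚ f +ₚ (a ·ₚ g +ₚ (0# ∷ f *ₚ g)) ∎)

    *ₚ-comm : ∀ f g → f *ₚ g ≈ₚ g *ₚ f
    *ₚ-comm []      g = ≈ₚ-sym (*ₚ-[] g)
    *ₚ-comm (a ∷ f) g = begin
      a ·ₚ g +ₚ (0# ∷ f *ₚ g)  ≈⟨ +ₚ-congˡ (∷-cong R.refl (*ₚ-comm f g)) ⟩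
      a ·ₚ g +ₚ (0# ∷ g *ₚ f)  ≈⟨ *ₚ-∷ g a f ⟨
      g *ₚ (a ∷ f)             ∎

    *ₚ-congˡ : ∀ f {g h} → g ≈ₚ h → f *ₚ g ≈ₚ f *ₚ h
    *ₚ-congˡ []      e = ≈ₚ-refl
    *ₚ-congˡ (a ∷ f) e = +ₚ-cong (·-cong R.refl e) (∷-cong R.refl (*ₚ-congˡ f e))

    *ₚ-cong : ∀ {f f′ g g′} → f ≈ₚ f′ → g ≈ₚ g′ → f *ₚ g ≈ₚ f′ *ₚ g′
    *ₚ-cong {f} {f′} {g} {g′} e e′ = begin
      f *ₚ g    ≈⟨ *ₚ-congˡ f e′ ⟩
      f *ₚ g′   ≈⟨ *ₚ-comm f g′ ⟩
      g′ *ₚ f   ≈⟨ *ₚ-congˡ g′ e ⟩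
      g′ *ₚ f′  ≈⟨ *ₚ-comm g′ f′ ⟩
      f′ *ₚ g′  ∎

    *ₚ-distribˡ : ∀ f g h → f *ₚ (g +ₚ h) ≈ₚ f *ₚ g +ₚ f *ₚ h
    *ₚ-distribˡ []      g h = ≈ₚ-refl
    *ₚ-distribˡ (a ∷ f) g h = begin
      a ·ₚ (g +ₚ h) +ₚ (0# ∷ f *ₚ (g +ₚ h))
        ≈⟨ +ₚ-cong (·-distribˡ a g h) (∷-cong R.refl (*ₚ-distribˡ f g h)) ⟩
      (a ·ₚ g +ₚ a ·ₚ h) +ₚ (0# ∷ f *ₚ g +ₚ f *ₚ h)
        ≈⟨ +ₚ-congˡ (shift-+ (f *ₚ g) (f *ₚ h)) ⟩
      (a ·ₚ g +ₚ a ·ₚ h) +ₚ ((0# ∷ f *ₚ g) +ₚ (0# ∷ f *ₚ h))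
        ≈⟨ interchange (a ·ₚ g) (a ·ₚ h) _ _ ⟩
      (a ·ₚ g +ₚ (0# ∷ f *ₚ g)) +ₚ (a ·ₚ h +ₚ (0# ∷ f *ₚ h)) ∎

    *ₚ-distrib : (∀ f g h → f *ₚ (g +ₚ h) ≈ₚ f *ₚ g +ₚ f *ₚ h)
               × (∀ f g h → (g +ₚ h) *ₚ f ≈ₚ g *ₚ f +ₚ h *ₚ f)
    *ₚ-distrib = Consequences.comm∧distrˡ⇒distr setoidₚ +ₚ-cong *ₚ-comm *ₚ-distribˡ

    ·-*ₚ : ∀ a f g → a ·ₚ (f *ₚ g) ≈ₚ (a ·ₚ f) *ₚ g
    ·-*ₚ a []      g = ≈ₚ-refl
    ·-*ₚ a (b ∷ f) g = begin
      a ·ₚ (b ·ₚ g +ₚ (0# ∷ f *ₚ g))         ≈⟨ ·-distribˡ a (b ·ₚ g) _ ⟩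
      a ·ₚ b ·ₚ g +ₚ (a * 0# ∷ a ·ₚ (f *ₚ g))  ≈⟨ +ₚ-cong (·-assoc a b g) (∷-cong (zeroʳ a) (·-*ₚ a f g)) ⟩
      (a * b) ·ₚ g +ₚ (0# ∷ (a ·ₚ f) *ₚ g)   ∎

    *ₚ-assoc : ∀ f g h → (f *ₚ g) *ₚ h ≈ₚ f *ₚ (g *ₚ h)
    *ₚ-assoc []      g h = ≈ₚ-refl
    *ₚ-assoc (a ∷ f) g h = begin
      (a ·ₚ g +ₚ (0# ∷ f *ₚ g)) *ₚ h             ≈⟨ proj₂ *ₚ-distrib h (a ·ₚ g) (0# ∷ f *ₚ g) ⟩
      (a ·ₚ g) *ₚ h +ₚ (0# ∷ f *ₚ g) *ₚ h        ≈⟨ +ₚ-cong (≈ₚ-sym (·-*ₚ a g h)) (shift-* (f *ₚ g) h) ⟩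
      a ·ₚ (g *ₚ h) +ₚ (0# ∷ (f *ₚ g) *ₚ h)      ≈⟨ +ₚ-congˡ (∷-cong R.refl (*ₚ-assoc f g h)) ⟩
      a ·ₚ (g *ₚ h) +ₚ (0# ∷ f *ₚ (g *ₚ h))      ∎

    *ₚ-identityˡ : ∀ f → 1ₚ *ₚ f ≈ₚ f
    *ₚ-identityˡ f = begin
      1# ·ₚ f +ₚ (0# ∷ [])  ≈⟨ +ₚ-cong (·-identityˡ f) 0∷[] ⟩
      f +ₚ []               ≈⟨ +ₚ-identityʳ f ⟩
      f                     ∎

  polynomialRing : CommutativeRing c ℓ
  polynomialRing = record
    { Carrier = Poly
    ; _≈_ = _≈ₚ_
    ; _+_ = _+ₚ_
    ; _*_ = _*ₚ_
    ; -_  = -ₚ_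
    ; 0#  = []
    ; 1#  = 1ₚ
    ; isCommutativeRing = record
      { isRing = record
        { +-isAbelianGroup = G.isAbelianGroup
        ; *-cong     = *ₚ-cong
        ; *-assoc    = *ₚ-assoc
        ; *-identity = Consequences.comm∧idˡ⇒id setoidₚ *ₚ-comm *ₚ-identityˡ
        ; distrib    = *ₚ-distrib
        }
      ; *-comm = *ₚ-comm
      }
    }

𝔽 : ℕ → CommutativeRing 0ℓ 0ℓ
𝔽 l = ℤ.+-*-commutativeRing /⟨ + l ⟩

𝔽[x]/⟨xⁿ-1⟩ : ℕ → ℕ → CommutativeRing 0ℓ 0ℓ
𝔽[x]/⟨xⁿ-1⟩ l n = polynomialRing /⟨ X^ n +ₚ (-ₚ 1ₚ) ⟩
  where open Polynomials (𝔽 l)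

-- Fin n stands for ℤ_n through the representatives 0, …, n - 1.
module CyclotomicCosets (l n : ℕ) where

  infix 4 _∈C_ _∈C?_

  _∈C_ : Fin n → ℤ → Set
  α ∈C γ = ∃[ r ] + toℕ α ≡ γ ℤ.* (+ l) ℤ.^ r [mod n ]

  private
    module _ (α : Fin n) (γ : ℤ) where

      instance
        n≢0 : ℕ.NonZero n
        n≢0 = nonZeroIndex α

      term : ℕ → ℤ
      term r = γ ℤ.* (+ l) ℤ.^ r

      residue : ℤ → Fin n
      residue a = fromℕ< (n%ℕd<d a n)

      residue-injective : ∀ a b → residue a ≡ residue b → a ≡ b [mod n ]
      residue-injective a b e = divides (a /ℕ n ℤ.- b /ℕ n) (begin
        a ℤ.- b
          ≡⟨ ≡.cong₂ ℤ._-_ (a≡a%ℕn+[a/ℕn]*n a n) (a≡a%ℕn+[a/ℕn]*n b n) ⟩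
        (+ (a %ℕ n) ℤ.+ (a /ℕ n) ℤ.* + n) ℤ.- (+ (b %ℕ n) ℤ.+ (b /ℕ n) ℤ.* + n)
          ≡⟨ ≡.cong (λ z → (+ z ℤ.+ (a /ℕ n) ℤ.* + n) ℤ.- (+ (b %ℕ n) ℤ.+ (b /ℕ n) ℤ.* + n)) e′ ⟩
        (+ (b %ℕ n) ℤ.+ (a /ℕ n) ℤ.* + n) ℤ.- (+ (b %ℕ n) ℤ.+ (b /ℕ n) ℤ.* + n)
          ≡⟨ regroup (+ (b %ℕ n)) (a /ℕ n) (b /ℕ n) (+ n) ⟩
        (a /ℕ n ℤ.- b /ℕ n) ℤ.* + n ∎)
        where
        open ≡.≡-Reasoning
        e′ : a %ℕ n ≡ b %ℕ n
        e′ = ≡.trans (≡.sym (toℕ-fromℕ< _)) (≡.trans (≡.cong toℕ e) (toℕ-fromℕ< _))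
        regroup : ∀ u x y m → (u ℤ.+ x ℤ.* m) ℤ.- (u ℤ.+ y ℤ.* m) ≡ (x ℤ.- y) ℤ.* m
        regroup = solve-∀

      term-+ : ∀ i d → term (i ℕ.+ d) ≡ term i ℤ.* (+ l) ℤ.^ d
      term-+ i d = ≡.trans (≡.cong (γ ℤ.*_) (ℤ.^-distribˡ-+-* (+ l) i d))
                           (≡.sym (ℤ.*-assoc γ _ _))

      shorten : ∀ i j d → term i ≡ term j [mod n ] →
                + toℕ α ≡ term (j ℕ.+ d) [mod n ] → + toℕ α ≡ term (i ℕ.+ d) [mod n ]
      shorten i j d (divides u e) (divides v e′) = divides (v ℤ.- u ℤ.* L) (begin
        A ℤ.- term (i ℕ.+ d)
          ≡⟨ ≡.cong (λ x → A ℤ.- x) (term-+ i d) ⟩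
        A ℤ.- term i ℤ.* L
          ≡⟨ split A (term i) (term j) L ⟩
        (A ℤ.- term j ℤ.* L) ℤ.- (term i ℤ.- term j) ℤ.* L
          ≡⟨ ≡.cong₂ (λ x y → (A ℤ.- x) ℤ.- y ℤ.* L) (≡.sym (term-+ j d)) e ⟩
        (A ℤ.- term (j ℕ.+ d)) ℤ.- (u ℤ.* + n) ℤ.* L
          ≡⟨ ≡.cong (λ x → x ℤ.- (u ℤ.* + n) ℤ.* L) e′ ⟩
        v ℤ.* + n ℤ.- (u ℤ.* + n) ℤ.* L
          ≡⟨ factor u v L (+ n) ⟩
        (v ℤ.- u ℤ.* L) ℤ.* + n ∎)
        where
        open ≡.≡-Reasoning
        A L : ℤ
        A = + toℕ α
        L = (+ l) ℤ.^ d
        split : ∀ a x y z → a ℤ.- x ℤ.* z ≡ (a ℤ.- y ℤ.* z) ℤ.- (x ℤ.- y) ℤ.* z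
        split = solve-∀
        factor : ∀ u v z m → v ℤ.* m ℤ.- (u ℤ.* m) ℤ.* z ≡ (v ℤ.- u ℤ.* z) ℤ.* m
        factor = solve-∀

      Bounded : Set
      Bounded = ∃ λ (r : Fin n) → + toℕ α ≡ term (toℕ r) [mod n ]

      bound : ∀ r → + toℕ α ≡ term r [mod n ] → Bounded
      bound = <-rec _ step
        where
        step : ∀ r → (∀ {r′} → r′ < r → + toℕ α ≡ term r′ [mod n ] → Bounded) →
               + toℕ α ≡ term r [mod n ] → Bounded
        step r rec e with r ℕ.<? n
        ... | yes r<n = fromℕ< r<n , ≡.subst (λ r → + toℕ α ≡ term r [mod n ]) (≡.sym (toℕ-fromℕ< r<n)) e
        ... | no  r≮n
          with i , j , i<j , eq ← pigeonhole (ℕ.n<1+n n) (λ (i : Fin (suc n)) → residue (term (toℕ i)))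
          = rec (≡.subst (toℕ i ℕ.+ d <_) j+d≡r (ℕ.+-monoˡ-< d i<j))
              (shorten (toℕ i) (toℕ j) d (residue-injective (term (toℕ i)) (term (toℕ j)) eq)
                (≡.subst (λ r → + toℕ α ≡ term r [mod n ]) (≡.sym j+d≡r) e))
          where
          d : ℕ
          d = r ∸ toℕ j
          j+d≡r : toℕ j ℕ.+ d ≡ r
          j+d≡r = ℕ.m+[n∸m]≡n (ℕ.≤-trans (ℕ.s≤s⁻¹ (toℕ<n j)) (ℕ.≮⇒≥ r≮n))

  -- Among the exponents r ≥ 0, those below n already give the whole coset.
  _∈C?_ : ∀ α γ → Dec (α ∈C γ)
  α ∈C? γ = map′ (λ (r , e) → toℕ r , e) (λ (r , e) → bound α γ r e)
    (any? λ r → + n ∣? (+ toℕ α ℤ.- γ ℤ.* (+ l) ℤ.^ toℕ r))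

module CosetPolynomials (l n : ℕ) where

  open CommutativeRing (𝔽[x]/⟨xⁿ-1⟩ l n) public
    using () renaming (Carrier to A; _≈_ to _≈ᴬ_; _+_ to _+ᴬ_; _*_ to _*ᴬ_; 0# to 0ᴬ)
  open Polynomials (𝔽 l) using (X^_; _·ₚ_)
  open CyclotomicCosets l n

  infixr 8 _·_

  -- The carrier of 𝔽 l is ℤ, so + m is the class of m in 𝔽_l.
  _·_ : ℕ → A → A
  m · f = (+ m) ·ₚ f

  ∑ : ∀ {I : Set} → List I → (I → A) → A
  ∑ is f = foldr _+ᴬ_ 0ᴬ (map f is)

  cosetSum : ℤ → A
  cosetSum γ = ∑ (filter (_∈C? γ) (allFin n)) (λ α → X^ toℕ α)

module Notation (s t p q l : ℕ) (g : ℤ) where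

  open CosetPolynomials l (p ℕ.^ s ℕ.* q ℕ.^ t) public

  χ χ* : ℕ → ℕ → A
  χ  i j = cosetSum (+ (p ℕ.^ i ℕ.* q ℕ.^ j))
  χ* i j = cosetSum (+ (p ℕ.^ i ℕ.* q ℕ.^ j) ℤ.* g)

module Submission where

-- In 𝔽_l[x]/(xⁿ - 1) the product χ*_ij χ_ij' is the sum of N(c) x^c, where N(c) counts the
-- b ∈ C_ij' with c - b ∈ C*_ij. The powers of l modulo p^s form a subgroup of index 2 that omits -1
-- (its order is odd since p ≡ 3 mod 4), while l generates the units modulo q^t; combining the
-- exponents by the Chinese remainder theorem, p^i q^j w lies in C_ij or in C*_ij according to
-- whether w or -w is a power of l modulo p, for w prime to p and q. Since j < j', N(c) vanishes unless
-- c = p^i q^j c' with q ∤ c', and then N(c) is p^(s-i-1) φ(q^(t-j')) times the number of w modulo p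
-- for which both w and q^(j'-j) w - c' are residues. That number follows from symmetry: R(v) R(v - c)
-- summed over v is unchanged by c ↦ -c and by scaling c with a residue, so it is constant on
-- units, and its total over all c is the square of the number of residues.

open import Algebra.Bundles using (CommutativeMonoid; CommutativeRing)
import Algebra.Properties.CommutativeMonoid.Sum as CommutativeMonoidSum
import Algebra.Properties.CommutativeSemigroup as CommutativeSemigroupProperties
import Algebra.Properties.Semiring.Sum as SemiringSum
open import Data.Bool using (true; false; if_then_else_)
open import Data.Empty using (⊥-elim)
open import Data.Fin as Fin using (Fin; toℕ; fromℕ<; splitAt; join)
open import Data.Fin.Permutation using (permutation)
import Data.Fin.Properties as Fin
open import Data.Integer as ℤ using (ℤ; +_; -[1+_]; 0ℤ; 1ℤ; ∣_∣)
open import Data.Integer.DivMod using (_%ℕ_; _/ℕ_; n%ℕd<d; a≡a%ℕn+[a/ℕn]*n)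
import Data.Integer.Divisibility.Signed as Signed
import Data.Integer.Properties as ℤ
open import Data.Integer.Tactic.RingSolver using (solve-∀)
open import Data.List as List using (List; []; _∷_; _++_; filter; foldr; length; map; tabulate; upTo; applyUpTo)
open import Data.List.Membership.Propositional using (_∈_)
open import Data.List.Membership.Propositional.Properties using (∈-filter⁺; ∈-map⁺; ∈-upTo⁺)
import Data.List.Properties as List
import Data.List.Relation.Unary.All.Properties as All
open import Data.List.Relation.Unary.Any using (index)
open import Data.List.Relation.Unary.Any.Properties using (lookup-index)
open import Data.Nat as ℕ using (ℕ; zero; suc; NonZero; _^_; _∸_)
open import Data.Nat.Coprimality as Coprimality using (Coprime; prime⇒coprime)
import Data.Nat.Divisibility as ∣
import Data.Nat.DivMod as ℕ
open import Data.Nat.GCD using (gcd; gcd-greatest; module Bézout)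
open import Data.Nat.Primality using (Prime; prime⇒irreducible; prime⇒nonTrivial; prime⇒nonZero)
import Data.Nat.Properties as ℕ
import Data.Nat.Tactic.RingSolver as ℕSolver
open import Data.Product using (∃-syntax; _×_; _,_; proj₁; proj₂)
open import Data.Sum using (_⊎_; inj₁; inj₂; [_,_]′)
open import Function using (_$_; _∘_; id)
open import Level using (0ℓ)
open import Relation.Binary using (tri<; tri≈; tri>)
open import Relation.Binary.PropositionalEquality as ≡ using (_≡_; _≢_; refl)
import Relation.Binary.Reasoning.Setoid as SetoidReasoning
open import Relation.Nullary using (Dec; yes; no; ¬_; does)
open import Relation.Nullary.Decidable using (map′)
open import Relation.Unary using (Pred; Decidable)
open import Defs

-- Congruences and units

-- On the p-side g, being of order twice that of l, is not a power of l, and neither is -1. Hence -g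
-- is a power of l, and w lies in g times the powers of l exactly when -w is itself a power; this is
-- how g turns into a sign. On the q-side the powers of l fill all units, so g leaves no trace
-- there. The strict inequality j < j' uncouples the two primes: q divides q^(j'-j), so c' -
-- q^(j'-j) w is prime to q for every w as soon as c' is. The condition at q then only restricts w
-- itself and contributes the constant φ(q^(t-j')), while the interaction of the two cosets takes
-- place modulo p. Describing the class R by powers of l rather than by squares gives products and
-- the lift from p to p^s directly; squares appear only when q^(j'-j) has to be classified. If
-- q^(j'-j) is a nonresidue, the count concerns sums of two elements of R instead of differences; it
-- is deduced from the count of differences. The two counts behave differently at c' divisible by p:
-- all of R contributes for differences, nothing for sums. This is why a tail over k > i occurs in
-- one formula and not in the other.

infix 4 _≋_[_]

-- Equivalent to `_≡_[mod_]`, but taken as the equality of `𝔽 m`, so that the laws of that ring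
-- serve as the calculus of congruences.
_≋_[_] : ℤ → ℤ → ℕ → Set
x ≋ y [ m ] = CommutativeRing._≈_ (𝔽 m) x y

module _ {m : ℕ} where
  open CommutativeRing (𝔽 m) public using () renaming
    ( refl to ≋-refl ; sym to ≋-sym ; trans to ≋-trans ; reflexive to ≡⇒≋
    ; +-cong to ≋-+ ; *-cong to ≋-* ; *-congˡ to ≋-*ˡ ; *-congʳ to ≋-*ʳ ; -‿cong to ≋-neg )

  from-mod : ∀ {x y} → x ≡ y [mod m ] → x ≋ y [ m ]
  from-mod (Signed.divides c e) = congruent c e

  to-mod : ∀ {x y} → x ≋ y [ m ] → x ≡ y [mod m ]
  to-mod (congruent c e) = Signed.divides c e

  ≋-^ : ∀ {x y} → x ≋ y [ m ] → ∀ k → x ℤ.^ k ≋ y ℤ.^ k [ m ]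
  ≋-^ e zero    = ≋-refl
  ≋-^ e (suc k) = ≋-* e (≋-^ e k)

  abstract
    ≋-dec : ∀ x y → Dec (x ≋ y [ m ])
    ≋-dec x y = map′ from-mod to-mod (+ m Signed.∣? x ℤ.- y)

module ≋-Reasoning (m : ℕ) = SetoidReasoning (CommutativeRing.setoid (𝔽 m))

m≋0 : ∀ {m} → + m ≋ 0ℤ [ m ]
m≋0 {m} = congruent 1ℤ (≡.trans (ℤ.+-identityʳ (+ m)) (≡.sym (ℤ.*-identityˡ (+ m))))

≋-∣ : ∀ {d m x y} → d ∣.∣ m → x ≋ y [ m ] → x ≋ y [ d ]
≋-∣ {d} (∣.divides k refl) (congruent c e) = congruent (c ℤ.* + k)
  (≡.trans e (≡.trans (≡.cong (c ℤ.*_) (ℤ.pos-* k d)) (≡.sym (ℤ.*-assoc c (+ k) (+ d)))))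

≋0⇒∣ : ∀ {m x} → x ≋ 0ℤ [ m ] → ∃[ c ] x ≡ + m ℤ.* c
≋0⇒∣ {m} {x} (congruent c e) = c , ≡.trans (≡.sym (ℤ.+-identityʳ x)) (≡.trans e (ℤ.*-comm c (+ m)))

≋-scale : ∀ d {m x y} → x ≋ y [ m ] → + d ℤ.* x ≋ + d ℤ.* y [ d ℕ.* m ]
≋-scale d {m} {x} {y} (congruent c e) = congruent c (begin
  + d ℤ.* x ℤ.- + d ℤ.* y   ≡⟨ factor (+ d) x y ⟩
  + d ℤ.* (x ℤ.- y)         ≡⟨ ≡.cong (+ d ℤ.*_) e ⟩
  + d ℤ.* (c ℤ.* + m)       ≡⟨ swap (+ d) c (+ m) ⟩
  c ℤ.* (+ d ℤ.* + m)       ≡⟨ ≡.cong (c ℤ.*_) (ℤ.pos-* d m) ⟨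
  c ℤ.* + (d ℕ.* m)         ∎)
  where
  open ≡.≡-Reasoning
  factor : ∀ d x y → d ℤ.* x ℤ.- d ℤ.* y ≡ d ℤ.* (x ℤ.- y)
  factor = solve-∀
  swap : ∀ d c m → d ℤ.* (c ℤ.* m) ≡ c ℤ.* (d ℤ.* m)
  swap = solve-∀

≋-unscale : ∀ d .{{_ : NonZero d}} {m x y} → + d ℤ.* x ≋ + d ℤ.* y [ d ℕ.* m ] → x ≋ y [ m ]
≋-unscale d@(suc _) {m} {x} {y} (congruent c e) = congruent c (ℤ.*-cancelˡ-≡ (+ d) _ _ (begin
  + d ℤ.* (x ℤ.- y)         ≡⟨ factor (+ d) x y ⟨
  + d ℤ.* x ℤ.- + d ℤ.* y   ≡⟨ e ⟩
  c ℤ.* + (d ℕ.* m)         ≡⟨ ≡.cong (c ℤ.*_) (ℤ.pos-* d m) ⟩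
  c ℤ.* (+ d ℤ.* + m)       ≡⟨ swap (+ d) c (+ m) ⟨
  + d ℤ.* (c ℤ.* + m)       ∎))
  where
  open ≡.≡-Reasoning
  factor : ∀ d x y → d ℤ.* x ℤ.- d ℤ.* y ≡ d ℤ.* (x ℤ.- y)
  factor = solve-∀
  swap : ∀ d c m → d ℤ.* (c ℤ.* m) ≡ c ℤ.* (d ℤ.* m)
  swap = solve-∀

-- If x - y = c a, then b divides c a; being coprime to a, it divides c.
≋-combine : ∀ {a b x y} → Coprime b a → x ≋ y [ a ] → x ≋ y [ b ] → x ≋ y [ a ℕ.* b ]
≋-combine {a} {b} {x} {y} b⊥a (congruent c e) (congruent c′ e′)
  with Signed.divides k eq ← Signed.∣ᵤ⇒∣ {+ b} {c}
      (Coprimality.coprime-divisor b⊥a (≡.subst (b ∣.∣_) (≡.trans (ℤ.abs-* c (+ a)) (ℕ.*-comm ∣ c ∣ a))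
         (Signed.∣⇒∣ᵤ (Signed.divides {+ b} {c ℤ.* + a} c′ (≡.trans (≡.sym e) e′)))))
  = congruent k (begin
  x ℤ.- y                   ≡⟨ e ⟩
  c ℤ.* + a                 ≡⟨ ≡.cong (ℤ._* + a) eq ⟩
  k ℤ.* + b ℤ.* + a         ≡⟨ swap k (+ b) (+ a) ⟩
  k ℤ.* (+ a ℤ.* + b)       ≡⟨ ≡.cong (k ℤ.*_) (ℤ.pos-* a b) ⟨
  k ℤ.* + (a ℕ.* b)         ∎)
  where
  open ≡.≡-Reasoning
  swap : ∀ k b a → k ℤ.* b ℤ.* a ≡ k ℤ.* (a ℤ.* b)
  swap = solve-∀

record Unit (m : ℕ) (x : ℤ) : Set where
  constructor unit
  field
    inverse   : ℤ
    isInverse : x ℤ.* inverse ≋ 1ℤ [ m ]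

open Unit

unit-resp : ∀ {m x y} → x ≋ y [ m ] → Unit m x → Unit m y
unit-resp e (unit z xz) = unit z $ ≋-trans (≋-*ʳ (≋-sym e)) xz

unit-∣ : ∀ {d m x} → d ∣.∣ m → Unit m x → Unit d x
unit-∣ d∣m (unit y xy) = unit y (≋-∣ d∣m xy)

unit-1 : ∀ {m} → Unit m 1ℤ
unit-1 = unit 1ℤ ≋-refl

unit-neg : ∀ {m x} → Unit m x → Unit m (ℤ.- x)
unit-neg {m} {x} (unit y xy) = unit (ℤ.- y) $ ≋-trans (≡⇒≋ (negs x y)) xy
  where
  negs : ∀ x y → ℤ.- x ℤ.* ℤ.- y ≡ x ℤ.* y
  negs = solve-∀

unit-* : ∀ {m x y} → Unit m x → Unit m y → Unit m (x ℤ.* y)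
unit-* {m} {x} {y} (unit u xu) (unit v yv) = unit (u ℤ.* v) $ ≋-trans (≡⇒≋ (regroup x y u v)) (≋-* xu yv)
  where
  regroup : ∀ x y u v → (x ℤ.* y) ℤ.* (u ℤ.* v) ≡ (x ℤ.* u) ℤ.* (y ℤ.* v)
  regroup = solve-∀

unit-factor : ∀ {m} x y → Unit m (x ℤ.* y) → Unit m y
unit-factor x y (unit z xyz) = unit (x ℤ.* z) $ ≋-trans (≡⇒≋ (regroup x y z)) xyz
  where
  regroup : ∀ x y z → y ℤ.* (x ℤ.* z) ≡ x ℤ.* y ℤ.* z
  regroup = solve-∀

unit-^ : ∀ {m x} → Unit m x → ∀ k → Unit m (x ℤ.^ k)
unit-^ u zero    = unit-1
unit-^ u (suc k) = unit-* u (unit-^ u k)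

unit-cancel : ∀ {m} x {y z} → Unit m x → x ℤ.* y ≋ x ℤ.* z [ m ] → y ≋ z [ m ]
unit-cancel {m} x {y} {z} (unit x′ xx′) e = begin
  y                    ≈⟨ expand y ⟩
  x′ ℤ.* (x ℤ.* y)     ≈⟨ ≋-*ˡ {x = x′} e ⟩
  x′ ℤ.* (x ℤ.* z)     ≈⟨ expand z ⟨
  z                    ∎
  where
  open ≋-Reasoning m
  regroup : ∀ x y z → (x ℤ.* y) ℤ.* z ≡ y ℤ.* (x ℤ.* z)
  regroup = solve-∀
  expand : ∀ y → y ≋ x′ ℤ.* (x ℤ.* y) [ m ]
  expand y = ≋-trans (≋-sym (≋-trans (≋-*ʳ xx′) (≡⇒≋ (ℤ.*-identityˡ y)))) (≡⇒≋ (regroup x x′ y))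

coprime⇒unit : ∀ {m} x → Coprime ∣ x ∣ m → Unit m x
coprime⇒unit {m} -[1+ n ] c = unit-neg {x = + suc n} (coprime⇒unit (+ suc n) c)
coprime⇒unit {m} (+ n)    c with Coprimality.coprime-Bézout c
... | Bézout.+- a b eq = unit (+ a) $ congruent (+ b) (begin
  + n ℤ.* + a ℤ.- 1ℤ              ≡⟨ ≡.cong (ℤ._- 1ℤ)
      (≡.trans (ℤ.*-comm (+ n) (+ a)) (≡.trans (≡.sym (ℤ.pos-* a n)) (≡.cong +_ (≡.sym eq)))) ⟩
  + (1 ℕ.+ b ℕ.* m) ℤ.- 1ℤ        ≡⟨ cancel (+ (b ℕ.* m)) ⟩
  + (b ℕ.* m)                     ≡⟨ ℤ.pos-* b m ⟩
  + b ℤ.* + m                     ∎)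
  where
  open ≡.≡-Reasoning
  cancel : ∀ x → (1ℤ ℤ.+ x) ℤ.- 1ℤ ≡ x
  cancel = solve-∀
... | Bézout.-+ a b eq = unit (ℤ.- + a) $ congruent (ℤ.- + b) (begin
  + n ℤ.* ℤ.- + a ℤ.- 1ℤ          ≡⟨ out (+ n) (+ a) ⟩
  ℤ.- (1ℤ ℤ.+ + a ℤ.* + n)        ≡⟨ ≡.cong (λ z → ℤ.- (1ℤ ℤ.+ z)) (ℤ.pos-* a n) ⟨
  ℤ.- (+ (1 ℕ.+ a ℕ.* n))         ≡⟨ ≡.cong (λ z → ℤ.- (+ z)) eq ⟩
  ℤ.- (+ (b ℕ.* m))               ≡⟨ ≡.cong ℤ.-_ (ℤ.pos-* b m) ⟩
  ℤ.- (+ b ℤ.* + m)               ≡⟨ ℤ.neg-distribˡ-* (+ b) (+ m) ⟩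
  ℤ.- + b ℤ.* + m                 ∎)
  where
  open ≡.≡-Reasoning
  out : ∀ n a → n ℤ.* ℤ.- a ℤ.- 1ℤ ≡ ℤ.- (1ℤ ℤ.+ a ℤ.* n)
  out = solve-∀

unit⇒coprime : ∀ {m x} → Unit m x → Coprime ∣ x ∣ m
unit⇒coprime {m} {x} (unit y (congruent c e)) {d} (d∣x , d∣m) = ∣.∣1⇒≡1 (Signed.∣⇒∣ᵤ (≡.subst (+ d Signed.∣_) one
    (Signed.∣m∣n⇒∣m-n (Signed.∣m⇒∣m*n y (Signed.∣ᵤ⇒∣ {+ d} {x} d∣x)) (Signed.∣n⇒∣m*n c (Signed.∣ᵤ⇒∣ {+ d} {+ m} d∣m)))))
  where
  cancel : ∀ z → z ℤ.- (z ℤ.- 1ℤ) ≡ 1ℤ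
  cancel = solve-∀
  one : x ℤ.* y ℤ.- c ℤ.* + m ≡ 1ℤ
  one = ≡.trans (≡.cong (λ z → x ℤ.* y ℤ.- z) (≡.sym e)) (cancel (x ℤ.* y))

abstract
  unit? : ∀ m x → Dec (Unit m x)
  unit? m x = map′ (coprime⇒unit x) unit⇒coprime (Coprimality.coprime? ∣ x ∣ m)

module _ (m : ℕ) .{{_ : NonZero m}} where

  residue : ℤ → Fin m
  residue x = fromℕ< (n%ℕd<d x m)

  residue-≋ : ∀ x → + toℕ (residue x) ≋ x [ m ]
  residue-≋ x = ≋-sym (congruent (x /ℕ m) (begin
    x ℤ.- + toℕ (residue x)     ≡⟨ ≡.cong (λ r → x ℤ.- + r) (Fin.toℕ-fromℕ< (n%ℕd<d x m)) ⟩
    x ℤ.- + (x %ℕ m)            ≡⟨ ≡.cong (ℤ._- + (x %ℕ m)) (a≡a%ℕn+[a/ℕn]*n x m) ⟩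
    (+ (x %ℕ m) ℤ.+ (x /ℕ m) ℤ.* + m) ℤ.- + (x %ℕ m) ≡⟨ cancel (+ (x %ℕ m)) _ ⟩
    (x /ℕ m) ℤ.* + m            ∎))
    where
    open ≡.≡-Reasoning
    cancel : ∀ r z → (r ℤ.+ z) ℤ.- r ≡ z
    cancel = solve-∀

toℕ-≋-injective : ∀ {m} (i j : Fin m) → + toℕ i ≋ + toℕ j [ m ] → i ≡ j
toℕ-≋-injective {m} i j e = Fin.toℕ-injective (ℤ.+-injective (ℤ.i-j≡0⇒i≡j (+ toℕ i) (+ toℕ j)
    (ℤ.∣i∣≡0⇒i≡0 (small (≡.subst (ℕ._< m) (≡.sym (≡.cong ∣_∣ (ℤ.m-n≡m⊖n (toℕ i) (toℕ j)))) bound)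
        (Signed.∣⇒∣ᵤ (to-mod e))))))
  where
  bound : ∣ toℕ i ℤ.⊖ toℕ j ∣ ℕ.< m
  bound = ℕ.≤-<-trans (ℤ.∣m⊝n∣≤m⊔n (toℕ i) (toℕ j)) (ℕ.⊔-lub (Fin.toℕ<n i) (Fin.toℕ<n j))
  small : ∀ {a} → a ℕ.< m → m ∣.∣ a → a ≡ 0
  small {zero}  _   _   = refl
  small {suc a} a<m m∣a = ⊥-elim (∣.>⇒∤ a<m m∣a)

residue-cong : ∀ {m} .{{_ : NonZero m}} {x y} → x ≋ y [ m ] → residue m x ≡ residue m y
residue-cong {m} {x} {y} e = toℕ-≋-injective _ _ (≋-trans (residue-≋ m x) (≋-trans e (≋-sym (residue-≋ m y))))

residue-toℕ : ∀ {m} .{{_ : NonZero m}} (i : Fin m) → residue m (+ toℕ i) ≡ i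
residue-toℕ {m} i = toℕ-≋-injective _ _ (residue-≋ m (+ toℕ i))

module _ (m : ℕ) .{{_ : NonZero m}} where

  private
    totatives : List ℕ
    totatives = filter (λ a → Coprimality.coprime? a m) (List.map suc (upTo m))

    -- `φ` counts among 1, ..., m and not among 0, ..., m - 1; hence the residue of u - 1 is taken
    -- and shifted back by one.
    representative : ℤ → ℕ
    representative u = suc (toℕ (residue m (u ℤ.- 1ℤ)))

    representative-≋ : ∀ u → + representative u ≋ u [ m ]
    representative-≋ u = ≋-trans (≋-+ {x = 1ℤ} ≋-refl (residue-≋ m (u ℤ.- 1ℤ))) (≡⇒≋ (cancel u))
      where
      cancel : ∀ u → 1ℤ ℤ.+ (u ℤ.- 1ℤ) ≡ u
      cancel = solve-∀

    representative∈totatives : ∀ {u} → Unit m u → representative u ∈ totatives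
    representative∈totatives {u} v = ∈-filter⁺ (λ a → Coprimality.coprime? a m)
      (∈-map⁺ suc (∈-upTo⁺ (Fin.toℕ<n (residue m (u ℤ.- 1ℤ)))))
      (unit⇒coprime (unit-resp (≋-sym (representative-≋ u)) v))

    class : ∀ {u} → Unit m u → Fin (φ m)
    class v = index (representative∈totatives v)

    class-injective : ∀ {u u′} (v : Unit m u) (v′ : Unit m u′) → class v ≡ class v′ → u ≋ u′ [ m ]
    class-injective {u} {u′} v v′ e = ≋-trans (≋-sym (representative-≋ u))
      (≋-trans (≡⇒≋ (≡.cong +_ same)) (representative-≋ u′))
      where
      same : representative u ≡ representative u′
      same = ≡.trans (lookup-index (representative∈totatives v))
        (≡.trans (≡.cong (List.lookup totatives) e) (≡.sym (lookup-index (representative∈totatives v′))))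

  -- Pigeonhole: u together with the values of f gives one unit more than there are classes. Since
  -- the values of f are distinct, the coincidence must involve u.
  units-exhausted : (f : Fin (φ m) → ℤ) → (∀ i → Unit m (f i)) →
                    (∀ i j → f i ≋ f j [ m ] → i ≡ j) →
                    ∀ u → Unit m u → ∃[ k ] u ≋ f k [ m ]
  units-exhausted f f-unit f-injective u v = collision (Fin.pigeonhole (ℕ.n<1+n (φ m)) h)
    where
    h : Fin (suc (φ m)) → Fin (φ m)
    h Fin.zero    = class v
    h (Fin.suc i) = class (f-unit i)
    collision : (∃[ i ] ∃[ j ] i Fin.< j × h i ≡ h j) → ∃[ k ] u ≋ f k [ m ]
    collision (Fin.zero  , Fin.suc k , _   , e) = k , class-injective v (f-unit k) e
    collision (Fin.suc i , Fin.suc j , i<j , e) =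
      ⊥-elim (ℕ.<-irrefl (≡.cong toℕ (f-injective i j (class-injective (f-unit i) (f-unit j) e))) (ℕ.s<s⁻¹ i<j))

-- Finite sums over residues

𝟙 : ∀ {P : Set} → Dec P → ℕ
𝟙 P? = if does P? then 1 else 0

𝟙-yes : ∀ {P : Set} (P? : Dec P) → P → 𝟙 P? ≡ 1
𝟙-yes (yes _) p = refl
𝟙-yes (no ¬p) p = ⊥-elim (¬p p)

𝟙-no : ∀ {P : Set} (P? : Dec P) → ¬ P → 𝟙 P? ≡ 0
𝟙-no (yes p) ¬p = ⊥-elim (¬p p)
𝟙-no (no _)  ¬p = refl

𝟙-cong : ∀ {P Q : Set} (P? : Dec P) (Q? : Dec Q) → (P → Q) → (Q → P) → 𝟙 P? ≡ 𝟙 Q?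
𝟙-cong (yes p) Q? f g = ≡.sym (𝟙-yes Q? (f p))
𝟙-cong (no ¬p) Q? f g = ≡.sym (𝟙-no Q? (¬p ∘ g))

𝟙-× : ∀ {P Q R : Set} (P? : Dec P) (Q? : Dec Q) (R? : Dec R) → (P → Q × R) → (Q → R → P) →
      𝟙 P? ≡ 𝟙 Q? ℕ.* 𝟙 R?
𝟙-× P? (yes q) (yes r) f g = 𝟙-yes P? (g q r)
𝟙-× P? (yes q) (no ¬r) f g = 𝟙-no P? (¬r ∘ proj₂ ∘ f)
𝟙-× P? (no ¬q) R?      f g = 𝟙-no P? (¬q ∘ proj₁ ∘ f)

𝟙-⊎ : ∀ {P Q R : Set} (P? : Dec P) (Q? : Dec Q) (R? : Dec R) →
      (P → Q ⊎ R) → (Q → P) → (R → P) → (Q → ¬ R) → 𝟙 P? ≡ 𝟙 Q? ℕ.+ 𝟙 R?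
𝟙-⊎ P? (yes q) (yes r) f g h disjoint = ⊥-elim (disjoint q r)
𝟙-⊎ P? (yes q) (no ¬r) f g h disjoint = 𝟙-yes P? (g q)
𝟙-⊎ P? (no ¬q) (yes r) f g h disjoint = 𝟙-yes P? (h r)
𝟙-⊎ P? (no ¬q) (no ¬r) f g h disjoint = 𝟙-no P? ([ ¬q , ¬r ]′ ∘ f)

module Summation (M : CommutativeMonoid 0ℓ 0ℓ) where
  open CommutativeMonoid M renaming (_∙_ to _⊕_; refl to ≈-refl; sym to ≈-sym; trans to ≈-trans)
  open CommutativeMonoidSum M

  -- The substitution x ↦ c + k x permutes the residues, with inverse x ↦ k′ (x - c). Every later
  -- translation, reflection or scaling of a sum is an instance.
  sum-affine : ∀ m .{{_ : NonZero m}} (f : ℤ → Carrier) → (∀ {x y} → x ≋ y [ m ] → f x ≈ f y) →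
               ∀ c k → Unit m k → sum {m} (λ i → f (c ℤ.+ k ℤ.* + toℕ i)) ≈ sum {m} (λ i → f (+ toℕ i))
  sum-affine m f f-periodic c k (unit k′ kk′) = ≈-sym (≈-trans
      (sum-permute (λ i → f (+ toℕ i)) (permutation to from to∘from from∘to))
      (sum-cong-≋ {m} (λ i → f-periodic (residue-≋ m (c ℤ.+ k ℤ.* + toℕ i)))))
    where
    to from : Fin m → Fin m
    to   i = residue m (c ℤ.+ k ℤ.* + toℕ i)
    from i = residue m (k′ ℤ.* (+ toℕ i ℤ.- c))
    there : ∀ c k k′ x → c ℤ.+ k ℤ.* (k′ ℤ.* (x ℤ.- c)) ≡ c ℤ.+ (k ℤ.* k′) ℤ.* (x ℤ.- c)
    there = solve-∀
    there′ : ∀ c x → c ℤ.+ 1ℤ ℤ.* (x ℤ.- c) ≡ x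
    there′ = solve-∀
    back : ∀ c k k′ x → k′ ℤ.* ((c ℤ.+ k ℤ.* x) ℤ.- c) ≡ (k ℤ.* k′) ℤ.* x
    back = solve-∀
    to∘from : ∀ i → to (from i) ≡ i
    to∘from i = ≡.trans (residue-cong (begin
      c ℤ.+ k ℤ.* + toℕ (from i)              ≈⟨ ≋-+ {x = c} ≋-refl (≋-*ˡ {x = k} (residue-≋ m _)) ⟩
      c ℤ.+ k ℤ.* (k′ ℤ.* (x ℤ.- c))          ≡⟨ there c k k′ x ⟩
      c ℤ.+ (k ℤ.* k′) ℤ.* (x ℤ.- c)          ≈⟨ ≋-+ {x = c} ≋-refl (≋-*ʳ {x = x ℤ.- c} kk′) ⟩
      c ℤ.+ 1ℤ ℤ.* (x ℤ.- c)                  ≡⟨ there′ c x ⟩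
      x                                       ∎)) (residue-toℕ i)
      where
      open ≋-Reasoning m
      x = + toℕ i
    from∘to : ∀ i → from (to i) ≡ i
    from∘to i = ≡.trans (residue-cong (begin
      k′ ℤ.* (+ toℕ (to i) ℤ.- c)             ≈⟨ ≋-*ˡ {x = k′}
          (≋-+ (residue-≋ m (c ℤ.+ k ℤ.* x)) (≋-refl {x = ℤ.- c})) ⟩
      k′ ℤ.* ((c ℤ.+ k ℤ.* x) ℤ.- c)          ≡⟨ back c k k′ x ⟩
      (k ℤ.* k′) ℤ.* x                        ≈⟨ ≋-*ʳ {x = x} kk′ ⟩
      1ℤ ℤ.* x                                ≡⟨ ℤ.*-identityˡ x ⟩
      x                                       ∎)) (residue-toℕ i)
      where
      open ≋-Reasoning m
      x = + toℕ i

  sum-+ : ∀ m n (f : ℕ → Carrier) →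
          sum {m ℕ.+ n} (λ i → f (toℕ i)) ≈ sum {m} (λ i → f (toℕ i)) ⊕ sum {n} (λ i → f (m ℕ.+ toℕ i))
  sum-+ zero    n f = ≈-sym (identityˡ _)
  sum-+ (suc m) n f = ≈-trans (∙-congˡ (sum-+ m n (f ∘ suc))) (≈-sym (assoc _ _ _))

  sum-* : ∀ m n (f : ℕ → Carrier) →
          sum {m ℕ.* n} (λ i → f (toℕ i)) ≈ sum {m} (λ i → sum {n} (λ j → f (toℕ i ℕ.* n ℕ.+ toℕ j)))
  sum-* zero    n f = ≈-refl
  sum-* (suc m) n f = ≈-trans (sum-+ n (m ℕ.* n) f) (∙-congˡ (≈-trans (sum-* m n (λ k → f (n ℕ.+ k)))
    (sum-cong-≋ {m} λ i → sum-cong-≋ {n} λ j → reflexive (≡.cong f (≡.sym (ℕ.+-assoc n (toℕ i ℕ.* n) (toℕ j)))))))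

  sum-zero : ∀ m (f : Fin m → Carrier) → (∀ i → f i ≈ ε) → sum f ≈ ε
  sum-zero m f z = ≈-trans (sum-cong-≋ z) (sum-replicate-zero m)

open Summation ℕ.+-0-commutativeMonoid public
open SemiringSum ℕ.+-*-semiring public

sum-const : ∀ m c → sum {m} (λ _ → c) ≡ m ℕ.* c
sum-const zero    c = refl
sum-const (suc m) c = ≡.cong (c ℕ.+_) (sum-const m c)

length-filter-applyUpTo : ∀ {P : Pred ℕ 0ℓ} (P? : Decidable P) (f : ℕ → ℕ) n →
                          length (filter P? (applyUpTo f n)) ≡ sum {n} (λ i → 𝟙 (P? (f (toℕ i))))
length-filter-applyUpTo P? f zero    = refl
length-filter-applyUpTo P? f (suc n) with does (P? (f 0))
... | true  = ≡.cong suc (length-filter-applyUpTo P? (f ∘ suc) n)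
... | false = length-filter-applyUpTo P? (f ∘ suc) n

φ-as-sum : ∀ m .{{_ : NonZero m}} → φ m ≡ sum {m} (λ i → 𝟙 (unit? m (+ toℕ i)))
φ-as-sum m = begin
  φ m
    ≡⟨ ≡.cong (length ∘ filter (λ a → Coprimality.coprime? a m)) (List.map-upTo suc m) ⟩
  length (filter (λ a → Coprimality.coprime? a m) (applyUpTo suc m))
    ≡⟨ length-filter-applyUpTo (λ a → Coprimality.coprime? a m) suc m ⟩
  sum {m} (λ i → 𝟙 (Coprimality.coprime? (suc (toℕ i)) m))
    -- `φ` runs over 1, ..., m. Reading `suc i` as 1 + 1 · i lets `sum-affine` shift the range to 0,
    -- ..., m - 1.
    ≡⟨ sum-cong-≋ {m} (λ i → 𝟙-cong (Coprimality.coprime? (suc (toℕ i)) m) (unit? m (1ℤ ℤ.+ 1ℤ ℤ.* + toℕ i))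
         (unit-resp (≡⇒≋ (≡.sym (shift i))) ∘ coprime⇒unit (+ suc (toℕ i)))
         (unit⇒coprime ∘ unit-resp (≡⇒≋ (shift i)))) ⟩
  sum {m} (λ i → 𝟙 (unit? m (1ℤ ℤ.+ 1ℤ ℤ.* + toℕ i)))
    ≡⟨ sum-affine m (λ x → 𝟙 (unit? m x)) (λ e → 𝟙-cong (unit? m _) (unit? m _) (unit-resp e)
        (unit-resp (≋-sym e))) 1ℤ 1ℤ unit-1 ⟩
  sum {m} (λ i → 𝟙 (unit? m (+ toℕ i))) ∎
  where
  open ≡.≡-Reasoning
  shift : ∀ i → 1ℤ ℤ.+ 1ℤ ℤ.* + toℕ i ≡ + suc (toℕ {m} i)
  shift i = ≡.cong (ℤ._+_ 1ℤ) (ℤ.*-identityˡ (+ toℕ i))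

-- Units and Euler's function at prime powers

unit-prime-power : ∀ p a {x} → Unit p x → Unit (p ℕ.^ a) x
-- Modulo 1 every integer is a unit, with inverse 0.
unit-prime-power p zero    {x} u = unit 0ℤ (congruent (ℤ.- 1ℤ) (≡.cong (ℤ._- 1ℤ) (ℤ.*-zeroʳ x)))
unit-prime-power p (suc a) {x} u = coprime⇒unit x
    (Coprimality.sym (coprime-* (Coprimality.sym (unit⇒coprime u))
    (Coprimality.sym (unit⇒coprime (unit-prime-power p a u)))))
  where
  coprime-* : ∀ {a b c} → Coprime a c → Coprime b c → Coprime (a ℕ.* b) c
  coprime-* a⊥c b⊥c {d} (d∣ab , d∣c) = b⊥c (Coprimality.coprime-divisor
      (λ (e∣d , e∣a) → a⊥c (e∣a , ∣.∣-trans e∣d d∣c)) d∣ab , d∣c)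

unit-mod-prime : ∀ {p} → Prime p → ∀ x → ¬ (x ≋ 0ℤ [ p ]) → Unit p x
unit-mod-prime {p} pp x x≢0 = unit-resp (residue-≋ p x) (coprime⇒unit (+ toℕ (residue p x))
    (Coprimality.sym (prime⇒coprime pp {{ℕ.≢-nonZero nonzero}} (Fin.toℕ<n (residue p x)))))
  where
  instance _ = prime⇒nonZero pp
  nonzero : toℕ (residue p x) ≡.≢ 0
  nonzero e = x≢0 (≋-trans (≋-sym (residue-≋ p x)) (≡⇒≋ (≡.cong +_ e)))

unit-nonzero : ∀ {p} → Prime p → ∀ {x} → Unit p x → ¬ (x ≋ 0ℤ [ p ])
unit-nonzero {p} pp {x} (unit y xy) x≋0 = ℕ.<⇒≢ (ℕ.nonTrivial⇒n>1 p {{prime⇒nonTrivial pp}})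
    (≡.sym (unit⇒coprime {x = 0ℤ} (unit 0ℤ zero-unit) (p∣0 , ∣.∣-refl)))
  where
  p∣0 : p ∣.∣ ∣ 0ℤ ∣
  p∣0 = p ∣.∣0
  zero-unit : 0ℤ ℤ.* 0ℤ ≋ 1ℤ [ p ]
  zero-unit = ≋-trans (≋-trans (≡⇒≋ (≡.sym (ℤ.*-zeroˡ y))) (≋-*ʳ {x = y} (≋-sym x≋0))) xy

p∣p^ : ∀ p {a} → 1 ℕ.≤ a → p ∣.∣ p ℕ.^ a
p∣p^ p {suc a} _ = ∣.m∣m*n (p ℕ.^ a)

sum-units-prime : ∀ {p} → Prime p → sum {p} (λ j → 𝟙 (unit? p (+ toℕ j))) ≡ ℕ.pred p
sum-units-prime {zero}  pp = refl
sum-units-prime {suc k} pp = ≡.trans (≡.cong₂ ℕ._+_ (𝟙-no (unit? (suc k) 0ℤ) λ u → unit-nonzero pp u (≋-refl {x = 0ℤ}))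
    (≡.trans (sum-cong-≋ {k} λ j → 𝟙-yes (unit? (suc k) (+ suc (toℕ j)))
        (unit-mod-prime pp _ (λ e → small j (toℕ-≋-injective (Fin.suc j) Fin.zero e))))
             (sum-const k 1)))
    (ℕ.*-identityʳ k)
  where
  small : ∀ (j : Fin k) → Fin.suc j ≡.≢ Fin.zero
  small j ()

-- Invertibility modulo `p ^ suc a` depends on the residue modulo p alone, so each of the p^a blocks
-- of p consecutive integers contributes p - 1.
φ-prime-power : ∀ {p} → Prime p → ∀ a → φ (p ℕ.^ suc a) ≡ p ℕ.^ a ℕ.* ℕ.pred p
φ-prime-power {p} pp a = begin
  φ (p ℕ.^ suc a)
    ≡⟨ ≡.cong φ (ℕ.*-comm p (p ℕ.^ a)) ⟩
  φ (p ℕ.^ a ℕ.* p)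
    ≡⟨ φ-as-sum (p ℕ.^ a ℕ.* p) ⟩
  sum {p ℕ.^ a ℕ.* p} (λ i → 𝟙 (unit? (p ℕ.^ a ℕ.* p) (+ toℕ i)))
    ≡⟨ sum-* (p ℕ.^ a) p (λ i → 𝟙 (unit? (p ℕ.^ a ℕ.* p) (+ i))) ⟩
  sum {p ℕ.^ a} (λ i → sum {p} (λ j → 𝟙 (unit? (p ℕ.^ a ℕ.* p) (+ (toℕ i ℕ.* p ℕ.+ toℕ j)))))
    ≡⟨ sum-cong-≋ {p ℕ.^ a} (λ i → ≡.trans (sum-cong-≋ {p} (λ j →
         𝟙-cong (unit? (p ℕ.^ a ℕ.* p) _) (unit? p _)
           (unit-resp (drop (toℕ i) (toℕ j)) ∘ unit-∣ (∣.n∣m*n (p ℕ.^ a)))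
           (≡.subst (λ m → Unit m (+ (toℕ i ℕ.* p ℕ.+ toℕ j))) (ℕ.*-comm p (p ℕ.^ a)) ∘ unit-prime-power p
               (suc a) ∘ unit-resp (≋-sym (drop (toℕ i) (toℕ j))))))
         (sum-units-prime pp)) ⟩
  sum {p ℕ.^ a} (λ _ → ℕ.pred p)
    ≡⟨ sum-const (p ℕ.^ a) (ℕ.pred p) ⟩
  p ℕ.^ a ℕ.* ℕ.pred p ∎
  where
  open ≡.≡-Reasoning
  instance
    _ = prime⇒nonZero pp
    _ = ℕ.m^n≢0 p a
    _ = ℕ.m*n≢0 (p ℕ.^ a) p
  drop : ∀ i j → + (i ℕ.* p ℕ.+ j) ≋ + j [ p ]
  drop i j = congruent (+ i) (≡.trans (≡.cong (ℤ._- + j) (≡.cong (ℤ._+ + j) (ℤ.pos-* i p)))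
      (cancel (+ i ℤ.* + p) (+ j)))
    where
    cancel : ∀ x j → (x ℤ.+ j) ℤ.- j ≡ x
    cancel = solve-∀

-- Convolution in the group algebra of ℤ/n

_⋆[_]_ : (ℤ → ℕ) → ℕ → (ℤ → ℕ) → ℤ → ℕ
(f ⋆[ n ] g) x = sum {n} (λ i → f (x ℤ.- + toℕ i) ℕ.* g (+ toℕ i))

∑ˡ : List ℕ → (ℕ → ℕ) → ℕ
∑ˡ is f = foldr ℕ._+_ 0 (map f is)

module CyclicGroupAlgebra (R : CommutativeRing 0ℓ 0ℓ) (n : ℕ) .{{_ : NonZero n}} where

  open CommutativeRing R renaming (refl to ≈-refl)

  -- κ is the image of ℕ and e is a character of ℤ that is trivial on n.
  module Character
    (κ : ℕ → Carrier) (κ-0 : κ 0 ≈ 0#) (κ-1 : κ 1 ≈ 1#)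
    (κ-+ : ∀ a b → κ (a ℕ.+ b) ≈ κ a + κ b) (κ-* : ∀ a b → κ (a ℕ.* b) ≈ κ a * κ b)
    (e : ℤ → Carrier) (e-periodic : ∀ {x y} → x ≋ y [ n ] → e x ≈ e y)
    (e-+ : ∀ x y → e (x ℤ.+ y) ≈ e x * e y)
    where

    open SetoidReasoning setoid
    open CommutativeSemigroupProperties *-commutativeSemigroup using (interchange)
    private
      module Σ = SemiringSum semiring
      module S = Summation +-commutativeMonoid

    -- The element whose coefficients are the natural numbers f x. Through it, identities in the
    -- ring reduce to identities between counting functions.
    Σκe : (ℤ → ℕ) → Carrier
    Σκe f = Σ.sum {n} (λ i → κ (f (+ toℕ i)) * e (+ toℕ i))

    Σκe-cong : ∀ {f g} → (∀ x → f x ≡ g x) → Σκe f ≈ Σκe g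
    Σκe-cong f≗g = Σ.sum-cong-≋ {n} λ i → *-congʳ (reflexive (≡.cong κ (f≗g (+ toℕ i))))

    Σκe-+ : ∀ f g → Σκe f + Σκe g ≈ Σκe (λ x → f x ℕ.+ g x)
    Σκe-+ f g = sym (trans
      (Σ.sum-cong-≋ {n} λ i → trans (*-congʳ (κ-+ (f (+ toℕ i)) (g (+ toℕ i)))) (distribʳ _ _ _))
      (Σ.∑-distrib-+ {n} (λ i → κ (f (+ toℕ i)) * e (+ toℕ i)) (λ i → κ (g (+ toℕ i)) * e (+ toℕ i))))

    Σκe-scale : ∀ m f → κ m * Σκe f ≈ Σκe (λ x → m ℕ.* f x)
    Σκe-scale m f = trans (Σ.*-distribˡ-sum {n} (κ m) (λ i → κ (f (+ toℕ i)) * e (+ toℕ i)))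
      (Σ.sum-cong-≋ {n} λ i → trans (sym (*-assoc _ _ _)) (*-congʳ (sym (κ-* m (f (+ toℕ i))))))

    Σκe-list : ∀ is (f : ℕ → ℤ → ℕ) →
               foldr _+_ 0# (map (λ k → Σκe (f k)) is) ≈ Σκe (λ x → ∑ˡ is (λ k → f k x))
    Σκe-list []       f = sym (S.sum-zero n _ λ i → trans (*-congʳ κ-0) (zeroˡ _))
    Σκe-list (k ∷ is) f = trans (+-congˡ (Σκe-list is f)) (Σκe-+ (f k) (λ x → ∑ˡ is (λ k → f k x)))

    filter-sum : ∀ {I : Set} m {P : Pred I 0ℓ} (P? : Decidable P) (f : Fin m → I) (h : I → Carrier) →
                 foldr _+_ 0# (map h (filter P? (tabulate f))) ≈ Σ.sum {m} (λ i → κ (𝟙 (P? (f i))) * h (f i))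
    filter-sum zero    P? f h = ≈-refl
    filter-sum (suc m) P? f h with does (P? (f Fin.zero))
    ... | true  = +-cong (sym (trans (*-congʳ κ-1) (*-identityˡ _))) (filter-sum m P? (f ∘ Fin.suc) h)
    ... | false = trans (filter-sum m P? (f ∘ Fin.suc) h)
                    (trans (sym (+-identityˡ _)) (+-congʳ (sym (trans (*-congʳ κ-0) (zeroˡ _)))))

    κ-sum : ∀ m (f : Fin m → ℕ) → κ (sum f) ≈ Σ.sum {m} (λ i → κ (f i))
    κ-sum zero    f = κ-0
    κ-sum (suc m) f = trans (κ-+ (f Fin.zero) (sum (f ∘ Fin.suc))) (+-congˡ (κ-sum m (f ∘ Fin.suc)))

    -- For fixed b the substitution c = a + b permutes the residues, and exchanging the sums
    -- collects the coefficient of `e c`. Periodicity of f accounts for c - b leaving the range 0,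
    -- ..., n - 1.
    Σκe-* : ∀ f g → (∀ {x y} → x ≋ y [ n ] → f x ≡ f y) → Σκe f * Σκe g ≈ Σκe (f ⋆[ n ] g)
    Σκe-* f g f-periodic = begin
      Σκe f * Σκe g
        ≈⟨ Σ.*-distribˡ-sum {n} (Σκe f) (λ b → G b) ⟩
      Σ.sum {n} (λ b → Σκe f * G b)
        ≈⟨ Σ.sum-cong-≋ {n} (λ b → begin
             Σκe f * G b
               ≈⟨ Σ.*-distribʳ-sum {n} (G b) (λ a → κ (f (+ toℕ a)) * e (+ toℕ a)) ⟩
             Σ.sum {n} (λ a → κ (f (+ toℕ a)) * e (+ toℕ a) * G b)
               ≈⟨ Σ.sum-cong-≋ {n} (λ a → translate (+ toℕ a) (+ toℕ b)) ⟩
             Σ.sum {n} (λ a → H (+ toℕ b) (+ toℕ b ℤ.+ 1ℤ ℤ.* + toℕ a))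
               ≈⟨ S.sum-affine n (H (+ toℕ b))
                   (λ x≋y → *-cong (*-congʳ (reflexive (≡.cong κ (f-periodic (≋-+ x≋y ≋-refl)))))
                   (e-periodic x≋y)) (+ toℕ b) 1ℤ unit-1 ⟩
             Σ.sum {n} (λ c → H (+ toℕ b) (+ toℕ c)) ∎) ⟩
      Σ.sum {n} (λ b → Σ.sum {n} (λ c → H (+ toℕ b) (+ toℕ c)))
        ≈⟨ Σ.∑-comm {n} {n} (λ b c → H (+ toℕ b) (+ toℕ c)) ⟩
      Σ.sum {n} (λ c → Σ.sum {n} (λ b → H (+ toℕ b) (+ toℕ c)))
        ≈⟨ Σ.sum-cong-≋ {n} (λ c → trans
             (sym (Σ.*-distribʳ-sum {n} (e (+ toℕ c)) (λ b → κ (f (+ toℕ c ℤ.- + toℕ b)) * κ (g (+ toℕ b)))))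
             (*-congʳ (sym (trans (κ-sum n (λ b → f (+ toℕ c ℤ.- + toℕ b) ℕ.* g (+ toℕ b)))
               (Σ.sum-cong-≋ {n} λ b → κ-* (f (+ toℕ c ℤ.- + toℕ b)) (g (+ toℕ b))))))) ⟩
      Σκe (f ⋆[ n ] g) ∎
      where
      G : Fin n → Carrier
      G b = κ (g (+ toℕ b)) * e (+ toℕ b)
      H : ℤ → ℤ → Carrier
      H b c = κ (f (c ℤ.- b)) * κ (g b) * e c
      cancel : ∀ a b → b ℤ.+ 1ℤ ℤ.* a ℤ.- b ≡ a
      cancel = solve-∀
      commute : ∀ a b → b ℤ.+ 1ℤ ℤ.* a ≡ a ℤ.+ b
      commute = solve-∀
      translate : ∀ a b → κ (f a) * e a * (κ (g b) * e b) ≈ H b (b ℤ.+ 1ℤ ℤ.* a)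
      translate a b = begin
        κ (f a) * e a * (κ (g b) * e b)    ≈⟨ interchange _ _ _ _ ⟩
        κ (f a) * κ (g b) * (e a * e b)    ≈⟨ *-congˡ (e-+ a b) ⟨
        κ (f a) * κ (g b) * e (a ℤ.+ b)    ≡⟨ ≡.cong₂ (λ x y → κ (f x) * κ (g b) * e y) (cancel a b) (commute a b) ⟨
        H b (b ℤ.+ 1ℤ ℤ.* a)               ∎

-- Powers of x and coset sums modulo xⁿ - 1

module PolynomialFacts (l : ℕ) where
  open Polynomials (𝔽 l)
  open CommutativeRing (𝔽 l) using (_≈_; 0#; 1#)
  private module F = CommutativeRing (𝔽 l)
  private module P = CommutativeRing polynomialRing

  ·ₚ-as-* : ∀ a f → a ·ₚ f ≈ₚ (a ∷ []) *ₚ f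
  ·ₚ-as-* a f = coefficientwise λ k → F.sym (F.trans (coeff-+ (a ·ₚ f) (0# ∷ []) k)
    (F.trans (F.+-cong {x = coeff (a ·ₚ f) k} F.refl (z k)) (F.+-identityʳ (coeff (a ·ₚ f) k))))
    where
    z : ∀ k → coeff (0# ∷ []) k ≈ 0#
    z zero    = F.refl
    z (suc k) = F.refl

  shift-*ₚ : ∀ f g → (0# ∷ f) *ₚ g ≈ₚ 0# ∷ f *ₚ g
  shift-*ₚ f g = coefficientwise λ k → F.trans (coeff-+ (0# ·ₚ g) (0# ∷ f *ₚ g) k)
    (F.trans (F.+-cong {y = 0#} (F.trans (coeff-· 0# g k) (F.zeroˡ (coeff g k))) F.refl)
        (F.+-identityˡ (coeff (0# ∷ f *ₚ g) k)))

  X^-+ : ∀ a b → X^ (a ℕ.+ b) ≈ₚ X^ a *ₚ X^ b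
  X^-+ zero    b = P.sym (P.*-identityˡ (X^ b))
  X^-+ (suc a) b = P.trans (coefficientwise (λ { zero → F.refl ; (suc k) → at (X^-+ a b) k }))
      (P.sym (shift-*ₚ (X^ a) (X^ b)))

module CyclicPolynomials (l n : ℕ) .{{_ : NonZero n}} where
  open Polynomials (𝔽 l)
  open PolynomialFacts l
  private
    module F = CommutativeRing (𝔽 l)
    module P = CommutativeRing polynomialRing
    module Q = CommutativeRing (𝔽[x]/⟨xⁿ-1⟩ l n)
  open CosetPolynomials l n
  open CyclotomicCosets l n

  lift : ∀ {f g} → f ≈ₚ g → f ≈ᴬ g
  lift {f} {g} f≈g = congruent [] (P.trans (P.+-cong {x = f} f≈g (P.refl {x = -ₚ g})) (P.-‿inverseʳ g))

  constant : ℕ → A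
  constant m = + m ∷ []

  X^n≈1 : X^ n ≈ᴬ 1ₚ
  X^n≈1 = congruent 1ₚ (P.sym (P.*-identityˡ (X^ n +ₚ (-ₚ 1ₚ))))

  X^kn≈1 : ∀ k → X^ (k ℕ.* n) ≈ᴬ 1ₚ
  X^kn≈1 zero    = Q.refl
  X^kn≈1 (suc k) = Q.trans (lift (X^-+ n (k ℕ.* n))) (Q.trans (Q.*-cong X^n≈1 (X^kn≈1 k)) (Q.*-identityˡ 1ₚ))

  X^% : ∀ a → X^ (a ℕ.% n) ≈ᴬ X^ a
  X^% a = Q.sym (Q.trans (Q.reflexive (≡.cong X^_ (ℕ.m≡m%n+[m/n]*n a n)))
    (Q.trans (lift (X^-+ (a ℕ.% n) (a ℕ./ n ℕ.* n)))
      (Q.trans (Q.*-cong (Q.refl {x = X^ (a ℕ.% n)}) (X^kn≈1 (a ℕ./ n))) (Q.*-identityʳ (X^ (a ℕ.% n))))))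

  -- Reducing the exponent to 0, ..., n - 1 extends a ↦ x^a to negative exponents; it is additive
  -- because x^n is 1 in the quotient.
  e : ℤ → A
  e x = X^ toℕ (residue n x)

  e-periodic : ∀ {x y} → x ≋ y [ n ] → e x ≈ᴬ e y
  e-periodic x≋y = Q.reflexive (≡.cong (λ i → X^ toℕ i) (residue-cong x≋y))

  e-nat : ∀ a → e (+ a) ≈ᴬ X^ a
  e-nat a = Q.trans (Q.reflexive (≡.cong X^_ (Fin.toℕ-fromℕ< _))) (X^% a)

  e-toℕ : ∀ i → e (+ toℕ i) ≡ X^ toℕ i
  e-toℕ i = ≡.cong (λ i → X^ toℕ i) (residue-toℕ i)

  e-+ : ∀ x y → e (x ℤ.+ y) ≈ᴬ e x *ᴬ e y
  e-+ x y = Q.trans (e-periodic (≋-sym (≋-+ (residue-≋ n x) (residue-≋ n y))))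
    (Q.trans (e-nat (toℕ (residue n x) ℕ.+ toℕ (residue n y))) (lift (X^-+ (toℕ (residue n x)) (toℕ (residue n y)))))

  constant-0 : constant 0 ≈ᴬ 0ᴬ
  constant-0 = lift (coefficientwise λ { zero → F.refl ; (suc k) → F.refl })

  constant-* : ∀ a b → constant (a ℕ.* b) ≈ᴬ constant a *ᴬ constant b
  constant-* a b = lift (coefficientwise λ
    { zero    → F.reflexive (≡.trans (ℤ.pos-* a b) (≡.sym (ℤ.+-identityʳ (+ a ℤ.* + b))))
    ; (suc k) → F.refl })

  open CyclicGroupAlgebra.Character (𝔽[x]/⟨xⁿ-1⟩ l n) n constant constant-0 Q.refl
      (λ a b → Q.refl) constant-* e e-periodic e-+ public

  member : ℤ → ℤ → ℕ
  member γ x = 𝟙 (residue n x ∈C? γ)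

  member-periodic : ∀ γ {x y} → x ≋ y [ n ] → member γ x ≡ member γ y
  member-periodic γ x≋y = ≡.cong (λ i → 𝟙 (i ∈C? γ)) (residue-cong x≋y)

  cosetSum-expansion : ∀ γ → cosetSum γ ≈ᴬ Σκe (member γ)
  cosetSum-expansion γ = Q.trans (filter-sum n (_∈C? γ) id (λ i → X^ toℕ i))
    (Q.reflexive (sum-cong λ i → ≡.cong₂ (λ j f → constant (𝟙 (j ∈C? γ)) *ᴬ f) (≡.sym (residue-toℕ i))
        (≡.sym (e-toℕ i))))
    where
    sum-cong : ∀ {f g : Fin n → A} → (∀ i → f i ≡ g i) → SemiringSum.sum Q.semiring f ≡ SemiringSum.sum Q.semiring g
    sum-cong = SemiringSum.sum-cong-≗ Q.semiring

  ·-Σκe : ∀ m f → m · Σκe f ≈ᴬ Σκe (λ x → m ℕ.* f x)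
  ·-Σκe m f = Q.trans (lift (·ₚ-as-* (+ m) (Σκe f))) (Σκe-scale m f)

  ·-cong : ∀ m {f g} → f ≈ᴬ g → m · f ≈ᴬ m · g
  ·-cong m {f} {g} f≈g = Q.trans (lift (·ₚ-as-* (+ m) f))
    (Q.trans (Q.*-cong (Q.refl {x = constant m}) f≈g) (Q.sym (lift (·ₚ-as-* (+ m) g))))

-- Residues and non-residues modulo p

𝟙-unit-periodic : ∀ {m x y} → x ≋ y [ m ] → 𝟙 (unit? m x) ≡ 𝟙 (unit? m y)
𝟙-unit-periodic {m} {x} {y} e = 𝟙-cong (unit? m x) (unit? m y) (unit-resp e) (unit-resp (≋-sym e))

-- Write the index as i p + j. Then f sees only j, and for fixed j the argument j + p i of g runs k
-- times through all residues modulo N, as p is invertible there. The factor k may itself be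
-- divisible by p; it will be p^(s-i-1).
sum-coprime-moduli : ∀ k N p (f g : ℤ → ℕ) .{{_ : NonZero N}} .{{_ : NonZero p}} →
  (∀ {x y} → x ≋ y [ p ] → f x ≡ f y) → (∀ {x y} → x ≋ y [ N ] → g x ≡ g y) → Unit N (+ p) →
  sum {(k ℕ.* N) ℕ.* p} (λ i → f (+ toℕ i) ℕ.* g (+ toℕ i)) ≡
  k ℕ.* sum {N} (λ i → g (+ toℕ i)) ℕ.* sum {p} (λ i → f (+ toℕ i))
sum-coprime-moduli k N p f g f-periodic g-periodic p-unit = begin
  sum {(k ℕ.* N) ℕ.* p} (λ i → f (+ toℕ i) ℕ.* g (+ toℕ i))
    ≡⟨ sum-* (k ℕ.* N) p (λ i → f (+ i) ℕ.* g (+ i)) ⟩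
  sum {k ℕ.* N} (λ i → sum {p} (λ j → f (+ (toℕ i ℕ.* p ℕ.+ toℕ j)) ℕ.* g (+ (toℕ i ℕ.* p ℕ.+ toℕ j))))
    ≡⟨ sum-cong-≋ {k ℕ.* N} (λ i → sum-cong-≋ {p}
        (λ j → ≡.cong₂ ℕ._*_ (f-periodic (multiple p (toℕ i) (toℕ j))) (≡.cong g (expand (toℕ i) (toℕ j))))) ⟩
  sum {k ℕ.* N} (λ i → sum {p} (λ j → f (+ toℕ j) ℕ.* h j (+ toℕ i)))
    ≡⟨ ∑-comm {k ℕ.* N} {p} (λ i j → f (+ toℕ j) ℕ.* h j (+ toℕ i)) ⟩
  sum {p} (λ j → sum {k ℕ.* N} (λ i → f (+ toℕ j) ℕ.* h j (+ toℕ i)))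
    ≡⟨ sum-cong-≋ {p} (λ j → ≡.trans (≡.sym (*-distribˡ-sum {k ℕ.* N} (f (+ toℕ j)) (λ i → h j (+ toℕ i))))
         (≡.trans (≡.cong (f (+ toℕ j) ℕ.*_) (inner j)) (ℕ.*-comm (f (+ toℕ j)) G))) ⟩
  sum {p} (λ j → G ℕ.* f (+ toℕ j))
    ≡⟨ *-distribˡ-sum {p} G (λ j → f (+ toℕ j)) ⟨
  G ℕ.* sum {p} (λ j → f (+ toℕ j)) ∎
  where
  open ≡.≡-Reasoning
  G : ℕ
  G = k ℕ.* sum {N} (λ i → g (+ toℕ i))
  h : Fin p → ℤ → ℕ
  h j x = g (+ toℕ j ℤ.+ + p ℤ.* x)
  multiple : ∀ m i j → + (i ℕ.* m ℕ.+ j) ≋ + j [ m ]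
  multiple m i j = congruent (+ i) (≡.trans (≡.cong (λ z → (z ℤ.+ + j) ℤ.- + j) (ℤ.pos-* i m))
      (cancel (+ i ℤ.* + m) (+ j)))
    where
    cancel : ∀ x j → (x ℤ.+ j) ℤ.- j ≡ x
    cancel = solve-∀
  expand : ∀ i j → + (i ℕ.* p ℕ.+ j) ≡ + j ℤ.+ + p ℤ.* + i
  expand i j = ≡.trans (≡.cong +_ (≡.trans (ℕ.+-comm (i ℕ.* p) j) (≡.cong (j ℕ.+_) (ℕ.*-comm i p))))
      (≡.cong (ℤ._+_ (+ j)) (ℤ.pos-* p i))
  inner : ∀ j → sum {k ℕ.* N} (λ i → h j (+ toℕ i)) ≡ G
  inner j = begin
    sum {k ℕ.* N} (λ i → h j (+ toℕ i))
      ≡⟨ sum-* k N (λ i → h j (+ i)) ⟩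
    sum {k} (λ a → sum {N} (λ b → h j (+ (toℕ a ℕ.* N ℕ.+ toℕ b))))
      ≡⟨ sum-cong-≋ {k} (λ a → ≡.trans
           (sum-cong-≋ {N} (λ b → g-periodic (≋-+ (≋-refl {x = + toℕ j})
               (≋-*ˡ {x = + p} (multiple N (toℕ a) (toℕ b))))))
           (sum-affine N g g-periodic (+ toℕ j) (+ p) p-unit)) ⟩
    sum {k} (λ _ → sum {N} (λ i → g (+ toℕ i)))
      ≡⟨ sum-const k _ ⟩
    G ∎

-- R is a subgroup of index 2 of the units modulo p = 4k + 3 that does not contain -1.
module HalfSystem
  (p k : ℕ) (p-prime : Prime p) (p≡3+4k : p ≡ 3 ℕ.+ 4 ℕ.* k)
  (R : ℤ → Set) (R? : ∀ x → Dec (R x))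
  (R-resp : ∀ {x y} → x ≋ y [ p ] → R x → R y)
  (R⇒unit : ∀ {x} → R x → Unit p x)
  (R-split : ∀ {x} → Unit p x → R x ⊎ R (ℤ.- x))
  (R-exclusive : ∀ {x} → R x → ¬ R (ℤ.- x))
  (R-* : ∀ {x y} → R x → R y → R (x ℤ.* y))
  where

  open ≡.≡-Reasoning

  private instance
    p≢0 : NonZero p
    p≢0 = prime⇒nonZero p-prime

  ρ : ℤ → ℕ
  ρ x = 𝟙 (R? x)

  ρ-resp : ∀ {x y} → x ≋ y [ p ] → ρ x ≡ ρ y
  ρ-resp {x} {y} e = 𝟙-cong (R? x) (R? y) (R-resp e) (R-resp (≋-sym e))

  ρ-≡ : ∀ {x y} → x ≡ y → ρ x ≡ ρ y
  ρ-≡ = ≡.cong ρ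

  -- Replaces closure under inverses: if -y were in R, then so would be x (-y) = -(x y), against
  -- `R-exclusive`.
  R-cancel : ∀ {x y} → R x → R (x ℤ.* y) → R y
  R-cancel {x} {y} rx rxy = [ id , ⊥-elim ∘ impossible ]′ (R-split (unit-factor x y (R⇒unit rxy)))
    where
    impossible : ¬ R (ℤ.- y)
    impossible r-y = R-exclusive rxy (≡.subst R (≡.sym (ℤ.neg-distribʳ-* x y)) (R-* rx r-y))

  ρ-scale : ∀ {x} → R x → ∀ y → ρ (x ℤ.* y) ≡ ρ y
  ρ-scale {x} rx y = 𝟙-cong (R? (x ℤ.* y)) (R? y) (R-cancel rx) (R-* rx)

  R⇒≢0 : ∀ {x} → R x → ¬ (x ≋ 0ℤ [ p ])
  R⇒≢0 = unit-nonzero p-prime ∘ R⇒unit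

  ρ-zero : ∀ {x} → x ≋ 0ℤ [ p ] → ρ x ≡ 0
  ρ-zero {x} x≋0 = 𝟙-no (R? x) λ rx → R⇒≢0 rx x≋0

  unit-count : ∀ x → 𝟙 (unit? p x) ≡ ρ x ℕ.+ ρ (ℤ.- x)
  unit-count x = 𝟙-⊎ (unit? p x) (R? x) (R? (ℤ.- x)) R-split R⇒unit
    (λ r-x → ≡.subst (Unit p) (ℤ.neg-involutive x) (unit-neg (R⇒unit r-x))) R-exclusive

  zero-count : ∀ x → 𝟙 (≋-dec {p} x 0ℤ) ℕ.+ 𝟙 (unit? p x) ≡ 1
  zero-count x = complementary (≋-dec {p} x 0ℤ)
    where
    complementary : (x≋0? : Dec (x ≋ 0ℤ [ p ])) → 𝟙 x≋0? ℕ.+ 𝟙 (unit? p x) ≡ 1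
    complementary (yes x≋0) = ≡.cong suc (𝟙-no (unit? p x) λ u → unit-nonzero p-prime u x≋0)
    complementary (no x≢0)  = 𝟙-yes (unit? p x) (unit-mod-prime p-prime x x≢0)

  Σₚ : (ℤ → ℕ) → ℕ
  Σₚ f = sum {p} (λ i → f (+ toℕ i))

  Σₚ-cong : ∀ {f g} → (∀ x → f x ≡ g x) → Σₚ f ≡ Σₚ g
  Σₚ-cong f≗g = sum-cong-≋ {p} λ i → f≗g (+ toℕ i)

  Σₚ-affine : ∀ (f : ℤ → ℕ) → (∀ {x y} → x ≋ y [ p ] → f x ≡ f y) →
              ∀ c k → Unit p k → Σₚ (λ x → f (c ℤ.+ k ℤ.* x)) ≡ Σₚ f
  Σₚ-affine f = sum-affine p f

  Σₚ-+ : ∀ f g → Σₚ (λ x → f x ℕ.+ g x) ≡ Σₚ f ℕ.+ Σₚ g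
  Σₚ-+ f g = ∑-distrib-+ {p} (λ i → f (+ toℕ i)) (λ i → g (+ toℕ i))

  Σₚ-first : ∀ (f : ℤ → ℕ) c → (∀ x → ¬ (x ≋ 0ℤ [ p ]) → f x ≡ c) → Σₚ f ≡ f 0ℤ ℕ.+ (2 ℕ.* (1 ℕ.+ 2 ℕ.* k)) ℕ.* c
  -- The modulus is generalised to q so that p can become an explicit successor. Injectivity of
  -- residues travels along, since it is what shows that the indices after the first are nonzero
  -- modulo q.
  Σₚ-first f c const = ≡.subst (λ q → (∀ (i j : Fin q) → + toℕ i ≋ + toℕ j [ q ] → i ≡ j) →
      (∀ x → ¬ (x ≋ 0ℤ [ q ]) → f x ≡ c) →
      sum {q} (λ i → f (+ toℕ i)) ≡ f 0ℤ ℕ.+ (2 ℕ.* (1 ℕ.+ 2 ℕ.* k)) ℕ.* c)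
    (≡.sym p≡3+4k′) (λ inj const′ → ≡.cong (f 0ℤ ℕ.+_) (≡.trans
      (sum-cong-≋ {2 ℕ.* (1 ℕ.+ 2 ℕ.* k)} (λ i → const′ _ λ e → distinct i (inj (Fin.suc i) Fin.zero e)))
          (sum-const (2 ℕ.* (1 ℕ.+ 2 ℕ.* k)) c)))
    toℕ-≋-injective const
    where
    distinct : ∀ {n} (i : Fin n) → ¬ (Fin.suc i ≡ Fin.zero)
    distinct i ()
    p≡3+4k′ : p ≡ suc (2 ℕ.* (1 ℕ.+ 2 ℕ.* k))
    p≡3+4k′ = ≡.trans p≡3+4k (rearrange k)
      where
      rearrange : ∀ k → 3 ℕ.+ 4 ℕ.* k ≡ suc (2 ℕ.* (1 ℕ.+ 2 ℕ.* k))
      rearrange = ℕSolver.solve-∀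

  unit-neg-1 : Unit p (ℤ.- 1ℤ)
  unit-neg-1 = unit-neg {x = 1ℤ} unit-1

  neg-as-affine : ∀ c x → c ℤ.- x ≡ c ℤ.+ ℤ.- 1ℤ ℤ.* x
  neg-as-affine = solve-∀

  Σₚ-reflect : ∀ (f : ℤ → ℕ) → (∀ {x y} → x ≋ y [ p ] → f x ≡ f y) → ∀ c → Σₚ (λ x → f (c ℤ.- x)) ≡ Σₚ f
  Σₚ-reflect f f-periodic c = ≡.trans (Σₚ-cong (λ x → ≡.cong f (neg-as-affine c x)))
      (Σₚ-affine f f-periodic c (ℤ.- 1ℤ) unit-neg-1)

  -- Summing ρ over x and over -x gives the same number, and together the two sums count the p - 1 =
  -- 2 (1 + 2k) units.
  half : Σₚ ρ ≡ 1 ℕ.+ 2 ℕ.* k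
  half = ℕ.*-cancelˡ-≡ (Σₚ ρ) (1 ℕ.+ 2 ℕ.* k) 2 (begin
    2 ℕ.* Σₚ ρ
      ≡⟨ ≡.cong (Σₚ ρ ℕ.+_) (ℕ.+-identityʳ (Σₚ ρ)) ⟩
    Σₚ ρ ℕ.+ Σₚ ρ
      ≡⟨ ≡.cong (Σₚ ρ ℕ.+_) (≡.trans (≡.sym (Σₚ-reflect ρ ρ-resp 0ℤ)) (Σₚ-cong λ x → ρ-≡ (ℤ.+-identityˡ (ℤ.- x)))) ⟩
    Σₚ ρ ℕ.+ Σₚ (λ x → ρ (ℤ.- x))
      ≡⟨ Σₚ-+ ρ (λ x → ρ (ℤ.- x)) ⟨
    Σₚ (λ x → ρ x ℕ.+ ρ (ℤ.- x))
      ≡⟨ Σₚ-first _ 1 (λ x x≢0 → ≡.trans (≡.sym (unit-count x)) (𝟙-yes (unit? p x) (unit-mod-prime p-prime x x≢0))) ⟩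
    (ρ 0ℤ ℕ.+ ρ 0ℤ) ℕ.+ 2 ℕ.* (1 ℕ.+ 2 ℕ.* k) ℕ.* 1
      ≡⟨ ≡.cong₂ ℕ._+_ (≡.cong (λ z → z ℕ.+ z) (ρ-zero (≋-refl {x = 0ℤ}))) (ℕ.*-identityʳ _) ⟩
    2 ℕ.* (1 ℕ.+ 2 ℕ.* k) ∎)

  -- The numbers of ways to write c as x - y, respectively as -(x + y), with x and y in R.
  T₊ T₋ : ℤ → ℕ
  T₊ c = Σₚ (λ x → ρ x ℕ.* ρ (x ℤ.- c))
  T₋ c = Σₚ (λ x → ρ x ℕ.* ρ (ℤ.- x ℤ.- c))

  T₊-zero : ∀ {c} → c ≋ 0ℤ [ p ] → T₊ c ≡ 1 ℕ.+ 2 ℕ.* k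
  T₊-zero {c} c≋0 = ≡.trans (Σₚ-cong λ x → ≡.trans
      (≡.cong (ρ x ℕ.*_) (ρ-resp (≋-trans (≋-+ (≋-refl {x = x}) (≋-neg c≋0)) (≡⇒≋ (ℤ.+-identityʳ x)))))
      (idempotent (R? x))) half
    where
    idempotent : ∀ {P : Set} (P? : Dec P) → 𝟙 P? ℕ.* 𝟙 P? ≡ 𝟙 P?
    idempotent (yes _) = refl
    idempotent (no _)  = refl

  T₊-scale : ∀ {c} → R c → T₊ c ≡ T₊ 1ℤ
  T₊-scale {c} rc = begin
    T₊ c
      ≡⟨ Σₚ-affine (λ x → ρ x ℕ.* ρ (x ℤ.- c)) (λ e → ≡.cong₂ ℕ._*_ (ρ-resp e) (ρ-resp (≋-+ e ≋-refl))) 0ℤ c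
          (R⇒unit rc) ⟨
    Σₚ (λ x → ρ (0ℤ ℤ.+ c ℤ.* x) ℕ.* ρ (0ℤ ℤ.+ c ℤ.* x ℤ.- c))
      ≡⟨ Σₚ-cong (λ x → ≡.cong₂ ℕ._*_ (≡.trans (ρ-≡ (ℤ.+-identityˡ (c ℤ.* x))) (ρ-scale rc x))
           (≡.trans (ρ-≡ (factor c x)) (ρ-scale rc (x ℤ.- 1ℤ)))) ⟩
    T₊ 1ℤ ∎
    where
    factor : ∀ c x → 0ℤ ℤ.+ c ℤ.* x ℤ.- c ≡ c ℤ.* (x ℤ.- 1ℤ)
    factor = solve-∀

  -- Exchanging x and y turns x - y = c into a representation of -c.
  T₊-neg : ∀ c → T₊ (ℤ.- c) ≡ T₊ c
  T₊-neg c = begin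
    T₊ (ℤ.- c)
      ≡⟨ Σₚ-cong (λ x → ≡.trans (ℕ.*-comm (ρ x) (ρ (x ℤ.- ℤ.- c))) (≡.cong₂ ℕ._*_ (ρ-≡ (there c x)) (ρ-≡ (back c x)))) ⟩
    Σₚ (λ x → ρ (c ℤ.+ 1ℤ ℤ.* x) ℕ.* ρ (c ℤ.+ 1ℤ ℤ.* x ℤ.- c))
      ≡⟨ Σₚ-affine (λ x → ρ x ℕ.* ρ (x ℤ.- c)) (λ e → ≡.cong₂ ℕ._*_ (ρ-resp e) (ρ-resp (≋-+ e ≋-refl))) c 1ℤ unit-1 ⟩
    T₊ c ∎
    where
    there : ∀ c x → x ℤ.- ℤ.- c ≡ c ℤ.+ 1ℤ ℤ.* x
    there = solve-∀
    back : ∀ c x → x ≡ c ℤ.+ 1ℤ ℤ.* x ℤ.- c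
    back = solve-∀

  -- Scaling by R and a change of sign together reach every unit. In other words, R is a difference
  -- set, the one known as Paley's.
  T₊-constant : ∀ c → ¬ (c ≋ 0ℤ [ p ]) → T₊ c ≡ T₊ 1ℤ
  T₊-constant c c≢0 = [ T₊-scale , (λ r-c → ≡.trans (≡.sym (T₊-neg c)) (T₊-scale r-c)) ]′
    (R-split (unit-mod-prime p-prime c c≢0))

  T₊-total : Σₚ T₊ ≡ (1 ℕ.+ 2 ℕ.* k) ℕ.* (1 ℕ.+ 2 ℕ.* k)
  T₊-total = begin
    Σₚ T₊
      ≡⟨ ∑-comm {p} {p} (λ c x → ρ (+ toℕ x) ℕ.* ρ (+ toℕ x ℤ.- + toℕ c)) ⟩
    Σₚ (λ x → Σₚ (λ c → ρ x ℕ.* ρ (x ℤ.- c)))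
      ≡⟨ Σₚ-cong (λ x → ≡.trans (≡.sym (*-distribˡ-sum {p} (ρ x) (λ c → ρ (x ℤ.- + toℕ c))))
           (≡.trans (≡.cong (ρ x ℕ.*_) (≡.trans (Σₚ-reflect ρ ρ-resp x) half)) (ℕ.*-comm (ρ x) _))) ⟩
    Σₚ (λ x → (1 ℕ.+ 2 ℕ.* k) ℕ.* ρ x)
      ≡⟨ *-distribˡ-sum {p} (1 ℕ.+ 2 ℕ.* k) (λ x → ρ (+ toℕ x)) ⟨
    (1 ℕ.+ 2 ℕ.* k) ℕ.* Σₚ ρ
      ≡⟨ ≡.cong ((1 ℕ.+ 2 ℕ.* k) ℕ.*_) half ⟩
    (1 ℕ.+ 2 ℕ.* k) ℕ.* (1 ℕ.+ 2 ℕ.* k) ∎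

  -- Put h = 1 + 2k, the size of R. The h² pairs split into h with difference 0 and 2h nonzero
  -- differences with T pairs each. From h² = h + 2hT follows T = k, which is (p - 3)/4.
  T₊-unit : ∀ {c} → ¬ (c ≋ 0ℤ [ p ]) → T₊ c ≡ k
  T₊-unit {c} c≢0 = ≡.trans (T₊-constant c c≢0)
    (ℕ.*-cancelˡ-≡ (T₊ 1ℤ) k 2 (ℕ.suc-injective
        (ℕ.*-cancelˡ-≡ (1 ℕ.+ 2 ℕ.* T₊ 1ℤ) (1 ℕ.+ 2 ℕ.* k) (1 ℕ.+ 2 ℕ.* k) (begin
      (1 ℕ.+ 2 ℕ.* k) ℕ.* (1 ℕ.+ 2 ℕ.* T₊ 1ℤ)
        ≡⟨ expand (1 ℕ.+ 2 ℕ.* k) (T₊ 1ℤ) ⟩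
      (1 ℕ.+ 2 ℕ.* k) ℕ.+ 2 ℕ.* (1 ℕ.+ 2 ℕ.* k) ℕ.* T₊ 1ℤ
        ≡⟨ ≡.cong (ℕ._+ 2 ℕ.* (1 ℕ.+ 2 ℕ.* k) ℕ.* T₊ 1ℤ) (T₊-zero (≋-refl {x = 0ℤ})) ⟨
      T₊ 0ℤ ℕ.+ 2 ℕ.* (1 ℕ.+ 2 ℕ.* k) ℕ.* T₊ 1ℤ
        ≡⟨ Σₚ-first T₊ (T₊ 1ℤ) T₊-constant ⟨
      Σₚ T₊
        ≡⟨ T₊-total ⟩
      (1 ℕ.+ 2 ℕ.* k) ℕ.* (1 ℕ.+ 2 ℕ.* k) ∎))))
    where
    expand : ∀ h t → h ℕ.* (1 ℕ.+ 2 ℕ.* t) ≡ h ℕ.+ 2 ℕ.* h ℕ.* t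
    expand = ℕSolver.solve-∀

  Σₚ-point : ∀ c → Σₚ (λ x → 𝟙 (≋-dec {p} (x ℤ.+ c) 0ℤ)) ≡ 1
  Σₚ-point c = begin
    Σₚ (λ x → 𝟙 (≋-dec {p} (x ℤ.+ c) 0ℤ))
      ≡⟨ Σₚ-cong (λ x → ≡.cong (λ z → 𝟙 (≋-dec {p} z 0ℤ)) (commute x c)) ⟩
    Σₚ (λ x → 𝟙 (≋-dec {p} (c ℤ.+ 1ℤ ℤ.* x) 0ℤ))
      ≡⟨ Σₚ-affine (λ x → 𝟙 (≋-dec {p} x 0ℤ)) (λ e → 𝟙-cong (≋-dec {p} _ 0ℤ) (≋-dec {p} _ 0ℤ)
          (≋-trans (≋-sym e)) (≋-trans e)) c 1ℤ unit-1 ⟩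
    Σₚ (λ x → 𝟙 (≋-dec {p} x 0ℤ))
      ≡⟨ Σₚ-first _ 0 (λ x x≢0 → 𝟙-no (≋-dec {p} x 0ℤ) x≢0) ⟩
    𝟙 (≋-dec {p} 0ℤ 0ℤ) ℕ.+ 2 ℕ.* (1 ℕ.+ 2 ℕ.* k) ℕ.* 0
      ≡⟨ ≡.cong₂ ℕ._+_ (𝟙-yes (≋-dec {p} 0ℤ 0ℤ) (≋-refl {x = 0ℤ})) (ℕ.*-zeroʳ (2 ℕ.* (1 ℕ.+ 2 ℕ.* k))) ⟩
    1 ∎
    where
    commute : ∀ x c → x ℤ.+ c ≡ c ℤ.+ 1ℤ ℤ.* x
    commute = solve-∀

  -- Every x in R has exactly one of x + c ≡ 0, x + c ∈ R and -(x + c) ∈ R.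
  T-sum : ∀ c → ρ (ℤ.- c) ℕ.+ (T₊ (ℤ.- c) ℕ.+ T₋ c) ≡ 1 ℕ.+ 2 ℕ.* k
  T-sum c = begin
    ρ (ℤ.- c) ℕ.+ (T₊ (ℤ.- c) ℕ.+ T₋ c)
      ≡⟨ ≡.cong₂ ℕ._+_ point (Σₚ-+ (λ x → ρ x ℕ.* ρ (x ℤ.- ℤ.- c)) (λ x → ρ x ℕ.* ρ (ℤ.- x ℤ.- c))) ⟨
    Σₚ (λ x → ρ x ℕ.* 𝟙 (≋-dec {p} (x ℤ.+ c) 0ℤ)) ℕ.+ Σₚ (λ x → ρ x ℕ.* ρ (x ℤ.- ℤ.- c) ℕ.+ ρ x ℕ.* ρ (ℤ.- x ℤ.- c))
      ≡⟨ Σₚ-+ (λ x → ρ x ℕ.* 𝟙 (≋-dec {p} (x ℤ.+ c) 0ℤ)) (λ x → ρ x ℕ.* ρ (x ℤ.- ℤ.- c) ℕ.+ ρ x ℕ.* ρ (ℤ.- x ℤ.- c)) ⟨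
    Σₚ (λ x → ρ x ℕ.* 𝟙 (≋-dec {p} (x ℤ.+ c) 0ℤ) ℕ.+ (ρ x ℕ.* ρ (x ℤ.- ℤ.- c) ℕ.+ ρ x ℕ.* ρ (ℤ.- x ℤ.- c)))
      ≡⟨ Σₚ-cong (λ x → ≡.trans (≡.cong (λ z → ρ x ℕ.* 𝟙 (≋-dec {p} (x ℤ.+ c) 0ℤ) ℕ.+ z)
           (≡.trans (≡.cong₂ (λ y z → ρ x ℕ.* ρ y ℕ.+ ρ x ℕ.* ρ z) (plus x c) (minus x c))
             (≡.trans (≡.sym (ℕ.*-distribˡ-+ (ρ x) (ρ (x ℤ.+ c)) _))
                 (≡.cong (ρ x ℕ.*_) (≡.sym (unit-count (x ℤ.+ c)))))))
           (≡.trans (≡.sym (ℕ.*-distribˡ-+ (ρ x) (𝟙 (≋-dec {p} (x ℤ.+ c) 0ℤ)) _))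
               (≡.trans (≡.cong (ρ x ℕ.*_) (zero-count (x ℤ.+ c))) (ℕ.*-identityʳ (ρ x))))) ⟩
    Σₚ ρ
      ≡⟨ half ⟩
    1 ℕ.+ 2 ℕ.* k ∎
    where
    plus : ∀ x c → x ℤ.- ℤ.- c ≡ x ℤ.+ c
    plus = solve-∀
    minus : ∀ x c → ℤ.- x ℤ.- c ≡ ℤ.- (x ℤ.+ c)
    minus = solve-∀
    opposite : ∀ x c → x ≡ (x ℤ.+ c) ℤ.+ ℤ.- c
    opposite = solve-∀
    swap : ∀ x (x+c≋0? : Dec (x ℤ.+ c ≋ 0ℤ [ p ])) → ρ x ℕ.* 𝟙 x+c≋0? ≡ ρ (ℤ.- c) ℕ.* 𝟙 x+c≋0?
    swap x (yes e) = ≡.cong (ℕ._* 1) (ρ-resp (≋-trans (≡⇒≋ (opposite x c))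
        (≋-trans (≋-+ e (≋-refl {x = ℤ.- c})) (≡⇒≋ (ℤ.+-identityˡ (ℤ.- c))))))
    swap x (no _)  = ≡.trans (ℕ.*-zeroʳ (ρ x)) (≡.sym (ℕ.*-zeroʳ (ρ (ℤ.- c))))
    point : Σₚ (λ x → ρ x ℕ.* 𝟙 (≋-dec {p} (x ℤ.+ c) 0ℤ)) ≡ ρ (ℤ.- c)
    point = ≡.trans (Σₚ-cong λ x → swap x (≋-dec {p} (x ℤ.+ c) 0ℤ))
        (≡.trans (≡.sym (*-distribˡ-sum {p} (ρ (ℤ.- c)) (λ i → 𝟙 (≋-dec {p} (+ toℕ i ℤ.+ c) 0ℤ))))
      (≡.trans (≡.cong (ρ (ℤ.- c) ℕ.*_) (Σₚ-point c)) (ℕ.*-identityʳ _)))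

  -- As Q is in R, the substitution Q x for x turns the count into `T₊ c`. The right-hand side
  -- merges the value k at units and the value 1 + 2k at 0 into one expression in indicators, the
  -- form in which coset coefficients will be recognised.
  count-residue : ∀ {Q} → R Q → ∀ c →
    Σₚ (λ x → ρ (Q ℤ.* x ℤ.- c) ℕ.* ρ x) ≡
    k ℕ.* (ρ c ℕ.+ ρ (ℤ.- c)) ℕ.+ (1 ℕ.+ 2 ℕ.* k) ℕ.* 𝟙 (≋-dec {p} c 0ℤ)
  count-residue {Q} rQ c = begin
    Σₚ (λ x → ρ (Q ℤ.* x ℤ.- c) ℕ.* ρ x)
      ≡⟨ Σₚ-cong (λ x → ≡.trans (ℕ.*-comm (ρ (Q ℤ.* x ℤ.- c)) (ρ x))
          (≡.cong₂ ℕ._*_ (≡.trans (≡.sym (ρ-scale rQ x)) (ρ-≡ (≡.sym (ℤ.+-identityˡ (Q ℤ.* x)))))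
           (ρ-≡ (≡.cong (ℤ._- c) (≡.sym (ℤ.+-identityˡ (Q ℤ.* x))))))) ⟩
    Σₚ (λ x → ρ (0ℤ ℤ.+ Q ℤ.* x) ℕ.* ρ (0ℤ ℤ.+ Q ℤ.* x ℤ.- c))
      ≡⟨ Σₚ-affine (λ x → ρ x ℕ.* ρ (x ℤ.- c)) (λ e → ≡.cong₂ ℕ._*_ (ρ-resp e) (ρ-resp (≋-+ e ≋-refl))) 0ℤ Q
          (R⇒unit rQ) ⟩
    T₊ c
      ≡⟨ value (≋-dec {p} c 0ℤ) ⟩
    k ℕ.* (ρ c ℕ.+ ρ (ℤ.- c)) ℕ.+ (1 ℕ.+ 2 ℕ.* k) ℕ.* 𝟙 (≋-dec {p} c 0ℤ) ∎
    where
    value : (c≋0? : Dec (c ≋ 0ℤ [ p ])) → T₊ c ≡ k ℕ.* (ρ c ℕ.+ ρ (ℤ.- c)) ℕ.+ (1 ℕ.+ 2 ℕ.* k) ℕ.* 𝟙 c≋0?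
    value (yes c≋0) = ≡.trans (T₊-zero c≋0) (≡.sym (≡.cong₂ ℕ._+_
      (≡.trans (≡.cong (k ℕ.*_) (≡.cong₂ ℕ._+_ (ρ-zero c≋0) (ρ-zero (≋-neg c≋0)))) (ℕ.*-zeroʳ k)) (ℕ.*-identityʳ _)))
    value (no c≢0) = ≡.trans (T₊-unit c≢0) (≡.sym (≡.trans (≡.cong₂ ℕ._+_
      (≡.trans (≡.cong (k ℕ.*_) (≡.trans (≡.sym (unit-count c))
          (𝟙-yes (unit? p c) (unit-mod-prime p-prime c c≢0)))) (ℕ.*-identityʳ k))
      (ℕ.*-zeroʳ (1 ℕ.+ 2 ℕ.* k))) (ℕ.+-identityʳ k)))

  -- Now -Q is in R, and substituting -Q x for x gives `T₋ c`, which `T-sum` expresses through `T₊`.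
  count-nonresidue : ∀ {Q} → R (ℤ.- Q) → ∀ c →
    Σₚ (λ x → ρ (Q ℤ.* x ℤ.- c) ℕ.* ρ x) ≡ k ℕ.* ρ (ℤ.- c) ℕ.+ (k ℕ.+ 1) ℕ.* ρ c
  count-nonresidue {Q} r-Q c = begin
    Σₚ (λ x → ρ (Q ℤ.* x ℤ.- c) ℕ.* ρ x)
      ≡⟨ Σₚ-cong (λ x → ≡.trans (ℕ.*-comm (ρ (Q ℤ.* x ℤ.- c)) (ρ x))
          (≡.cong₂ ℕ._*_ (≡.trans (≡.sym (ρ-scale r-Q x)) (ρ-≡ (≡.sym (ℤ.+-identityˡ (ℤ.- Q ℤ.* x)))))
           (ρ-≡ (double Q x c)))) ⟩
    Σₚ (λ x → ρ (0ℤ ℤ.+ ℤ.- Q ℤ.* x) ℕ.* ρ (ℤ.- (0ℤ ℤ.+ ℤ.- Q ℤ.* x) ℤ.- c))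
      ≡⟨ Σₚ-affine (λ x → ρ x ℕ.* ρ (ℤ.- x ℤ.- c))
          (λ e → ≡.cong₂ ℕ._*_ (ρ-resp e) (ρ-resp (≋-+ (≋-neg e) ≋-refl))) 0ℤ (ℤ.- Q) (R⇒unit r-Q) ⟩
    T₋ c
      ≡⟨ value (≋-dec {p} c 0ℤ) ⟩
    k ℕ.* ρ (ℤ.- c) ℕ.+ (k ℕ.+ 1) ℕ.* ρ c ∎
    where
    double : ∀ Q x c → Q ℤ.* x ℤ.- c ≡ ℤ.- (0ℤ ℤ.+ ℤ.- Q ℤ.* x) ℤ.- c
    double = solve-∀
    neg-≢0 : ¬ (c ≋ 0ℤ [ p ]) → ¬ (ℤ.- c ≋ 0ℤ [ p ])
    neg-≢0 c≢0 e = c≢0 (≋-trans (≡⇒≋ (≡.sym (ℤ.neg-involutive c))) (≋-neg e))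
    value : Dec (c ≋ 0ℤ [ p ]) → T₋ c ≡ k ℕ.* ρ (ℤ.- c) ℕ.+ (k ℕ.+ 1) ℕ.* ρ c
    -- Here `T₊` already exhausts the total 1 + 2k, which leaves 0 for `T₋`.
    value (yes c≋0) = ℕ.+-cancelˡ-≡ (1 ℕ.+ 2 ℕ.* k) _ _ (begin
      1 ℕ.+ 2 ℕ.* k ℕ.+ T₋ c
        ≡⟨ ≡.cong₂ (λ a b → a ℕ.+ (b ℕ.+ T₋ c)) (ρ-zero (≋-neg c≋0)) (T₊-zero (≋-neg c≋0)) ⟨
      ρ (ℤ.- c) ℕ.+ (T₊ (ℤ.- c) ℕ.+ T₋ c)
        ≡⟨ T-sum c ⟩
      1 ℕ.+ 2 ℕ.* k
        ≡⟨ annihilate k ⟩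
      1 ℕ.+ 2 ℕ.* k ℕ.+ (k ℕ.* 0 ℕ.+ (k ℕ.+ 1) ℕ.* 0)
        ≡⟨ ≡.cong₂ (λ a b → 1 ℕ.+ 2 ℕ.* k ℕ.+ (k ℕ.* a ℕ.+ (k ℕ.+ 1) ℕ.* b)) (ρ-zero (≋-neg c≋0)) (ρ-zero c≋0) ⟨
      1 ℕ.+ 2 ℕ.* k ℕ.+ (k ℕ.* ρ (ℤ.- c) ℕ.+ (k ℕ.+ 1) ℕ.* ρ c) ∎)
      where
      annihilate : ∀ k → 1 ℕ.+ 2 ℕ.* k ≡ 1 ℕ.+ 2 ℕ.* k ℕ.+ (k ℕ.* 0 ℕ.+ (k ℕ.+ 1) ℕ.* 0)
      annihilate = ℕSolver.solve-∀
    -- `T-sum` leaves k + 1 - ρ(-c), that is k if -c is in R and k + 1 if c is. To avoid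
    -- subtraction, a factor 1 is replaced by ρ(c) + ρ(-c).
    value (no c≢0) = ℕ.+-cancelˡ-≡ (ρ (ℤ.- c) ℕ.+ k) _ _ (begin
      ρ (ℤ.- c) ℕ.+ k ℕ.+ T₋ c
        ≡⟨ ℕ.+-assoc (ρ (ℤ.- c)) k _ ⟩
      ρ (ℤ.- c) ℕ.+ (k ℕ.+ T₋ c)
        ≡⟨ ≡.cong (λ a → ρ (ℤ.- c) ℕ.+ (a ℕ.+ T₋ c)) (T₊-unit (neg-≢0 c≢0)) ⟨
      ρ (ℤ.- c) ℕ.+ (T₊ (ℤ.- c) ℕ.+ T₋ c)
        ≡⟨ T-sum c ⟩
      1 ℕ.+ 2 ℕ.* k
        ≡⟨ split k ⟩
      1 ℕ.* (k ℕ.+ 1) ℕ.+ k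
        ≡⟨ ≡.cong (λ a → a ℕ.* (k ℕ.+ 1) ℕ.+ k)
            (≡.trans (≡.sym (𝟙-yes (unit? p c) (unit-mod-prime p-prime c c≢0))) (unit-count c)) ⟩
      (ρ c ℕ.+ ρ (ℤ.- c)) ℕ.* (k ℕ.+ 1) ℕ.+ k
        ≡⟨ regroup (ρ c) (ρ (ℤ.- c)) k ⟩
      ρ (ℤ.- c) ℕ.+ k ℕ.+ (k ℕ.* ρ (ℤ.- c) ℕ.+ (k ℕ.+ 1) ℕ.* ρ c) ∎)
      where
      split : ∀ k → 1 ℕ.+ 2 ℕ.* k ≡ 1 ℕ.* (k ℕ.+ 1) ℕ.+ k
      split = ℕSolver.solve-∀
      regroup : ∀ a b k → (a ℕ.+ b) ℕ.* (k ℕ.+ 1) ℕ.+ k ≡ b ℕ.+ k ℕ.+ (k ℕ.* b ℕ.+ (k ℕ.+ 1) ℕ.* a)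
      regroup = ℕSolver.solve-∀

-- Multiplicative orders

^-periodic : ∀ {m k} d → k ℤ.^ d ≋ 1ℤ [ m ] → ∀ a b → k ℤ.^ (a ℕ.+ d ℕ.* b) ≋ k ℤ.^ a [ m ]
^-periodic {m} {k} d k^d≋1 a b = begin
  k ℤ.^ (a ℕ.+ d ℕ.* b)             ≡⟨ ℤ.^-distribˡ-+-* k a (d ℕ.* b) ⟩
  k ℤ.^ a ℤ.* k ℤ.^ (d ℕ.* b)       ≡⟨ ≡.cong (k ℤ.^ a ℤ.*_) (ℤ.^-*-assoc k d b) ⟨
  k ℤ.^ a ℤ.* (k ℤ.^ d) ℤ.^ b       ≈⟨ ≋-*ˡ {x = k ℤ.^ a} (≋-^ k^d≋1 b) ⟩
  k ℤ.^ a ℤ.* 1ℤ ℤ.^ b              ≡⟨ ≡.cong (k ℤ.^ a ℤ.*_) (ℤ.^-zeroˡ b) ⟩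
  k ℤ.^ a ℤ.* 1ℤ                    ≡⟨ ℤ.*-identityʳ (k ℤ.^ a) ⟩
  k ℤ.^ a                           ∎
  where open ≋-Reasoning m

^-mod : ∀ {m k d} .{{_ : NonZero d}} → k ℤ.^ d ≋ 1ℤ [ m ] → ∀ {a b} → + a ≋ + b [ d ] → k ℤ.^ a ≋ k ℤ.^ b [ m ]
^-mod {m} {k} {d} k^d≋1 {a} {b} e = ≋-trans (reduce a) (≋-trans (≡⇒≋ (≡.cong (k ℤ.^_) remainders)) (≋-sym (reduce b)))
  where
  reduce : ∀ a → k ℤ.^ a ≋ k ℤ.^ (a ℕ.% d) [ m ]
  reduce a = ≋-trans (≡⇒≋ (≡.cong (k ℤ.^_) (≡.trans (ℕ.m≡m%n+[m/n]*n a d)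
      (≡.cong (a ℕ.% d ℕ.+_) (ℕ.*-comm (a ℕ./ d) d)))))
    (^-periodic d k^d≋1 (a ℕ.% d) (a ℕ./ d))
  remainders : a ℕ.% d ≡ b ℕ.% d
  remainders = ≡.trans (≡.sym (Fin.toℕ-fromℕ< _)) (≡.trans (≡.cong toℕ (residue-cong e)) (Fin.toℕ-fromℕ< _))

module _ {m d : ℕ} {k : ℤ} (ord : HasOrder m k d) where
  open HasOrder ord

  order-power : k ℤ.^ d ≋ 1ℤ [ m ]
  order-power = from-mod power

  order-nonZero : NonZero d
  order-nonZero = ℕ.>-nonZero positive

  order-unit : Unit m k
  order-unit = unit (k ℤ.^ ℕ.pred d) (≋-trans (≡⇒≋ (≡.cong (k ℤ.^_) (ℕ.suc-pred d {{order-nonZero}}))) order-power)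

  order-≤ : ∀ {a b} → a ℕ.< b → b ℕ.< d → ¬ (k ℤ.^ a ≋ k ℤ.^ b [ m ])
  order-≤ {a} {b} a<b b<d e = ℕ.<⇒≱ b<d (ℕ.≤-trans (minimal (b ℕ.∸ a) (ℕ.m<n⇒0<n∸m a<b) (to-mod k^[b-a]≋1))
      (ℕ.m∸n≤m b a))
    where
    k^[b-a]≋1 : k ℤ.^ (b ℕ.∸ a) ≋ 1ℤ [ m ]
    k^[b-a]≋1 = unit-cancel (k ℤ.^ a) (unit-^ order-unit a) (begin
      k ℤ.^ a ℤ.* k ℤ.^ (b ℕ.∸ a)    ≡⟨ ℤ.^-distribˡ-+-* k a (b ℕ.∸ a) ⟨
      k ℤ.^ (a ℕ.+ (b ℕ.∸ a))        ≡⟨ ≡.cong (k ℤ.^_) (ℕ.m+[n∸m]≡n (ℕ.<⇒≤ a<b)) ⟩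
      k ℤ.^ b                        ≈⟨ e ⟨
      k ℤ.^ a                        ≡⟨ ℤ.*-identityʳ (k ℤ.^ a) ⟨
      k ℤ.^ a ℤ.* 1ℤ                 ∎)
      where open ≋-Reasoning m

  order-injective : (i j : Fin d) → k ℤ.^ toℕ i ≋ k ℤ.^ toℕ j [ m ] → i ≡ j
  order-injective i j e = compare (ℕ.<-cmp (toℕ i) (toℕ j))
    where
    compare : _ → i ≡ j
    compare (tri< i<j _ _) = ⊥-elim (order-≤ i<j (Fin.toℕ<n j) e)
    compare (tri≈ _ i≡j _) = Fin.toℕ-injective i≡j
    compare (tri> _ _ i>j) = ⊥-elim (order-≤ i>j (Fin.toℕ<n i) (≋-sym e))

generator : ∀ {m k} .{{_ : NonZero m}} → HasOrder m k (φ m) → ∀ u → Unit m u → ∃[ r ] u ≋ k ℤ.^ r [ m ]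
generator {m} {k} ord u v = as-power (units-exhausted m (λ i → k ℤ.^ toℕ i)
    (λ i → unit-^ (order-unit ord) (toℕ i)) (order-injective ord) u v)
  where
  as-power : (∃[ i ] u ≋ k ℤ.^ toℕ {φ m} i [ m ]) → ∃[ r ] u ≋ k ℤ.^ r [ m ]
  as-power (i , e) = toℕ i , e

-- The L powers of k and their L negatives are pairwise distinct units, and there are φ m of them,
-- so no unit is left over.
generator-± : ∀ {m k L} .{{_ : NonZero m}} → HasOrder m k L → φ m ≡ L ℕ.+ L →
              (∀ a b → ¬ (k ℤ.^ a ≋ ℤ.- k ℤ.^ b [ m ])) →
              ∀ u → Unit m u → (∃[ r ] u ≋ k ℤ.^ r [ m ]) ⊎ (∃[ r ] ℤ.- u ≋ k ℤ.^ r [ m ])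
generator-± {m} {k} {L} ord φ≡2L disjoint u v =
  -- `Exhausts` is `units-exhausted` with the number of classes made variable, so that it can be
  -- taken as L + L and split into two halves.
  as-power (≡.subst Exhausts φ≡2L (units-exhausted m) (f ∘ splitAt L) (f-unit ∘ splitAt L) f-injective u v)
  where
  Exhausts : ℕ → Set
  Exhausts N = (f : Fin N → ℤ) → (∀ i → Unit m (f i)) → (∀ i j → f i ≋ f j [ m ] → i ≡ j) →
               ∀ u → Unit m u → ∃[ i ] u ≋ f i [ m ]
  f : Fin L ⊎ Fin L → ℤ
  f (inj₁ i) = k ℤ.^ toℕ i
  f (inj₂ i) = ℤ.- k ℤ.^ toℕ i
  f-unit : ∀ i → Unit m (f i)
  f-unit (inj₁ i) = unit-^ (order-unit ord) (toℕ i)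
  f-unit (inj₂ i) = unit-neg (unit-^ (order-unit ord) (toℕ i))
  same : ∀ i j → f i ≋ f j [ m ] → i ≡ j
  same (inj₁ i) (inj₁ j) e = ≡.cong inj₁ (order-injective ord i j e)
  same (inj₁ i) (inj₂ j) e = ⊥-elim (disjoint (toℕ i) (toℕ j) e)
  same (inj₂ i) (inj₁ j) e = ⊥-elim (disjoint (toℕ j) (toℕ i) (≋-sym e))
  same (inj₂ i) (inj₂ j) e = ≡.cong inj₂ (order-injective ord i j
    (≋-trans (≡⇒≋ (≡.sym (ℤ.neg-involutive (k ℤ.^ toℕ i)))) (≋-trans (≋-neg e) (≡⇒≋ (ℤ.neg-involutive (k ℤ.^ toℕ j))))))
  f-injective : ∀ i j → f (splitAt L i) ≋ f (splitAt L j) [ m ] → i ≡ j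
  f-injective i j e = ≡.trans (≡.sym (Fin.join-splitAt L L i))
    (≡.trans (≡.cong (join L L) (same (splitAt L i) (splitAt L j) e)) (Fin.join-splitAt L L j))
  as-power′ : ∀ i → u ≋ f i [ m ] → (∃[ r ] u ≋ k ℤ.^ r [ m ]) ⊎ (∃[ r ] ℤ.- u ≋ k ℤ.^ r [ m ])
  as-power′ (inj₁ i) e = inj₁ (toℕ i , e)
  as-power′ (inj₂ i) e = inj₂ (toℕ i , ≋-trans (≋-neg e) (≡⇒≋ (ℤ.neg-involutive (k ℤ.^ toℕ i))))
  as-power : (∃[ i ] u ≋ f (splitAt L i) [ m ]) → (∃[ r ] u ≋ k ℤ.^ r [ m ]) ⊎ (∃[ r ] ℤ.- u ≋ k ℤ.^ r [ m ])
  as-power (i , e) = as-power′ (splitAt L i) e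

-- The Chinese remainder theorem for exponents: r = r₁ + L x, where x solves L x ≡ r₂ - r₁ modulo F
-- by means of the inverse of L.
common-exponent : ∀ {a b k L F} .{{_ : NonZero F}} → k ℤ.^ L ≋ 1ℤ [ a ] → k ℤ.^ F ≋ 1ℤ [ b ] → Coprime L F →
                  ∀ r₁ r₂ → ∃[ r ] (k ℤ.^ r ≋ k ℤ.^ r₁ [ a ]) × (k ℤ.^ r ≋ k ℤ.^ r₂ [ b ])
common-exponent {a} {b} {k} {L} {F} k^L≋1 k^F≋1 L⊥F r₁ r₂ =
  r₁ ℕ.+ L ℕ.* x , ^-periodic L k^L≋1 r₁ x , ^-mod k^F≋1 (begin
    + (r₁ ℕ.+ L ℕ.* x)                      ≡⟨ ≡.cong (ℤ._+_ (+ r₁)) (ℤ.pos-* L x) ⟩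
    + r₁ ℤ.+ + L ℤ.* + x                    ≈⟨ ≋-+ (≋-refl {x = + r₁}) (≋-*ˡ {x = + L} (residue-≋ F _)) ⟩
    + r₁ ℤ.+ + L ℤ.* (L⁻¹ ℤ.* (+ r₂ ℤ.- + r₁)) ≡⟨ ≡.cong (ℤ._+_ (+ r₁)) (ℤ.*-assoc (+ L) L⁻¹ (+ r₂ ℤ.- + r₁)) ⟨
    + r₁ ℤ.+ (+ L ℤ.* L⁻¹) ℤ.* (+ r₂ ℤ.- + r₁) ≈⟨ ≋-+ (≋-refl {x = + r₁})
        (≋-*ʳ {x = + r₂ ℤ.- + r₁} (Unit.isInverse L-unit)) ⟩
    + r₁ ℤ.+ 1ℤ ℤ.* (+ r₂ ℤ.- + r₁)         ≡⟨ cancel (+ r₁) (+ r₂) ⟩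
    + r₂                                    ∎)
  where
  open ≋-Reasoning F
  L-unit : Unit F (+ L)
  L-unit = coprime⇒unit (+ L) L⊥F
  L⁻¹ : ℤ
  L⁻¹ = Unit.inverse L-unit
  x : ℕ
  x = toℕ (residue F (L⁻¹ ℤ.* (+ r₂ ℤ.- + r₁)))
  cancel : ∀ r₁ r₂ → r₁ ℤ.+ 1ℤ ℤ.* (r₂ ℤ.- r₁) ≡ r₂
  cancel = solve-∀

neg-^-odd : ∀ x h → (ℤ.- x) ℤ.^ (1 ℕ.+ 2 ℕ.* h) ≡ ℤ.- (x ℤ.^ (1 ℕ.+ 2 ℕ.* h))
neg-^-odd x h = begin
  ℤ.- x ℤ.* (ℤ.- x) ℤ.^ (2 ℕ.* h)     ≡⟨ ≡.cong (ℤ.- x ℤ.*_) (ℤ.^-*-assoc (ℤ.- x) 2 h) ⟨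
  ℤ.- x ℤ.* ((ℤ.- x) ℤ.^ 2) ℤ.^ h     ≡⟨ ≡.cong (λ z → ℤ.- x ℤ.* z ℤ.^ h) (square x) ⟩
  ℤ.- x ℤ.* (x ℤ.^ 2) ℤ.^ h           ≡⟨ ≡.cong (ℤ.- x ℤ.*_) (ℤ.^-*-assoc x 2 h) ⟩
  ℤ.- x ℤ.* x ℤ.^ (2 ℕ.* h)           ≡⟨ ℤ.neg-distribˡ-* x (x ℤ.^ (2 ℕ.* h)) ⟨
  ℤ.- (x ℤ.* x ℤ.^ (2 ℕ.* h))         ∎
  where
  open ≡.≡-Reasoning
  square : ∀ x → ℤ.- x ℤ.* (ℤ.- x ℤ.* 1ℤ) ≡ x ℤ.* (x ℤ.* 1ℤ)
  square = solve-∀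

parity : ∀ r → ∃[ k ] (r ≡ k ℕ.+ k ⊎ r ≡ suc (k ℕ.+ k))
parity zero    = 0 , inj₁ refl
parity (suc r) with parity r
... | k , inj₁ r≡2k   = k , inj₂ (≡.cong suc r≡2k)
... | k , inj₂ r≡2k+1 = suc k , inj₁ (≡.trans (≡.cong suc r≡2k+1) (≡.cong suc (≡.sym (ℕ.+-suc k k))))

-- The powers of l modulo p form an index-2 subgroup without -1, because the order 2h + 1 of l modulo P is odd and half of φ P.
module PowerClass
  (p P h : ℕ) (l : ℤ) (p-prime : Prime p) (p≢2 : ¬ (p ≡ 2))
  .{{_ : NonZero P}} (p∣P : p ∣.∣ P) (lift-unit : ∀ {x} → Unit p x → Unit P x)
  (ord : HasOrder P l (1 ℕ.+ 2 ℕ.* h)) (φ≡ : φ P ≡ (1 ℕ.+ 2 ℕ.* h) ℕ.+ (1 ℕ.+ 2 ℕ.* h))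
  where

  private
    L : ℕ
    L = 1 ℕ.+ 2 ℕ.* h

    l^L≋1 : l ℤ.^ L ≋ 1ℤ [ p ]
    l^L≋1 = ≋-∣ p∣P (order-power ord)

  -- Taken modulo p, where the counting takes place, although the order of l is given modulo P;
  -- `R-lift` provides the passage back.
  R : ℤ → Set
  R x = ∃[ r ] x ≋ l ℤ.^ r [ p ]

  R-resp : ∀ {x y} → x ≋ y [ p ] → R x → R y
  R-resp e (r , e′) = r , ≋-trans (≋-sym e) e′

  R⇒unit : ∀ {x} → R x → Unit p x
  R⇒unit (r , e) = unit-resp (≋-sym e) (unit-∣ p∣P (unit-^ (order-unit ord) r))

  R-* : ∀ {x y} → R x → R y → R (x ℤ.* y)
  R-* (r , e) (r′ , e′) = r ℕ.+ r′ , ≋-trans (≋-* e e′) (≡⇒≋ (≡.sym (ℤ.^-distribˡ-+-* l r r′)))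

  private
    power-of-power : ∀ r → (l ℤ.^ r) ℤ.^ L ≋ 1ℤ [ p ]
    power-of-power r = ≋-trans (≡⇒≋ (≡.trans (ℤ.^-*-assoc l r L) (≡.cong (l ℤ.^_) (ℕ.*-comm r L))))
        (^-periodic L l^L≋1 0 r)

  -- Raised to the odd exponent L, both x and -x would become 1, whence 1 ≡ -1 modulo p and p
  -- divides 2.
  R-exclusive : ∀ {x} → R x → ¬ R (ℤ.- x)
  R-exclusive {x} (r , e) (r′ , e′) = p≢2 (divides-2 (∣.∣⇒≤ p∣2))
    where
    1≋-1 : 1ℤ ≋ ℤ.- 1ℤ [ p ]
    1≋-1 = begin
      1ℤ                     ≈⟨ power-of-power r′ ⟨
      (l ℤ.^ r′) ℤ.^ L       ≈⟨ ≋-^ e′ L ⟨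
      (ℤ.- x) ℤ.^ L          ≡⟨ neg-^-odd x h ⟩
      ℤ.- (x ℤ.^ L)          ≈⟨ ≋-neg (≋-^ e L) ⟩
      ℤ.- ((l ℤ.^ r) ℤ.^ L)  ≈⟨ ≋-neg (power-of-power r) ⟩
      ℤ.- 1ℤ                 ∎
      where open ≋-Reasoning p
    p∣2 : p ∣.∣ 2
    p∣2 = Signed.∣⇒∣ᵤ (to-mod 1≋-1)
    divides-2 : p ℕ.≤ 2 → p ≡ 2
    divides-2 p≤2 = ℕ.≤-antisym p≤2 (ℕ.nonTrivial⇒n>1 p {{prime⇒nonTrivial p-prime}})

  ±-power : ∀ u → Unit p u → (∃[ r ] u ≋ l ℤ.^ r [ P ]) ⊎ (∃[ r ] ℤ.- u ≋ l ℤ.^ r [ P ])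
  ±-power u v = generator-± ord φ≡
    (λ a b e → R-exclusive {l ℤ.^ a} (a , ≋-refl) (b , ≋-trans (≋-neg (≋-∣ p∣P e)) (≡⇒≋ (ℤ.neg-involutive (l ℤ.^ b)))))
    u (lift-unit v)

  R-split : ∀ {u} → Unit p u → R u ⊎ R (ℤ.- u)
  R-split {u} v = [ inj₁ ∘ weaken , inj₂ ∘ weaken ]′ (±-power u v)
    where
    weaken : ∀ {u} → (∃[ r ] u ≋ l ℤ.^ r [ P ]) → R u
    weaken (r , e) = r , ≋-∣ p∣P e

  -- Modulo P either u or -u is a power of l, and the second would put -u into R. So the class
  -- modulo p decides the class modulo P.
  R-lift : ∀ {u} → R u → ∃[ r ] u ≋ l ℤ.^ r [ P ]
  R-lift {u} ru = [ id , (λ (r , e) → ⊥-elim (R-exclusive ru (r , ≋-∣ p∣P e))) ]′ (±-power u (R⇒unit ru))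

  abstract
    R? : ∀ x → Dec (R x)
    R? x = decide (unit? p x)
      where
      from-split : R x ⊎ R (ℤ.- x) → Dec (R x)
      from-split (inj₁ rx)  = yes rx
      from-split (inj₂ r-x) = no λ rx → R-exclusive rx r-x
      decide : Dec (Unit p x) → Dec (R x)
      decide (yes u) = from-split (R-split u)
      decide (no ¬u) = no (¬u ∘ R⇒unit)

  R-square : ∀ {x} → Unit p x → R (x ℤ.* x)
  R-square {x} u = [ (λ rx → R-* rx rx) , (λ r-x → ≡.subst R (negs x) (R-* r-x r-x)) ]′ (R-split u)
    where
    negs : ∀ x → ℤ.- x ℤ.* ℤ.- x ≡ x ℤ.* x
    negs = solve-∀

  R⇒square : ∀ {x} → R x → ∃[ y ] y ℤ.* y ≋ x [ p ]
  R⇒square {x} (r , e) = root (parity r)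
    where
    square : ∀ k → l ℤ.^ k ℤ.* l ℤ.^ k ≡ l ℤ.^ (k ℕ.+ k)
    square k = ≡.sym (ℤ.^-distribˡ-+-* l k k)
    root : (∃[ k ] (r ≡ k ℕ.+ k ⊎ r ≡ suc (k ℕ.+ k))) → ∃[ y ] y ℤ.* y ≋ x [ p ]
    root (k , inj₁ r≡2k) = l ℤ.^ k , ≋-trans (≡⇒≋ (≡.trans (square k) (≡.cong (l ℤ.^_) (≡.sym r≡2k)))) (≋-sym e)
    -- An odd exponent becomes even on adding the odd period: (2k + 1) + (2h + 1) = 2 (k + h + 1).
    root (k , inj₂ r≡2k+1) = l ℤ.^ (k ℕ.+ suc h) , ≋-trans
        (≡⇒≋ (≡.trans (square (k ℕ.+ suc h)) (≡.cong (l ℤ.^_) exponent)))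
        (≋-trans (^-periodic L l^L≋1 r 1) (≋-sym e))
      where
      rearrange : ∀ k h → (k ℕ.+ suc h) ℕ.+ (k ℕ.+ suc h) ≡ suc (k ℕ.+ k) ℕ.+ (1 ℕ.+ 2 ℕ.* h) ℕ.* 1
      rearrange = ℕSolver.solve-∀
      exponent : (k ℕ.+ suc h) ℕ.+ (k ℕ.+ suc h) ≡ r ℕ.+ L ℕ.* 1
      exponent = ≡.trans (rearrange k h) (≡.cong (ℕ._+ L ℕ.* 1) (≡.sym r≡2k+1))

-- Cosets modulo p^s q^t

𝟙-disjoint : ∀ {P Q : Set} (P? : Dec P) (Q? : Dec Q) → (P → ¬ Q) → 𝟙 P? ℕ.* 𝟙 Q? ≡ 0
𝟙-disjoint (yes p) Q? disjoint = ≡.cong (ℕ._+ 0) (𝟙-no Q? (disjoint p))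
𝟙-disjoint (no _)  Q? disjoint = refl

power-∣ : ∀ p {a b} → a ℕ.≤ b → p ^ a ∣.∣ p ^ b
power-∣ p {a} {b} a≤b = ∣.divides (p ^ (b ∸ a))
    (≡.trans (≡.cong (p ^_) (≡.sym (ℕ.m∸n+n≡m a≤b))) (ℕ.^-distribˡ-+-* p (b ∸ a) a))

power-split : ∀ p {a b} → a ℕ.≤ b → p ^ b ≡ p ^ a ℕ.* p ^ (b ∸ a)
power-split p {a} {b} a≤b = ≡.trans (≡.cong (p ^_) (≡.sym (ℕ.m+[n∸m]≡n a≤b))) (ℕ.^-distribˡ-+-* p a (b ∸ a))

sum-multiples : ∀ d M .{{_ : NonZero d}} (f : ℤ → ℕ) → (∀ x → ¬ (x ≋ 0ℤ [ d ]) → f x ≡ 0) →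
                sum {M ℕ.* d} (λ i → f (+ toℕ i)) ≡ sum {M} (λ i → f (+ d ℤ.* + toℕ i))
sum-multiples d@(suc d-1) M f f-zero = ≡.trans (sum-* M d (λ i → f (+ i))) (sum-cong-≋ {M} λ i → ≡.trans
    (≡.cong₂ ℕ._+_
      (≡.cong f (≡.trans (≡.cong +_ (≡.trans (ℕ.+-identityʳ (toℕ i ℕ.* d)) (ℕ.*-comm (toℕ i) d))) (ℤ.pos-* d (toℕ i))))
      (sum-zero d-1 _ λ j → f-zero _ λ e → distinct j
          (toℕ-≋-injective (Fin.suc j) Fin.zero (≋-trans (≋-sym (offset (toℕ i) (suc (toℕ j)))) e))))
    (ℕ.+-identityʳ _))
  where
  distinct : ∀ (j : Fin d-1) → ¬ (Fin.suc j ≡ Fin.zero)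
  distinct j ()
  offset : ∀ a b → + (a ℕ.* d ℕ.+ b) ≋ + b [ d ]
  offset a b = congruent (+ a) (≡.trans (≡.cong (λ z → (z ℤ.+ + b) ℤ.- + b) (ℤ.pos-* a d)) (cancel (+ a ℤ.* + d) (+ b)))
    where
    cancel : ∀ x j → (x ℤ.+ j) ℤ.- j ≡ x
    cancel = solve-∀

-- Here `1 + 2 * h` is half of φ(p^s), and `k` is (p - 3)/4. The gcd condition of the theorem
-- appears as `L⊥F`, which lets exponents of l be prescribed independently at p and at q.
module TwoPrimes
  (s t p q l k h : ℕ) (g : ℤ) (1≤s : 1 ℕ.≤ s)
  (p-prime : Prime p) (q-prime : Prime q) (p≢q : ¬ (p ≡ q)) (p≡3+4k : p ≡ 3 ℕ.+ 4 ℕ.* k)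
  (φ≡ : φ (p ^ s) ≡ (1 ℕ.+ 2 ℕ.* h) ℕ.+ (1 ℕ.+ 2 ℕ.* h))
  (p-order : HasOrder (p ^ s) (+ l) (1 ℕ.+ 2 ℕ.* h))
  (q-order : HasOrder (q ^ t) (+ l) (φ (q ^ t))) (L⊥F : Coprime (1 ℕ.+ 2 ℕ.* h) (φ (q ^ t)))
  (g-order : PrimitiveRoot (p ^ s) g) (g-unit : Unit (q ^ t) g)
  where

  private
    L F n : ℕ
    L = 1 ℕ.+ 2 ℕ.* h
    F = φ (q ^ t)
    n = p ^ s ℕ.* q ^ t

    instance
      p≢0 : NonZero p
      p≢0 = prime⇒nonZero p-prime
      q≢0 : NonZero q
      q≢0 = prime⇒nonZero q-prime
      P≢0 : NonZero (p ^ s)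
      P≢0 = ℕ.m^n≢0 p s
      Q≢0 : NonZero (q ^ t)
      Q≢0 = ℕ.m^n≢0 q t
      n≢0 : NonZero n
      n≢0 = ℕ.m*n≢0 (p ^ s) (q ^ t)
      F≢0 : NonZero F
      F≢0 = order-nonZero q-order

  d≢0 : ∀ i j → NonZero (p ^ i ℕ.* q ^ j)
  d≢0 i j = ℕ.m*n≢0 (p ^ i) (q ^ j) {{ℕ.m^n≢0 p i}} {{ℕ.m^n≢0 q j}}

  p≢2 : ¬ (p ≡ 2)
  p≢2 p≡2 = absurd (≡.trans (≡.sym p≡2) p≡3+4k)
    where
    absurd : ¬ (2 ≡ 3 ℕ.+ 4 ℕ.* k)
    absurd ()

  primes-unit : ∀ {p q} → Prime p → Prime q → ¬ (p ≡ q) → Unit q (+ p)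
  primes-unit {p} {q} pp pq p≢q = unit-mod-prime pq (+ p) λ e →
      [ (λ q≡1 → ℕ.<⇒≢ (ℕ.nonTrivial⇒n>1 q {{prime⇒nonTrivial pq}}) (≡.sym q≡1)) , p≢q ∘ ≡.sym ]′
        (prime⇒irreducible pp (≡.subst (q ∣.∣_) (≡.cong ∣_∣ (ℤ.+-identityʳ (+ p))) (Signed.∣⇒∣ᵤ (to-mod e))))

  p-unit-q : ∀ b → Unit (q ^ b) (+ p)
  p-unit-q b = unit-prime-power q b (primes-unit p-prime q-prime p≢q)

  unit-pos-^ : ∀ {m x} a → Unit m (+ x) → Unit m (+ (x ^ a))
  unit-pos-^ zero    u = unit-1
  unit-pos-^ {m} {x} (suc a) u = ≡.subst (Unit m) (≡.sym (ℤ.pos-* x (x ^ a))) (unit-* u (unit-pos-^ a u))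

  q^b⊥p^a : ∀ a b → Coprime (q ^ b) (p ^ a)
  q^b⊥p^a a b = Coprimality.sym (unit⇒coprime (unit-pos-^ a (p-unit-q b)))

  open PowerClass p (p ^ s) h (+ l) p-prime p≢2 (p∣p^ p {s} 1≤s) (unit-prime-power p s) p-order φ≡ public
  open HalfSystem p k p-prime p≡3+4k R R? R-resp R⇒unit R-split R-exclusive R-* public

  -- If g were in R, it would be a power of l modulo p^s, so g^L would be 1 although g has order 2L.
  R-neg-g : R (ℤ.- g)
  R-neg-g = [ ⊥-elim ∘ not-R , id ]′ (R-split (unit-∣ (p∣p^ p {s} 1≤s) (order-unit g-order)))
    where
    not-R : ¬ R g
    not-R rg = impossible (R-lift rg)
      where
      impossible : ¬ (∃[ r ] g ≋ (+ l) ℤ.^ r [ p ^ s ])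
      impossible (r , e) = ℕ.<⇒≱ (ℕ.m<m+n L (ℕ.z<s {2 ℕ.* h})) (≡.subst (ℕ._≤ L) φ≡
        (HasOrder.minimal g-order L (ℕ.s≤s ℕ.z≤n) (to-mod (≋-trans (≋-^ e L)
          (≋-trans (≡⇒≋ (≡.trans (ℤ.^-*-assoc (+ l) r L) (≡.cong ((+ l) ℤ.^_) (ℕ.*-comm r L))))
              (^-periodic L (order-power p-order) 0 r))))))

  -- Membership of w in the coset of e, with the modulus M kept variable so that common factors can
  -- be divided out and coprime factors treated apart.
  record Powers (M : ℕ) (e w : ℤ) : Set where
    constructor powers
    field
      exponent   : ℕ
      congruence : w ≋ e ℤ.* (+ l) ℤ.^ exponent [ M ]

  -- For b ≥ 1 a unit modulo q^b is one modulo q^t, where l generates; so w divided by e is a power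
  -- of l.
  powers-q : ∀ {e} → Unit (q ^ t) e → ∀ b → b ℕ.≤ t → ∀ {w} → Unit (q ^ b) w → Powers (q ^ b) e w
  powers-q {e} _ zero _ {w} _ = powers 0 (congruent (w ℤ.- e ℤ.* (+ l) ℤ.^ 0) (≡.sym (ℤ.*-identityʳ _)))
  powers-q {e} (unit e⁻¹ ee⁻¹) b@(suc _) b≤t {w} w-unit = from-generator
      (generator q-order (e⁻¹ ℤ.* w)
        (unit-* {x = e⁻¹} (unit e (≋-trans (≡⇒≋ (ℤ.*-comm e⁻¹ e)) ee⁻¹))
            (unit-prime-power q t (unit-∣ (p∣p^ q {b} (ℕ.s≤s ℕ.z≤n)) w-unit))))
    where
    open ≋-Reasoning (q ^ b)
    from-generator : (∃[ r ] e⁻¹ ℤ.* w ≋ (+ l) ℤ.^ r [ q ^ t ]) → Powers (q ^ b) e w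
    from-generator (r , eq) = powers r (begin
      w                         ≡⟨ ℤ.*-identityˡ w ⟨
      1ℤ ℤ.* w                  ≈⟨ ≋-*ʳ {x = w} (≋-∣ (power-∣ q b≤t) ee⁻¹) ⟨
      e ℤ.* e⁻¹ ℤ.* w           ≡⟨ ℤ.*-assoc e e⁻¹ w ⟩
      e ℤ.* (e⁻¹ ℤ.* w)         ≈⟨ ≋-*ˡ {x = e} (≋-∣ (power-∣ q b≤t) eq) ⟩
      e ℤ.* (+ l) ℤ.^ r         ∎)

  powers⇒unit : ∀ {e} → Unit (q ^ t) e → ∀ {b M} → b ℕ.≤ t → q ^ b ∣.∣ M → ∀ {w} → Powers M e w → Unit (q ^ b) w
  powers⇒unit {e} e-unit {b} b≤t q^b∣M (powers r eq) = unit-resp (≋-sym (≋-∣ q^b∣M eq))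
    (unit-∣ (power-∣ q b≤t) (unit-* e-unit (unit-^ (order-unit q-order) r)))

  -- The exponents are matched modulo p^s and q^t, where the orders of l are known to be coprime,
  -- and the result is then reduced to the smaller moduli.
  powers-combine : ∀ {e} a b → a ℕ.≤ s → b ℕ.≤ t → ∀ {w} → Powers (p ^ s) e w → Powers (q ^ b) e w → Powers
      (p ^ a ℕ.* q ^ b) e w
  powers-combine {e} a b a≤s b≤t {w} (powers r₁ e₁) (powers r₂ e₂) = from-common
      (common-exponent {p ^ s} {q ^ t} {+ l} {L} {F} (order-power p-order) (order-power q-order) L⊥F r₁ r₂)
    where
    from-common : (∃[ r ] ((+ l) ℤ.^ r ≋ (+ l) ℤ.^ r₁ [ p ^ s ]) × ((+ l) ℤ.^ r ≋ (+ l) ℤ.^ r₂ [ q ^ t ])) →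
        Powers (p ^ a ℕ.* q ^ b) e w
    from-common (r , f₁ , f₂) = powers r $ ≋-combine {p ^ a} {q ^ b} (q^b⊥p^a a b)
      (≋-∣ (power-∣ p a≤s) (≋-trans e₁ (≋-*ˡ {x = e} (≋-sym f₁))))
      (≋-trans e₂ (≋-*ˡ {x = e} (≋-sym (≋-∣ (power-∣ q b≤t) f₂))))

  R⇒powers : ∀ {w} → R w → Powers (p ^ s) 1ℤ w
  R⇒powers rw = from-lift (R-lift rw)
    where
    from-lift : ∀ {w} → (∃[ r ] w ≋ (+ l) ℤ.^ r [ p ^ s ]) → Powers (p ^ s) 1ℤ w
    from-lift (r , e) = powers r $ ≋-trans e (≡⇒≋ (≡.sym (ℤ.*-identityˡ _)))

  powers⇒R : ∀ {M w} → p ∣.∣ M → Powers M 1ℤ w → R w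
  powers⇒R p∣M (powers r e) = r , ≋-trans (≋-∣ p∣M e) (≡⇒≋ (ℤ.*-identityˡ _))

  R-neg⇒powers : ∀ {w} → R (ℤ.- w) → Powers (p ^ s) g w
  R-neg⇒powers {w} r-w = from-lifts (R-lift R-neg-g) (R-lift r-w)
    where
    open ≋-Reasoning (p ^ s)
    λ^ : ℕ → ℤ
    λ^ r = (+ l) ℤ.^ r
    from-lifts : (∃[ r ] ℤ.- g ≋ (+ l) ℤ.^ r [ p ^ s ]) → (∃[ r ] ℤ.- w ≋ (+ l) ℤ.^ r [ p ^ s ]) → Powers (p ^ s) g w
    -- The quotient of -w by -g has exponent r - r₀. Adding L r₀ makes it the natural number r + 2h
    -- r₀.
    from-lifts (r₀ , e₀) (r , e) = powers (r ℕ.+ 2 ℕ.* h ℕ.* r₀) (begin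
      w                                           ≡⟨ ℤ.neg-involutive w ⟨
      ℤ.- ℤ.- w                                   ≈⟨ ≋-neg e ⟩
      ℤ.- λ^ r                                    ≈⟨ ≋-neg (^-periodic L (order-power p-order) r r₀) ⟨
      ℤ.- λ^ (r ℕ.+ L ℕ.* r₀)                     ≡⟨ ≡.cong (λ a → ℤ.- λ^ a) (rearrange r (2 ℕ.* h) r₀) ⟩
      ℤ.- λ^ (r₀ ℕ.+ (r ℕ.+ 2 ℕ.* h ℕ.* r₀))      ≡⟨ ≡.cong ℤ.-_ (ℤ.^-distribˡ-+-* (+ l) r₀ (r ℕ.+ 2 ℕ.* h ℕ.* r₀)) ⟩
      ℤ.- (λ^ r₀ ℤ.* λ^ (r ℕ.+ 2 ℕ.* h ℕ.* r₀))   ≈⟨ ≋-neg (≋-*ʳ {x = λ^ (r ℕ.+ 2 ℕ.* h ℕ.* r₀)} e₀) ⟨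
      ℤ.- (ℤ.- g ℤ.* λ^ (r ℕ.+ 2 ℕ.* h ℕ.* r₀))   ≡⟨ double g (λ^ (r ℕ.+ 2 ℕ.* h ℕ.* r₀)) ⟩
      g ℤ.* λ^ (r ℕ.+ 2 ℕ.* h ℕ.* r₀)             ∎)
      where
      rearrange : ∀ r h r₀ → r ℕ.+ (1 ℕ.+ h) ℕ.* r₀ ≡ r₀ ℕ.+ (r ℕ.+ h ℕ.* r₀)
      rearrange = ℕSolver.solve-∀
      double : ∀ g x → ℤ.- (ℤ.- g ℤ.* x) ≡ g ℤ.* x
      double = solve-∀

  powers⇒R-neg : ∀ {M w} → p ∣.∣ M → Powers M g w → R (ℤ.- w)
  powers⇒R-neg {M} {w} p∣M (powers r e) = R-resp
      (≋-trans (≡⇒≋ (≡.sym (ℤ.neg-distribˡ-* g _))) (≋-neg (≋-sym (≋-∣ p∣M e)))) (R-* R-neg-g (r , ≋-refl))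

  -- Coset membership and the coefficients of χ_ij and χ*_ij

  open CyclicPolynomials l n
  open CosetPolynomials l n
  open CyclotomicCosets l n

  In : ℤ → ℤ → Set
  In γ x = residue n x ∈C γ

  in⇒ : ∀ γ x → In γ x → Powers n γ x
  in⇒ γ x (r , e) = powers r $ ≋-trans (≋-sym (residue-≋ n x)) (from-mod e)

  in⇐ : ∀ γ x → Powers n γ x → In γ x
  in⇐ γ x (powers r e) = r , to-mod (≋-trans (residue-≋ n x) e)

  module _ d {M : ℕ} .{{_ : NonZero d}} (d*M≡n : d ℕ.* M ≡ n) where

    d∣n : d ∣.∣ n
    d∣n = ∣.divides M (≡.trans (≡.sym d*M≡n) (ℕ.*-comm d M))

    in-scale⇒ : ∀ e w → In (+ d ℤ.* e) (+ d ℤ.* w) → Powers M e w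
    in-scale⇒ e w = unscale ∘ in⇒ (+ d ℤ.* e) (+ d ℤ.* w)
      where
      unscale : Powers n (+ d ℤ.* e) (+ d ℤ.* w) → Powers M e w
      unscale (powers r eq) = powers r $ ≋-unscale d
          (≡.subst (λ m → + d ℤ.* w ≋ + d ℤ.* (e ℤ.* (+ l) ℤ.^ r) [ m ]) (≡.sym d*M≡n)
          (≋-trans eq (≡⇒≋ (ℤ.*-assoc (+ d) e _))))

    in-scale⇐ : ∀ e w → Powers M e w → In (+ d ℤ.* e) (+ d ℤ.* w)
    in-scale⇐ e w (powers r eq) = in⇐ (+ d ℤ.* e) (+ d ℤ.* w)
        (powers r $ ≋-trans (≡.subst (λ m → + d ℤ.* w ≋ + d ℤ.* (e ℤ.* (+ l) ℤ.^ r) [ m ]) d*M≡n (≋-scale d eq))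
        (≡⇒≋ (≡.sym (ℤ.*-assoc (+ d) e _))))

    in⇒multiple : ∀ e x → In (+ d ℤ.* e) x → x ≋ 0ℤ [ d ]
    in⇒multiple e x = multiple ∘ in⇒ (+ d ℤ.* e) x
      where
      multiple : Powers n (+ d ℤ.* e) x → x ≋ 0ℤ [ d ]
      multiple (powers r eq) = ≋-trans (≋-∣ d∣n eq) (≋-trans (≡⇒≋ (ℤ.*-assoc (+ d) e _))
        (≋-trans (≋-*ʳ {x = e ℤ.* (+ l) ℤ.^ r} (m≋0 {d})) (≡⇒≋ (ℤ.*-zeroˡ (e ℤ.* (+ l) ℤ.^ r)))))

  cofactor-≡ : ∀ {i j} → i ℕ.≤ s → j ℕ.≤ t → (p ^ i ℕ.* q ^ j) ℕ.* (p ^ (s ∸ i) ℕ.* q ^ (t ∸ j)) ≡ n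
  cofactor-≡ {i} {j} i≤s j≤t = ≡.trans (interchange (p ^ i) (q ^ j) (p ^ (s ∸ i)) (q ^ (t ∸ j)))
      (≡.sym (≡.cong₂ ℕ._*_ (power-split p i≤s) (power-split q j≤t)))
    where
    interchange : ∀ a b c d → a ℕ.* b ℕ.* (c ℕ.* d) ≡ a ℕ.* c ℕ.* (b ℕ.* d)
    interchange = ℕSolver.solve-∀

  δ : ℕ → ℕ → ℤ
  δ i j = + (p ^ i ℕ.* q ^ j)

  -- The coefficients of χ_ij and χ*_ij.
  χᶠ χ*ᶠ : ℕ → ℕ → ℤ → ℕ
  χᶠ  i j = member (δ i j)
  χ*ᶠ i j = member (δ i j ℤ.* g)

  δ-1 : ∀ i j → δ i j ≡ δ i j ℤ.* 1ℤ
  δ-1 i j = ≡.sym (ℤ.*-identityʳ (δ i j))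

  p∣M : ∀ {i} j → i ℕ.< s → p ∣.∣ p ^ (s ∸ i) ℕ.* q ^ (t ∸ j)
  p∣M {i} j i<s = ∣.∣m⇒∣m*n (q ^ (t ∸ j)) (p∣p^ p {s ∸ i} (ℕ.m<n⇒0<n∸m i<s))

  q∣M : ∀ i j → q ^ (t ∸ j) ∣.∣ p ^ (s ∸ i) ℕ.* q ^ (t ∸ j)
  q∣M i j = ∣.n∣m*n (p ^ (s ∸ i))

  -- Dividing by p^i q^j leaves the modulus p^(s-i) q^(t-j). As i < s, its p-part still sees the
  -- class modulo p, which decides whether w is a power of l there; its q-part asks only for a unit.
  χ-value : ∀ {i j} → i ℕ.< s → j ℕ.≤ t → ∀ w → χᶠ i j (δ i j ℤ.* w) ≡ ρ w ℕ.* 𝟙 (unit? (q ^ (t ∸ j)) w)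
  χ-value {i} {j} i<s j≤t w = 𝟙-× (residue n (δ i j ℤ.* w) ∈C? δ i j) (R? w) (unit? (q ^ (t ∸ j)) w)
      (λ m → both (in-scale⇒ (p ^ i ℕ.* q ^ j) {{d≢0 i j}} eq 1ℤ w (≡.subst (λ γ → In γ (δ i j ℤ.* w)) (δ-1 i j) m)))
      (λ rw u → ≡.subst (λ γ → In γ (δ i j ℤ.* w)) (≡.sym (δ-1 i j)) (in-scale⇐ (p ^ i ℕ.* q ^ j) {{d≢0 i j}} eq 1ℤ w
        (powers-combine (s ∸ i) (t ∸ j) (ℕ.m∸n≤m s i) (ℕ.m∸n≤m t j) (R⇒powers rw)
            (powers-q unit-1 (t ∸ j) (ℕ.m∸n≤m t j) u))))
    where
    eq = cofactor-≡ {i} {j} (ℕ.<⇒≤ i<s) j≤t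
    both : Powers (p ^ (s ∸ i) ℕ.* q ^ (t ∸ j)) 1ℤ w → R w × Unit (q ^ (t ∸ j)) w
    both m = powers⇒R (p∣M j i<s) m , powers⇒unit unit-1 (ℕ.m∸n≤m t j) (q∣M i j) m

  χ*-value : ∀ {i j} → i ℕ.< s → j ℕ.≤ t → ∀ w → χ*ᶠ i j (δ i j ℤ.* w) ≡ ρ (ℤ.- w) ℕ.* 𝟙 (unit? (q ^ (t ∸ j)) w)
  χ*-value {i} {j} i<s j≤t w = 𝟙-× (residue n (δ i j ℤ.* w) ∈C? (δ i j ℤ.* g)) (R? (ℤ.- w)) (unit? (q ^ (t ∸ j)) w)
      (both ∘ in-scale⇒ (p ^ i ℕ.* q ^ j) {{d≢0 i j}} eq g w)
      (λ r-w u → in-scale⇐ (p ^ i ℕ.* q ^ j) {{d≢0 i j}} eq g w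
        (powers-combine (s ∸ i) (t ∸ j) (ℕ.m∸n≤m s i) (ℕ.m∸n≤m t j) (R-neg⇒powers r-w)
            (powers-q g-unit (t ∸ j) (ℕ.m∸n≤m t j) u)))
    where
    eq = cofactor-≡ {i} {j} (ℕ.<⇒≤ i<s) j≤t
    both : Powers (p ^ (s ∸ i) ℕ.* q ^ (t ∸ j)) g w → R (ℤ.- w) × Unit (q ^ (t ∸ j)) w
    both m = powers⇒R-neg (p∣M j i<s) m , powers⇒unit g-unit (ℕ.m∸n≤m t j) (q∣M i j) m

  -- At i = s the p-part of the remaining modulus is p^0 = 1, so only the condition at q survives.
  χ-last : ∀ {j} → j ℕ.≤ t → ∀ w → χᶠ s j (δ s j ℤ.* w) ≡ 𝟙 (unit? (q ^ (t ∸ j)) w)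
  χ-last {j} j≤t w = 𝟙-cong (residue n (δ s j ℤ.* w) ∈C? δ s j) (unit? (q ^ (t ∸ j)) w)
      (λ m → powers⇒unit unit-1 (ℕ.m∸n≤m t j) (q∣M s j)
          (in-scale⇒ (p ^ s ℕ.* q ^ j) {{d≢0 s j}} eq 1ℤ w (≡.subst (λ γ → In γ (δ s j ℤ.* w)) (δ-1 s j) m)))
      (λ u → ≡.subst (λ γ → In γ (δ s j ℤ.* w)) (≡.sym (δ-1 s j)) (in-scale⇐ (p ^ s ℕ.* q ^ j) {{d≢0 s j}} eq 1ℤ w
        (≡.subst (λ m → Powers m 1ℤ w) (≡.sym modulus) (powers-q unit-1 (t ∸ j) (ℕ.m∸n≤m t j) u))))
    where
    eq = cofactor-≡ {s} {j} ℕ.≤-refl j≤t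
    modulus : p ^ (s ∸ s) ℕ.* q ^ (t ∸ j) ≡ q ^ (t ∸ j)
    modulus = ≡.trans (≡.cong (λ a → p ^ a ℕ.* q ^ (t ∸ j)) (ℕ.n∸n≡0 s)) (ℕ.*-identityˡ _)

  χ-zero : ∀ {i j} → i ℕ.≤ s → j ℕ.≤ t → ∀ {x} → ¬ (x ≋ 0ℤ [ p ^ i ℕ.* q ^ j ]) → χᶠ i j x ≡ 0
  χ-zero {i} {j} i≤s j≤t {x} ¬m = 𝟙-no (residue n x ∈C? δ i j) λ m →
    ¬m (in⇒multiple (p ^ i ℕ.* q ^ j) {{d≢0 i j}} (cofactor-≡ {i} {j} i≤s j≤t) 1ℤ x
        (≡.subst (λ γ → In γ x) (δ-1 i j) m))

  χ*-zero : ∀ {i j} → i ℕ.≤ s → j ℕ.≤ t → ∀ {x} → ¬ (x ≋ 0ℤ [ p ^ i ℕ.* q ^ j ]) → χ*ᶠ i j x ≡ 0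
  χ*-zero {i} {j} i≤s j≤t {x} ¬m = 𝟙-no (residue n x ∈C? (δ i j ℤ.* g)) λ m →
    ¬m (in⇒multiple (p ^ i ℕ.* q ^ j) {{d≢0 i j}} (cofactor-≡ {i} {j} i≤s j≤t) g x m)

  -- The power of q in x is exactly q^j, whereas p^i is only a lower bound for the power of p. For i
  -- ≤ s and j < t this describes the union of all C_kj and C*_kj with i ≤ k ≤ s.
  record Exact (i j : ℕ) (x : ℤ) : Set where
    constructor exact
    field
      cofactor      : ℤ
      factorisation : x ≡ δ i j ℤ.* cofactor
      cofactor-unit : Unit q cofactor

  δ-cancel : ∀ i j {v w} → δ i j ℤ.* v ≡ δ i j ℤ.* w → v ≡ w
  δ-cancel i j {v} {w} = ℤ.*-cancelˡ-≡ (δ i j) v w {{d≢0 i j}}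

  δ-multiple : ∀ i j w → δ i j ℤ.* w ≋ 0ℤ [ p ^ i ℕ.* q ^ j ]
  δ-multiple i j w = ≋-trans (≋-*ʳ {x = w} m≋0) (≡⇒≋ (ℤ.*-zeroˡ w))

  exact⇒multiple : ∀ {i j x} → Exact i j x → x ≋ 0ℤ [ p ^ i ℕ.* q ^ j ]
  exact⇒multiple {i} {j} (exact w refl _) = δ-multiple i j w

  exact-scale : ∀ i j {w} → Exact i j (δ i j ℤ.* w) → Unit q w
  exact-scale i j (exact w′ e u) = ≡.subst (Unit q) (≡.sym (δ-cancel i j e)) u

  abstract
    exact? : ∀ i j x → Dec (Exact i j x)
    exact? i j x = decide (≋-dec {p ^ i ℕ.* q ^ j} x 0ℤ)
      where
      decide-unit : ∀ {w} → x ≡ δ i j ℤ.* w → Dec (Unit q w) → Dec (Exact i j x)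
      decide-unit e    (yes u) = yes (exact _ e u)
      decide-unit refl (no ¬u) = no (¬u ∘ exact-scale i j)
      decide-multiple : (∃[ w ] x ≡ δ i j ℤ.* w) → Dec (Exact i j x)
      decide-multiple (w , e) = decide-unit e (unit? q w)
      decide : Dec (x ≋ 0ℤ [ p ^ i ℕ.* q ^ j ]) → Dec (Exact i j x)
      decide (yes m) = decide-multiple (≋0⇒∣ m)
      decide (no ¬m) = no (¬m ∘ exact⇒multiple)

  ε : ℕ → ℕ → ℤ → ℕ
  ε i j x = 𝟙 (exact? i j x)

  ε-scale : ∀ i j w → ε i j (δ i j ℤ.* w) ≡ 𝟙 (unit? q w)
  ε-scale i j w = 𝟙-cong (exact? i j (δ i j ℤ.* w)) (unit? q w) (exact-scale i j) (exact w refl)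

  δ-suc : ∀ i j w → δ (suc i) j ℤ.* w ≡ δ i j ℤ.* (+ p ℤ.* w)
  δ-suc i j w = ≡.trans (≡.cong (ℤ._* w) (≡.trans (≡.cong +_ (rearrange p (p ^ i) (q ^ j)))
      (ℤ.pos-* (p ^ i ℕ.* q ^ j) p))) (ℤ.*-assoc (δ i j) (+ p) w)
    where
    rearrange : ∀ p a b → p ℕ.* a ℕ.* b ≡ a ℕ.* b ℕ.* p
    rearrange = ℕSolver.solve-∀

  δ-shift : ∀ i {j j′} → j ℕ.≤ j′ → ∀ w → δ i j′ ℤ.* w ≡ δ i j ℤ.* (+ (q ^ (j′ ∸ j)) ℤ.* w)
  δ-shift i {j} {j′} j≤j′ w = ≡.trans (≡.cong (ℤ._* w) (≡.trans
      (≡.cong +_ (≡.trans (≡.cong (p ^ i ℕ.*_) (power-split q j≤j′)) (≡.sym (ℕ.*-assoc (p ^ i) (q ^ j) _))))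
      (ℤ.pos-* (p ^ i ℕ.* q ^ j) (q ^ (j′ ∸ j)))))
    (ℤ.*-assoc (δ i j) (+ (q ^ (j′ ∸ j))) w)

  ε-suc : ∀ i j w → ε (suc i) j (δ i j ℤ.* w) ≡ 𝟙 (≋-dec {p} w 0ℤ) ℕ.* 𝟙 (unit? q w)
  ε-suc i j w = 𝟙-× (exact? (suc i) j (δ i j ℤ.* w)) (≋-dec {p} w 0ℤ) (unit? q w)
      (λ { (exact w′ e u) → divide (δ-cancel i j (≡.trans e (δ-suc i j w′))) u })
      (λ w≋0 u → multiply (≋0⇒∣ w≋0) u)
    where
    divide : ∀ {w w′} → w ≡ + p ℤ.* w′ → Unit q w′ → (w ≋ 0ℤ [ p ]) × Unit q w
    divide {_} {w′} refl u = ≋-trans (≋-*ʳ {x = w′} m≋0) (≡⇒≋ (ℤ.*-zeroˡ w′)) , unit-*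
        (primes-unit p-prime q-prime p≢q) u
    multiply : ∀ {w} → (∃[ w′ ] w ≡ + p ℤ.* w′) → Unit q w → Exact (suc i) j (δ i j ℤ.* w)
    multiply (w′ , refl) u = exact w′ (≡.sym (δ-suc i j w′)) (unit-factor (+ p) w′ u)

  unit-q-power : ∀ {j} → j ℕ.< t → ∀ w → 𝟙 (unit? (q ^ (t ∸ j)) w) ≡ 𝟙 (unit? q w)
  unit-q-power {j} j<t w = 𝟙-cong (unit? (q ^ (t ∸ j)) w) (unit? q w)
    (unit-∣ (p∣p^ q {t ∸ j} (ℕ.m<n⇒0<n∸m j<t))) (unit-prime-power q (t ∸ j))

  -- For the cofactor w exactly one of three things happens: w is in R, -w is in R, or p divides w.
  -- The last is exactness at i + 1.
  ε-step : ∀ {i j} → i ℕ.< s → j ℕ.< t → ∀ x → χᶠ i j x ℕ.+ χ*ᶠ i j x ℕ.+ ε (suc i) j x ≡ ε i j x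
  ε-step {i} {j} i<s j<t x = by-cases (≋-dec {p ^ i ℕ.* q ^ j} x 0ℤ)
    where
    open ≡.≡-Reasoning
    at-multiple : (∃[ w ] x ≡ δ i j ℤ.* w) → χᶠ i j x ℕ.+ χ*ᶠ i j x ℕ.+ ε (suc i) j x ≡ ε i j x
    at-multiple (w , refl) = begin
      χᶠ i j x ℕ.+ χ*ᶠ i j x ℕ.+ ε (suc i) j x
        ≡⟨ ≡.cong₂ ℕ._+_ (≡.cong₂ ℕ._+_ (χ-value i<s (ℕ.<⇒≤ j<t) w) (χ*-value i<s (ℕ.<⇒≤ j<t) w)) (ε-suc i j w) ⟩
      ρ w ℕ.* 𝟙 (unit? (q ^ (t ∸ j)) w) ℕ.+ ρ (ℤ.- w) ℕ.* 𝟙 (unit? (q ^ (t ∸ j)) w) ℕ.+ 𝟙 (≋-dec {p} w 0ℤ) ℕ.* 𝟙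
          (unit? q w)
        ≡⟨ ≡.cong (λ u → ρ w ℕ.* u ℕ.+ ρ (ℤ.- w) ℕ.* u ℕ.+ 𝟙 (≋-dec {p} w 0ℤ) ℕ.* 𝟙 (unit? q w)) (unit-q-power j<t w) ⟩
      ρ w ℕ.* 𝟙 (unit? q w) ℕ.+ ρ (ℤ.- w) ℕ.* 𝟙 (unit? q w) ℕ.+ 𝟙 (≋-dec {p} w 0ℤ) ℕ.* 𝟙 (unit? q w)
        ≡⟨ factor (ρ w) (ρ (ℤ.- w)) (𝟙 (≋-dec {p} w 0ℤ)) (𝟙 (unit? q w)) ⟩
      (𝟙 (≋-dec {p} w 0ℤ) ℕ.+ (ρ w ℕ.+ ρ (ℤ.- w))) ℕ.* 𝟙 (unit? q w)
        ≡⟨ ≡.cong (ℕ._* 𝟙 (unit? q w)) (≡.trans (≡.cong (𝟙 (≋-dec {p} w 0ℤ) ℕ.+_) (≡.sym (unit-count w)))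
            (zero-count w)) ⟩
      1 ℕ.* 𝟙 (unit? q w)
        ≡⟨ ℕ.*-identityˡ _ ⟩
      𝟙 (unit? q w)
        ≡⟨ ε-scale i j w ⟨
      ε i j x ∎
      where
      factor : ∀ a b z u → a ℕ.* u ℕ.+ b ℕ.* u ℕ.+ z ℕ.* u ≡ (z ℕ.+ (a ℕ.+ b)) ℕ.* u
      factor = ℕSolver.solve-∀
    by-cases : Dec (x ≋ 0ℤ [ p ^ i ℕ.* q ^ j ]) → χᶠ i j x ℕ.+ χ*ᶠ i j x ℕ.+ ε (suc i) j x ≡ ε i j x
    by-cases (yes m) = at-multiple (≋0⇒∣ m)
    by-cases (no ¬m) = ≡.trans
      (≡.cong₂ ℕ._+_ (≡.cong₂ ℕ._+_ (χ-zero (ℕ.<⇒≤ i<s) (ℕ.<⇒≤ j<t) ¬m) (χ*-zero (ℕ.<⇒≤ i<s) (ℕ.<⇒≤ j<t) ¬m))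
        (𝟙-no (exact? (suc i) j x) (¬m ∘ ≋-∣ (∣.*-monoˡ-∣ (q ^ j) (∣.n∣m*n p)) ∘ exact⇒multiple)))
      (≡.sym (𝟙-no (exact? i j x) (¬m ∘ exact⇒multiple)))

  ε-last : ∀ {j} → j ℕ.< t → ∀ x → χᶠ s j x ≡ ε s j x
  ε-last {j} j<t x = by-cases (≋-dec {p ^ s ℕ.* q ^ j} x 0ℤ)
    where
    at-multiple : (∃[ w ] x ≡ δ s j ℤ.* w) → χᶠ s j x ≡ ε s j x
    at-multiple (w , refl) = ≡.trans (χ-last (ℕ.<⇒≤ j<t) w) (≡.trans (unit-q-power j<t w) (≡.sym (ε-scale s j w)))
    by-cases : Dec (x ≋ 0ℤ [ p ^ s ℕ.* q ^ j ]) → χᶠ s j x ≡ ε s j x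
    by-cases (yes m) = at-multiple (≋0⇒∣ m)
    by-cases (no ¬m) = ≡.trans (χ-zero ℕ.≤-refl (ℕ.<⇒≤ j<t) ¬m) (≡.sym (𝟙-no (exact? s j x) (¬m ∘ exact⇒multiple)))

  -- The sum over k > i telescopes because, by ε-step, χ_kj + χ*_kj is ε k j - ε (k + 1) j.
  χ-tail : ℕ → ℕ → ℤ → ℕ
  χ-tail i j x = ∑ˡ (filter (i ℕ.<?_) (upTo s)) (λ k → χᶠ k j x ℕ.+ χ*ᶠ k j x) ℕ.+ χᶠ s j x

  χ-tail-value : ∀ {i j} → i ℕ.< s → j ℕ.< t → ∀ x → χ-tail i j x ≡ ε (suc i) j x
  χ-tail-value {i} {j} i<s j<t x = ≡.trans (≡.cong (∑ˡ (range s) f ℕ.+_) (ε-last j<t x))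
      (≡.subst (λ m → ∑ˡ (range m) f ℕ.+ ε m j x ≡ ε (suc i) j x) (ℕ.m∸n+n≡m i<s)
          (telescope (s ∸ suc i) (ℕ.≤-reflexive (ℕ.m∸n+n≡m i<s))))
    where
    open ≡.≡-Reasoning
    f : ℕ → ℕ
    f k = χᶠ k j x ℕ.+ χ*ᶠ k j x
    range : ℕ → List ℕ
    range m = filter (i ℕ.<?_) (upTo m)
    range-suc : ∀ {m} → i ℕ.< m → range (suc m) ≡ range m ++ m ∷ []
    range-suc {m} i<m = ≡.trans (≡.cong (filter (i ℕ.<?_)) (≡.sym (List.upTo-∷ʳ m)))
      (≡.trans (List.filter-++ (i ℕ.<?_) (upTo m) (m ∷ [])) (≡.cong (range m ++_) (List.filter-accept (i ℕ.<?_) i<m)))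
    ∑ˡ-snoc : ∀ is m → ∑ˡ (is ++ m ∷ []) f ≡ ∑ˡ is f ℕ.+ f m
    ∑ˡ-snoc []       m = ℕ.+-identityʳ (f m)
    ∑ˡ-snoc (k ∷ is) m = ≡.trans (≡.cong (f k ℕ.+_) (∑ˡ-snoc is m)) (≡.sym (ℕ.+-assoc (f k) (∑ˡ is f) (f m)))
    -- The upper end is a + suc i. At a = 0 no k below suc i exceeds i, so the sum starts out empty.
    telescope : ∀ a → a ℕ.+ suc i ℕ.≤ s → ∑ˡ (range (a ℕ.+ suc i)) f ℕ.+ ε (a ℕ.+ suc i) j x ≡ ε (suc i) j x
    telescope zero    _     = ≡.cong (λ is → ∑ˡ is f ℕ.+ ε (suc i) j x)
      (List.filter-none (i ℕ.<?_) (All.applyUpTo⁺₁ id (suc i) (λ k≤i → ℕ.≤⇒≯ (ℕ.s≤s⁻¹ k≤i))))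
    telescope (suc a) a+i<s = begin
      ∑ˡ (range (suc m)) f ℕ.+ ε (suc m) j x
        ≡⟨ ≡.cong (λ is → ∑ˡ is f ℕ.+ ε (suc m) j x) (range-suc (ℕ.m≤n+m (suc i) a)) ⟩
      ∑ˡ (range m ++ m ∷ []) f ℕ.+ ε (suc m) j x
        ≡⟨ ≡.cong (ℕ._+ ε (suc m) j x) (∑ˡ-snoc (range m) m) ⟩
      ∑ˡ (range m) f ℕ.+ f m ℕ.+ ε (suc m) j x
        ≡⟨ ℕ.+-assoc (∑ˡ (range m) f) (f m) _ ⟩
      ∑ˡ (range m) f ℕ.+ (f m ℕ.+ ε (suc m) j x)
        ≡⟨ ≡.cong (∑ˡ (range m) f ℕ.+_) (ε-step a+i<s j<t x) ⟩
      ∑ˡ (range m) f ℕ.+ ε m j x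
        ≡⟨ telescope a (ℕ.<⇒≤ a+i<s) ⟩
      ε (suc i) j x ∎
      where
      m : ℕ
      m = a ℕ.+ suc i

  in-χ*⇒exact : ∀ {i j x} → i ℕ.< s → j ℕ.< t → In (δ i j ℤ.* g) x → Exact i j x
  in-χ*⇒exact {i} {j} {x} i<s j<t m = from-multiple (≋0⇒∣ (in⇒multiple d {{d≢0 i j}} eq g x m))
    where
    d = p ^ i ℕ.* q ^ j
    eq = cofactor-≡ {i} {j} (ℕ.<⇒≤ i<s) (ℕ.<⇒≤ j<t)
    from-multiple : (∃[ w ] x ≡ δ i j ℤ.* w) → Exact i j x
    from-multiple (w , e) = exact w e (unit-∣ (p∣p^ q {t ∸ j} (ℕ.m<n⇒0<n∸m j<t))
      (powers⇒unit g-unit (ℕ.m∸n≤m t j) (q∣M i j) (in-scale⇒ d {{d≢0 i j}} eq g w (≡.subst (In (δ i j ℤ.* g)) e m))))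

  -- Coefficients of the product χ*_ij χ_ij'

  module _ {i j j′ : ℕ} (i<s : i ℕ.< s) (j<j′ : j ℕ.< j′) (j′≤t : j′ ℕ.≤ t) where

    private
      j<t : j ℕ.< t
      j<t = ℕ.<-≤-trans j<j′ j′≤t
      Q : ℤ
      Q = + (q ^ (j′ ∸ j))
      pᵃ φ′ : ℕ
      pᵃ = p ^ (s ∸ i ∸ 1)
      φ′ = φ (q ^ (t ∸ j′))
      conv : ℤ → ℕ
      conv = χ*ᶠ i j ⋆[ n ] χᶠ i j′

    -- This is where j < j′ enters: q divides Q, so c - Q w agrees with c modulo q.
    unit-minus-Q : ∀ {c} → Unit q c → ∀ w → Unit q (c ℤ.- Q ℤ.* w)
    unit-minus-Q {c} u w = unit-resp (≋-sym (begin
      c ℤ.- Q ℤ.* w     ≈⟨ ≋-+ (≋-refl {x = c}) (≋-neg (≋-*ʳ {x = w} Q≋0)) ⟩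
      c ℤ.- 0ℤ ℤ.* w    ≡⟨ vanish c w ⟩
      c                 ∎)) u
      where
      open ≋-Reasoning q
      Q≋0 : Q ≋ 0ℤ [ q ]
      Q≋0 = ≋-∣ (p∣p^ q {j′ ∸ j} (ℕ.m<n⇒0<n∸m j<j′)) m≋0
      vanish : ∀ c w → c ℤ.- 0ℤ ℤ.* w ≡ c
      vanish = solve-∀

    sum-exact : ∀ {x b} → Exact i j (x ℤ.- b) → b ≋ 0ℤ [ p ^ i ℕ.* q ^ j′ ] → Exact i j x
    sum-exact {x} {b} (exact w e u) b≋0 = from-multiple (≋0⇒∣ b≋0)
      where
      from-multiple : (∃[ v ] b ≡ δ i j′ ℤ.* v) → Exact i j x
      from-multiple (v , e′) = exact (w ℤ.- Q ℤ.* ℤ.- v) (begin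
        x                                        ≡⟨ split x b ⟩
        (x ℤ.- b) ℤ.+ b                          ≡⟨ ≡.cong₂ ℤ._+_ e (≡.trans e′ (δ-shift i (ℕ.<⇒≤ j<j′) v)) ⟩
        δ i j ℤ.* w ℤ.+ δ i j ℤ.* (Q ℤ.* v)      ≡⟨ factor (δ i j) w Q v ⟩
        δ i j ℤ.* (w ℤ.- Q ℤ.* ℤ.- v)            ∎) (unit-minus-Q u (ℤ.- v))
        where
        open ≡.≡-Reasoning
        split : ∀ x b → x ≡ (x ℤ.- b) ℤ.+ b
        split = solve-∀
        factor : ∀ d w Q v → d ℤ.* w ℤ.+ d ℤ.* (Q ℤ.* v) ≡ d ℤ.* (w ℤ.- Q ℤ.* ℤ.- v)
        factor = solve-∀

    conv-zero : ∀ {x} → ¬ Exact i j x → conv x ≡ 0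
    conv-zero {x} ¬ex = sum-zero n _ λ b →
      𝟙-disjoint (residue n (x ℤ.- + toℕ b) ∈C? (δ i j ℤ.* g)) (residue n (+ toℕ b) ∈C? δ i j′)
        λ m m′ → ¬ex (sum-exact {x} {+ toℕ b} (in-χ*⇒exact i<s j<t m)
          (in⇒multiple (p ^ i ℕ.* q ^ j′) {{d≢0 i j′}} (cofactor-≡ {i} {j′} (ℕ.<⇒≤ i<s) j′≤t) 1ℤ (+ toℕ b)
            (≡.subst (λ γ → In γ (+ toℕ b)) (δ-1 i j′) m′)))

    -- Only b = p^i q^j′ w contributes. Its summand is a function of w modulo p times the indicator
    -- of w being a unit modulo q^(t-j′), and w runs over p^(s-i) q^(t-j′) residues: one factor p
    -- goes to the sum over residues, and p^(s-i-1) remains.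
    conv-value : ∀ {c} → Unit q c → conv (δ i j ℤ.* c) ≡ pᵃ ℕ.* φ′ ℕ.* Σₚ (λ w → ρ (Q ℤ.* w ℤ.- c) ℕ.* ρ w)
    conv-value {c} c-unit = begin
      sum {n} (λ b → term (+ toℕ b))
        ≡⟨ resize n≡ (λ b → term (+ b)) ⟩
      sum {M ℕ.* d′} (λ b → term (+ toℕ b))
        ≡⟨ sum-multiples d′ M {{d≢0 i j′}} term
            (λ b b≢0 → ≡.trans (≡.cong (χ*ᶠ i j (δ i j ℤ.* c ℤ.- b) ℕ.*_) (χ-zero (ℕ.<⇒≤ i<s) j′≤t b≢0))
            (ℕ.*-zeroʳ (χ*ᶠ i j (δ i j ℤ.* c ℤ.- b)))) ⟩
      sum {M} (λ w → term (δ i j′ ℤ.* + toℕ w))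
        ≡⟨ sum-cong-≋ {M} (λ w → term-value (+ toℕ w)) ⟩
      sum {M} (λ w → f (+ toℕ w) ℕ.* u (+ toℕ w))
        ≡⟨ resize M≡ (λ w → f (+ w) ℕ.* u (+ w)) ⟩
      sum {(pᵃ ℕ.* N) ℕ.* p} (λ w → f (+ toℕ w) ℕ.* u (+ toℕ w))
        ≡⟨ sum-coprime-moduli pᵃ N p f u {{N≢0}} f-periodic 𝟙-unit-periodic (p-unit-q (t ∸ j′)) ⟩
      pᵃ ℕ.* sum {N} (λ w → u (+ toℕ w)) ℕ.* Σₚ f
        ≡⟨ ≡.cong (λ z → pᵃ ℕ.* z ℕ.* Σₚ f) (φ-as-sum N {{N≢0}}) ⟨
      pᵃ ℕ.* φ′ ℕ.* Σₚ f ∎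
      where
      open ≡.≡-Reasoning
      N M d′ : ℕ
      N = q ^ (t ∸ j′)
      M = p ^ (s ∸ i) ℕ.* N
      d′ = p ^ i ℕ.* q ^ j′
      N≢0 : NonZero N
      N≢0 = ℕ.m^n≢0 q (t ∸ j′)
      term f u : ℤ → ℕ
      term b = χ*ᶠ i j (δ i j ℤ.* c ℤ.- b) ℕ.* χᶠ i j′ b
      f w = ρ (Q ℤ.* w ℤ.- c) ℕ.* ρ w
      u w = 𝟙 (unit? N w)
      f-periodic : ∀ {x y} → x ≋ y [ p ] → f x ≡ f y
      f-periodic e = ≡.cong₂ ℕ._*_ (ρ-resp (≋-+ (≋-*ˡ {x = Q} e) (≋-refl {x = ℤ.- c}))) (ρ-resp e)
      resize : ∀ {m m′} → m ≡ m′ → ∀ (h : ℕ → ℕ) → sum {m} (λ i → h (toℕ i)) ≡ sum {m′} (λ i → h (toℕ i))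
      resize refl h = refl
      n≡ : n ≡ M ℕ.* d′
      n≡ = ≡.trans (≡.sym (cofactor-≡ {i} {j′} (ℕ.<⇒≤ i<s) j′≤t)) (ℕ.*-comm d′ M)
      M≡ : M ≡ (pᵃ ℕ.* N) ℕ.* p
      M≡ = ≡.trans (≡.cong (λ a → p ^ a ℕ.* N)
          (≡.sym (≡.trans (ℕ.+-comm 1 (s ∸ i ∸ 1)) (ℕ.m∸n+n≡m (ℕ.m<n⇒0<n∸m i<s))))) (rearrange p pᵃ N)
        where
        rearrange : ∀ p a n → p ℕ.* a ℕ.* n ≡ a ℕ.* n ℕ.* p
        rearrange = ℕSolver.solve-∀
      χ*-term : ∀ w → χ*ᶠ i j (δ i j ℤ.* c ℤ.- δ i j′ ℤ.* w) ≡ ρ (Q ℤ.* w ℤ.- c)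
      χ*-term w = begin
        χ*ᶠ i j (δ i j ℤ.* c ℤ.- δ i j′ ℤ.* w)
          ≡⟨ ≡.cong (χ*ᶠ i j) (≡.trans (≡.cong (λ z → δ i j ℤ.* c ℤ.- z) (δ-shift i (ℕ.<⇒≤ j<j′) w))
              (factor (δ i j) c (Q ℤ.* w))) ⟩
        χ*ᶠ i j (δ i j ℤ.* (c ℤ.- Q ℤ.* w))
          ≡⟨ χ*-value i<s (ℕ.<⇒≤ j<t) (c ℤ.- Q ℤ.* w) ⟩
        ρ (ℤ.- (c ℤ.- Q ℤ.* w)) ℕ.* 𝟙 (unit? (q ^ (t ∸ j)) (c ℤ.- Q ℤ.* w))
          -- The starred coset tests the negative, which reverses c - Q w; the condition at q holds
          -- by `unit-minus-Q`.
          ≡⟨ ≡.cong₂ ℕ._*_ (ρ-≡ (flip c (Q ℤ.* w)))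
              (≡.trans (unit-q-power j<t _) (𝟙-yes (unit? q _) (unit-minus-Q c-unit w))) ⟩
        ρ (Q ℤ.* w ℤ.- c) ℕ.* 1
          ≡⟨ ℕ.*-identityʳ _ ⟩
        ρ (Q ℤ.* w ℤ.- c) ∎
        where
        factor : ∀ d c v → d ℤ.* c ℤ.- d ℤ.* v ≡ d ℤ.* (c ℤ.- v)
        factor = solve-∀
        flip : ∀ c v → ℤ.- (c ℤ.- v) ≡ v ℤ.- c
        flip = solve-∀
      term-value : ∀ w → term (δ i j′ ℤ.* w) ≡ f w ℕ.* u w
      term-value w = ≡.trans (≡.cong₂ ℕ._*_ (χ*-term w) (χ-value i<s j′≤t w))
          (≡.sym (ℕ.*-assoc (ρ (Q ℤ.* w ℤ.- c)) (ρ w) (u w)))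

    private
      at-unit : ∀ {c} → Unit q c → (χᶠ i j (δ i j ℤ.* c) ≡ ρ c) × (χ*ᶠ i j (δ i j ℤ.* c) ≡ ρ (ℤ.- c))
      at-unit {c} u = ≡.trans (χ-value i<s (ℕ.<⇒≤ j<t) c) (trivial (ρ c)) , ≡.trans (χ*-value i<s (ℕ.<⇒≤ j<t) c)
          (trivial (ρ (ℤ.- c)))
        where
        trivial : ∀ a → a ℕ.* 𝟙 (unit? (q ^ (t ∸ j)) c) ≡ a
        trivial a = ≡.trans (≡.cong (a ℕ.*_) (≡.trans (unit-q-power j<t c) (𝟙-yes (unit? q c) u))) (ℕ.*-identityʳ a)

      -- By `ε-step` the three natural numbers add up to 0.
      away : ∀ {x} → ¬ Exact i j x → (χᶠ i j x ≡ 0) × (χ*ᶠ i j x ≡ 0) × (ε (suc i) j x ≡ 0)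
      away {x} ¬ex = ℕ.m+n≡0⇒m≡0 _ χ+χ*≡0 , ℕ.m+n≡0⇒n≡0 (χᶠ i j x) χ+χ*≡0 , ℕ.m+n≡0⇒n≡0 (χᶠ i j x ℕ.+ χ*ᶠ i j x) total
        where
        total : χᶠ i j x ℕ.+ χ*ᶠ i j x ℕ.+ ε (suc i) j x ≡ 0
        total = ≡.trans (ε-step i<s j<t x) (𝟙-no (exact? i j x) ¬ex)
        χ+χ*≡0 : χᶠ i j x ℕ.+ χ*ᶠ i j x ≡ 0
        χ+χ*≡0 = ℕ.m+n≡0⇒m≡0 _ total

    -- The case p ∣ c of `count-residue` is exactness at i + 1, which is the value of `χ-tail`; its
    -- weight p^(s-i-1) (1 + 2k) is half of φ(p^(s-i)).
    conv-residue : R Q → ∀ x → conv x ≡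
      (k ℕ.* pᵃ ℕ.* φ′) ℕ.* (χᶠ i j x ℕ.+ χ*ᶠ i j x) ℕ.+ (pᵃ ℕ.* (1 ℕ.+ 2 ℕ.* k) ℕ.* φ′) ℕ.* χ-tail i j x
    conv-residue rQ x = ≡.trans (by-cases (exact? i j x))
        (≡.cong (λ z → (k ℕ.* pᵃ ℕ.* φ′) ℕ.* (χᶠ i j x ℕ.+ χ*ᶠ i j x) ℕ.+ (pᵃ ℕ.* (1 ℕ.+ 2 ℕ.* k) ℕ.* φ′) ℕ.* z)
            (≡.sym (χ-tail-value i<s j<t x)))
      where
      open ≡.≡-Reasoning
      K₁ K₂ : ℕ
      K₁ = k ℕ.* pᵃ ℕ.* φ′
      K₂ = pᵃ ℕ.* (1 ℕ.+ 2 ℕ.* k) ℕ.* φ′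
      by-cases : Dec (Exact i j x) → conv x ≡ K₁ ℕ.* (χᶠ i j x ℕ.+ χ*ᶠ i j x) ℕ.+ K₂ ℕ.* ε (suc i) j x
      by-cases (no ¬ex) = ≡.trans (conv-zero ¬ex) (≡.sym (≡.trans
        (≡.cong₂ (λ a b → K₁ ℕ.* a ℕ.+ K₂ ℕ.* b) (≡.cong₂ ℕ._+_ (proj₁ (away ¬ex)) (proj₁ (proj₂ (away ¬ex))))
            (proj₂ (proj₂ (away ¬ex))))
        (≡.cong₂ ℕ._+_ (ℕ.*-zeroʳ K₁) (ℕ.*-zeroʳ K₂))))
      by-cases (yes (exact c refl u)) = begin
        conv x
          ≡⟨ conv-value u ⟩
        pᵃ ℕ.* φ′ ℕ.* Σₚ (λ w → ρ (Q ℤ.* w ℤ.- c) ℕ.* ρ w)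
          ≡⟨ ≡.cong (pᵃ ℕ.* φ′ ℕ.*_) (count-residue rQ c) ⟩
        pᵃ ℕ.* φ′ ℕ.* (k ℕ.* (ρ c ℕ.+ ρ (ℤ.- c)) ℕ.+ (1 ℕ.+ 2 ℕ.* k) ℕ.* 𝟙 (≋-dec {p} c 0ℤ))
          ≡⟨ distribute pᵃ φ′ k (ρ c ℕ.+ ρ (ℤ.- c)) (1 ℕ.+ 2 ℕ.* k) (𝟙 (≋-dec {p} c 0ℤ)) ⟩
        K₁ ℕ.* (ρ c ℕ.+ ρ (ℤ.- c)) ℕ.+ K₂ ℕ.* (𝟙 (≋-dec {p} c 0ℤ) ℕ.* 1)
          ≡⟨ ≡.cong₂ (λ a b → K₁ ℕ.* a ℕ.+ K₂ ℕ.* b) (≡.cong₂ ℕ._+_ (proj₁ (at-unit u)) (proj₂ (at-unit u)))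
               (≡.trans (ε-suc i j c) (≡.cong (𝟙 (≋-dec {p} c 0ℤ) ℕ.*_) (𝟙-yes (unit? q c) u))) ⟨
        K₁ ℕ.* (χᶠ i j x ℕ.+ χ*ᶠ i j x) ℕ.+ K₂ ℕ.* ε (suc i) j x ∎
        where
        distribute : ∀ a f k r h z → a ℕ.* f ℕ.*
            (k ℕ.* r ℕ.+ h ℕ.* z) ≡ k ℕ.* a ℕ.* f ℕ.* r ℕ.+ a ℕ.* h ℕ.* f ℕ.* (z ℕ.* 1)
        distribute = ℕSolver.solve-∀

    -- No tail arises, because `count-nonresidue` vanishes when p divides c.
    conv-nonresidue : R (ℤ.- Q) → ∀ x → conv x ≡
      (k ℕ.* pᵃ ℕ.* φ′) ℕ.* χ*ᶠ i j x ℕ.+ ((k ℕ.+ 1) ℕ.* pᵃ ℕ.* φ′) ℕ.* χᶠ i j x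
    conv-nonresidue r-Q x = by-cases (exact? i j x)
      where
      open ≡.≡-Reasoning
      K₁ K₂ : ℕ
      K₁ = k ℕ.* pᵃ ℕ.* φ′
      K₂ = (k ℕ.+ 1) ℕ.* pᵃ ℕ.* φ′
      by-cases : Dec (Exact i j x) → conv x ≡ K₁ ℕ.* χ*ᶠ i j x ℕ.+ K₂ ℕ.* χᶠ i j x
      by-cases (no ¬ex) = ≡.trans (conv-zero ¬ex) (≡.sym (≡.trans
        (≡.cong₂ (λ a b → K₁ ℕ.* a ℕ.+ K₂ ℕ.* b) (proj₁ (proj₂ (away ¬ex))) (proj₁ (away ¬ex)))
        (≡.cong₂ ℕ._+_ (ℕ.*-zeroʳ K₁) (ℕ.*-zeroʳ K₂))))
      by-cases (yes (exact c refl u)) = begin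
        conv x
          ≡⟨ conv-value u ⟩
        pᵃ ℕ.* φ′ ℕ.* Σₚ (λ w → ρ (Q ℤ.* w ℤ.- c) ℕ.* ρ w)
          ≡⟨ ≡.cong (pᵃ ℕ.* φ′ ℕ.*_) (count-nonresidue r-Q c) ⟩
        pᵃ ℕ.* φ′ ℕ.* (k ℕ.* ρ (ℤ.- c) ℕ.+ (k ℕ.+ 1) ℕ.* ρ c)
          ≡⟨ distribute pᵃ φ′ k (ρ (ℤ.- c)) (k ℕ.+ 1) (ρ c) ⟩
        K₁ ℕ.* ρ (ℤ.- c) ℕ.+ K₂ ℕ.* ρ c
          ≡⟨ ≡.cong₂ (λ a b → K₁ ℕ.* a ℕ.+ K₂ ℕ.* b) (proj₂ (at-unit u)) (proj₁ (at-unit u)) ⟨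
        K₁ ℕ.* χ*ᶠ i j x ℕ.+ K₂ ℕ.* χᶠ i j x ∎
        where
        distribute : ∀ a f k r h z → a ℕ.* f ℕ.* (k ℕ.* r ℕ.+ h ℕ.* z) ≡ k ℕ.* a ℕ.* f ℕ.* r ℕ.+ h ℕ.* a ℕ.* f ℕ.* z
        distribute = ℕSolver.solve-∀

    -- From coefficient functions back to the ring

    open CommutativeRing (𝔽[x]/⟨xⁿ-1⟩ l n) using () renaming
        (trans to ≈ᴬ-trans; sym to ≈ᴬ-sym; +-cong to +ᴬ-cong; *-cong to *ᴬ-cong; refl to ≈ᴬ-refl)

    private
      X X* : ℕ → ℕ → A
      X  i j = cosetSum (δ i j)
      X* i j = cosetSum (δ i j ℤ.* g)

      X-expansion : ∀ i j → X i j ≈ᴬ Σκe (χᶠ i j)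
      X-expansion i j = cosetSum-expansion (δ i j)

      X*-expansion : ∀ i j → X* i j ≈ᴬ Σκe (χ*ᶠ i j)
      X*-expansion i j = cosetSum-expansion (δ i j ℤ.* g)

      pair-expansion : ∀ k → X k j +ᴬ X* k j ≈ᴬ Σκe (λ x → χᶠ k j x ℕ.+ χ*ᶠ k j x)
      pair-expansion k = ≈ᴬ-trans (+ᴬ-cong (X-expansion k j) (X*-expansion k j)) (Σκe-+ (χᶠ k j) (χ*ᶠ k j))

      ∑-cong : ∀ (is : List ℕ) {f f′ : ℕ → A} → (∀ k → f k ≈ᴬ f′ k) → ∑ is f ≈ᴬ ∑ is f′
      ∑-cong []       e = ≈ᴬ-refl
      ∑-cong (k ∷ is) e = +ᴬ-cong (e k) (∑-cong is e)

      tail-expansion : ∑ (filter (i ℕ.<?_) (upTo s)) (λ k → X k j +ᴬ X* k j) +ᴬ X s j ≈ᴬ Σκe (χ-tail i j)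
      tail-expansion = ≈ᴬ-trans
        (+ᴬ-cong (≈ᴬ-trans (∑-cong is pair-expansion) (Σκe-list is (λ k x → χᶠ k j x ℕ.+ χ*ᶠ k j x))) (X-expansion s j))
        (Σκe-+ (λ x → ∑ˡ is (λ k → χᶠ k j x ℕ.+ χ*ᶠ k j x)) (χᶠ s j))
        where
        is : List ℕ
        is = filter (i ℕ.<?_) (upTo s)

      product-expansion : X* i j *ᴬ X i j′ ≈ᴬ Σκe conv
      product-expansion = ≈ᴬ-trans (*ᴬ-cong (X*-expansion i j) (X-expansion i j′))
        (Σκe-* (χ*ᶠ i j) (χᶠ i j′) (member-periodic (δ i j ℤ.* g)))

      combination : ∀ m₁ m₂ {u v} f h → u ≈ᴬ Σκe f → v ≈ᴬ Σκe h →
                    m₁ · u +ᴬ m₂ · v ≈ᴬ Σκe (λ x → m₁ ℕ.* f x ℕ.+ m₂ ℕ.* h x)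
      combination m₁ m₂ f h u≈ v≈ = ≈ᴬ-trans
        (+ᴬ-cong (≈ᴬ-trans (·-cong m₁ u≈) (·-Σκe m₁ f)) (≈ᴬ-trans (·-cong m₂ v≈) (·-Σκe m₂ h)))
        (Σκe-+ (λ x → m₁ ℕ.* f x) (λ x → m₂ ℕ.* h x))

    -- The multipliers enter through equations, so that the quotients in the theorem can be
    -- evaluated separately.
    product-residue : R Q → ∀ m₁ m₂ → m₁ ≡ k ℕ.* pᵃ ℕ.* φ′ → m₂ ≡ pᵃ ℕ.* (1 ℕ.+ 2 ℕ.* k) ℕ.* φ′ →
      X* i j *ᴬ X i j′ ≈ᴬ
        m₁ · (X i j +ᴬ X* i j) +ᴬ m₂ · (∑ (filter (i ℕ.<?_) (upTo s)) (λ k → X k j +ᴬ X* k j) +ᴬ X s j)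
    product-residue rQ m₁ m₂ refl refl = ≈ᴬ-trans product-expansion (≈ᴬ-trans (Σκe-cong (conv-residue rQ))
      (≈ᴬ-sym (combination m₁ m₂ (λ x → χᶠ i j x ℕ.+ χ*ᶠ i j x) (χ-tail i j) (pair-expansion i) tail-expansion)))

    product-nonresidue : R (ℤ.- Q) → ∀ m₁ m₂ → m₁ ≡ k ℕ.* pᵃ ℕ.* φ′ → m₂ ≡ (k ℕ.+ 1) ℕ.* pᵃ ℕ.* φ′ →
      X* i j *ᴬ X i j′ ≈ᴬ m₁ · X* i j +ᴬ m₂ · X i j
    product-nonresidue r-Q m₁ m₂ refl refl = ≈ᴬ-trans product-expansion (≈ᴬ-trans (Σκe-cong (conv-nonresidue r-Q))
      (≈ᴬ-sym (combination m₁ m₂ (χ*ᶠ i j) (χᶠ i j) (X*-expansion i j) (X-expansion i j))))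

  -- The quadratic character of powers of q modulo p

  q-unit : Unit p (+ q)
  q-unit = primes-unit q-prime p-prime (p≢q ∘ ≡.sym)

  quadraticResidue⇒R : QuadraticResidue p q → R (+ q)
  quadraticResidue⇒R (_ , x , e) = R-resp (from-mod e)
      (R-square (unit-factor x x (unit-resp (≋-sym (from-mod e)) q-unit)))

  quadraticNonresidue⇒R-neg : QuadraticNonresidue p q → R (ℤ.- + q)
  quadraticNonresidue⇒R-neg (_ , no-root) = [ ⊥-elim ∘ no-root ∘ root ∘ R⇒square , id ]′ (R-split q-unit)
    where
    root : (∃[ y ] y ℤ.* y ≋ + q [ p ]) → ∃[ y ] y ℤ.* y ≡ + q [mod p ]
    root (y , e) = y , to-mod e

  R-power : R (+ q) → ∀ m → R (+ (q ^ m))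
  R-power rq zero    = R-resp ≋-refl (0 , ≋-refl)
  R-power rq (suc m) = ≡.subst R (≡.sym (ℤ.pos-* q (q ^ m))) (R-* rq (R-power rq m))

  R-power-even : ∀ m → R (+ (q ^ (m ℕ.+ m)))
  R-power-even m = ≡.subst R (≡.trans (≡.sym (ℤ.pos-* (q ^ m) (q ^ m))) (≡.cong +_ (≡.sym (ℕ.^-distribˡ-+-* q m m))))
    (R-square (unit-pos-^ m q-unit))

  -- An odd power of q is q times a square, so its negative is -q times an element of R.
  R-power-odd : R (ℤ.- + q) → ∀ m → R (ℤ.- + (q ^ suc (m ℕ.+ m)))
  R-power-odd r-q m = ≡.subst R (≡.trans (≡.sym (ℤ.neg-distribˡ-* (+ q) (+ (q ^ (m ℕ.+ m)))))
      (≡.cong ℤ.-_ (≡.sym (ℤ.pos-* q (q ^ (m ℕ.+ m))))))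
    (R-* r-q (R-power-even m))

-- Parity, and Euler's function at powers of a prime 4k + 3

Odd : ℕ → Set
Odd x = ∃[ h ] x ≡ 1 ℕ.+ 2 ℕ.* h

odd-* : ∀ {x y} → Odd x → Odd y → Odd (x ℕ.* y)
odd-* (h , refl) (h′ , refl) = h ℕ.+ h′ ℕ.+ 2 ℕ.* h ℕ.* h′ , expand h h′
  where
  expand : ∀ h h′ → (1 ℕ.+ 2 ℕ.* h) ℕ.* (1 ℕ.+ 2 ℕ.* h′) ≡ 1 ℕ.+ 2 ℕ.* (h ℕ.+ h′ ℕ.+ 2 ℕ.* h ℕ.* h′)
  expand = ℕSolver.solve-∀

odd-^ : ∀ {x} a → Odd x → Odd (x ^ a)
odd-^ zero    _ = 0 , refl
odd-^ (suc a) o = odd-* o (odd-^ a o)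

odd⇒2∤ : ∀ {x} → Odd x → ¬ (2 ∣.∣ x)
odd⇒2∤ (h , refl) 2∣x = ∣.>⇒∤ (ℕ.s≤s (ℕ.s≤s ℕ.z≤n))
    (∣.∣m+n∣m⇒∣n (≡.subst (2 ∣.∣_) (ℕ.+-comm 1 (2 ℕ.* h)) 2∣x) (∣.m∣m*n h))

-- A common divisor of L and F divides gcd(2L, F) = 2, and it is not 2 because L is odd.
coprime-half : ∀ {L F} → Odd L → gcd (L ℕ.+ L) F ≡ 2 → Coprime L F
coprime-half {L} {F} odd gcd≡2 {d} (d∣L , d∣F) = small (∣.∣⇒≤ d∣2) d∣2
    (odd⇒2∤ odd ∘ λ 2≡d → ≡.subst (∣._∣ L) (≡.sym 2≡d) d∣L)
  where
  d∣2 : d ∣.∣ 2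
  d∣2 = ≡.subst (d ∣.∣_) gcd≡2 (gcd-greatest (∣.∣m∣n⇒∣m+n d∣L d∣L) d∣F)
  small : ∀ {d} → d ℕ.≤ 2 → d ∣.∣ 2 → ¬ (2 ≡ d) → d ≡ 1
  small {0} _ 0∣2 _ = ⊥-elim (absurd (∣.0∣⇒≡0 0∣2))
    where
    absurd : ¬ (2 ≡ 0)
    absurd ()
  small {1} _ _ _   = refl
  small {2} _ _ 2≢2 = ⊥-elim (2≢2 refl)
  small {suc (suc (suc _))} (ℕ.s≤s (ℕ.s≤s ())) _ _

m+m/2≡m : ∀ m → (m ℕ.+ m) ℕ./ 2 ≡ m
m+m/2≡m m = ≡.trans (≡.cong (ℕ._/ 2) (double m)) (ℕ.m*n/n≡m m 2)
  where
  double : ∀ m → m ℕ.+ m ≡ m ℕ.* 2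
  double = ℕSolver.solve-∀

φ-3+4k : ∀ {p k} → Prime p → p ≡ 3 ℕ.+ 4 ℕ.* k → ∀ {a} → 1 ℕ.≤ a →
         φ (p ^ a) ≡ p ^ (a ∸ 1) ℕ.* (1 ℕ.+ 2 ℕ.* k) ℕ.+ p ^ (a ∸ 1) ℕ.* (1 ℕ.+ 2 ℕ.* k)
φ-3+4k {p} {k} pp p≡ {suc a} _ = ≡.trans (φ-prime-power pp a) (≡.trans
    (≡.cong (λ z → p ^ a ℕ.* ℕ.pred z) p≡) (double (p ^ a) k))
  where
  double : ∀ x k → x ℕ.* (2 ℕ.+ 4 ℕ.* k) ≡ x ℕ.* (1 ℕ.+ 2 ℕ.* k) ℕ.+ x ℕ.* (1 ℕ.+ 2 ℕ.* k)
  double = ℕSolver.solve-∀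

open import Data.Nat using (_+_; _*_; _/_; _%_; _≤_; _<_; _<?_)
open import Data.Nat.Divisibility using (_∣_)

theorem4p11 : ∀ (s t p q l : ℕ) (g : ℤ) →
    1 ≤ s → 1 ≤ t →
    Prime p → Prime q → Prime l →
    p ≢ q → p ≢ l → q ≢ l →
    ¬ (2 ∣ p) → ¬ (2 ∣ q) →
    p % 4 ≡ 3 →
    HasOrder (p ^ s) (+ l) (φ (p ^ s) / 2) →
    HasOrder (q ^ t) (+ l) (φ (q ^ t)) →
    gcd (φ (p ^ s)) (φ (q ^ t)) ≡ 2 →
    PrimitiveRoot (p ^ s) g →
    PrimitiveRoot (q ^ t) g →
    ∀ (i j j' : ℕ) → i < s → j < j' → j' ≤ t →
    let open Notation s t p q l g in
    (QuadraticResidue p q →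
    χ* i j *ᴬ χ i j' ≈ᴬ
    ((p ∸ 3) / 4 * p ^ (s ∸ i ∸ 1) * φ (q ^ (t ∸ j'))) · (χ i j +ᴬ χ* i j)
    +ᴬ (φ (p ^ (s ∸ i)) / 2 * φ (q ^ (t ∸ j')))
    · (∑ (filter (i <?_) (upTo s)) (λ k → χ k j +ᴬ χ* k j) +ᴬ χ s j))
    ×
    (QuadraticNonresidue p q → ¬ (2 ∣ j' ∸ j) →
    χ* i j *ᴬ χ i j' ≈ᴬ
    ((p ∸ 3) / 4 * p ^ (s ∸ i ∸ 1) * φ (q ^ (t ∸ j'))) · χ* i j
    +ᴬ ((p + 1) / 4 * p ^ (s ∸ i ∸ 1) * φ (q ^ (t ∸ j'))) · χ i j)
    ×
    (QuadraticNonresidue p q → 2 ∣ j' ∸ j →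
    χ* i j *ᴬ χ i j' ≈ᴬ
    ((p ∸ 3) / 4 * p ^ (s ∸ i ∸ 1) * φ (q ^ (t ∸ j'))) · (χ i j +ᴬ χ* i j)
    +ᴬ (φ (p ^ (s ∸ i)) / 2 * φ (q ^ (t ∸ j')))
    · (∑ (filter (i <?_) (upTo s)) (λ k → χ k j +ᴬ χ* k j) +ᴬ χ s j))
theorem4p11 s t p q l g 1≤s _ p-prime q-prime _ p≢q _ _ _ _ p%4≡3 p-order q-order gcd≡2 g-order g-order′ i j j' i<s j<j' j'≤t =
    -- Only the class of q^(j'-j) modulo p matters: it is in R for residues q by closure under
    -- products, and for even j' - j because it is a square.
    (λ residue → product-residue i<s j<j' j'≤t
        (R-power (quadraticResidue⇒R residue) (j' ∸ j)) _ _ coefficient₁ coefficient₂)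
  , (λ nonresidue odd → product-nonresidue i<s j<j' j'≤t
      (odd-case nonresidue odd (parity (j' ∸ j))) _ _ coefficient₁ coefficient₃)
  , (λ _ even → product-residue i<s j<j' j'≤t (even-case even (parity (j' ∸ j))) _ _ coefficient₁ coefficient₂)
  where
  k L : ℕ
  -- Since p leaves remainder 3 modulo 4, this quotient equals (p - 3)/4.
  k = p / 4
  L = p ^ (s ∸ 1) * (1 + 2 * k)
  p≡3+4k : p ≡ 3 + 4 * k
  p≡3+4k = ≡.trans (ℕ.m≡m%n+[m/n]*n p 4) (≡.cong₂ _+_ p%4≡3 (ℕ.*-comm k 4))
  φ≡L+L : φ (p ^ s) ≡ L + L
  φ≡L+L = φ-3+4k {k = k} p-prime p≡3+4k 1≤s
  p-odd : Odd p
  p-odd = 1 + 2 * k , ≡.trans p≡3+4k (halve k)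
    where
    halve : ∀ k → 3 + 4 * k ≡ 1 + 2 * (1 + 2 * k)
    halve = ℕSolver.solve-∀
  L-odd : Odd L
  L-odd = odd-* (odd-^ (s ∸ 1) p-odd) (k , refl)
  L≡ : L ≡ 1 + 2 * proj₁ L-odd
  L≡ = proj₂ L-odd
  p-order′ : HasOrder (p ^ s) (+ l) (1 + 2 * proj₁ L-odd)
  p-order′ = ≡.subst (HasOrder (p ^ s) (+ l)) (≡.trans (≡.cong (_/ 2) φ≡L+L) (≡.trans (m+m/2≡m L) L≡)) p-order
  L⊥F : Coprime (1 + 2 * proj₁ L-odd) (φ (q ^ t))
  L⊥F = ≡.subst (λ L → Coprime L (φ (q ^ t))) L≡
      (coprime-half L-odd (≡.trans (≡.cong (λ m → gcd m (φ (q ^ t))) (≡.sym φ≡L+L)) gcd≡2))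
  open TwoPrimes s t p q l k (proj₁ L-odd) g 1≤s p-prime q-prime p≢q p≡3+4k
    (≡.trans φ≡L+L (≡.cong₂ _+_ L≡ L≡)) p-order′ q-order L⊥F g-order (order-unit g-order′)
  pᵃ φ′ : ℕ
  pᵃ = p ^ (s ∸ i ∸ 1)
  φ′ = φ (q ^ (t ∸ j'))
  coefficient₁ : (p ∸ 3) / 4 * pᵃ * φ′ ≡ k * pᵃ * φ′
  coefficient₁ = ≡.cong (λ z → z * pᵃ * φ′) (≡.trans (≡.cong (λ z → (z ∸ 3) / 4) p≡3+4k)
    (≡.trans (≡.cong (_/ 4) (ℕ.*-comm 4 k)) (ℕ.m*n/n≡m k 4)))
  coefficient₂ : φ (p ^ (s ∸ i)) / 2 * φ′ ≡ pᵃ * (1 + 2 * k) * φ′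
  coefficient₂ = ≡.cong (_* φ′) (≡.trans (≡.cong (_/ 2) (φ-3+4k {k = k} p-prime p≡3+4k (ℕ.m<n⇒0<n∸m i<s)))
      (m+m/2≡m (pᵃ * (1 + 2 * k))))
  coefficient₃ : (p + 1) / 4 * pᵃ * φ′ ≡ (k + 1) * pᵃ * φ′
  coefficient₃ = ≡.cong (λ z → z * pᵃ * φ′) (≡.trans
      (≡.cong (_/ 4) (≡.trans (≡.cong (_+ 1) p≡3+4k) (quadruple k))) (ℕ.m*n/n≡m (k + 1) 4))
    where
    quadruple : ∀ k → 3 + 4 * k + 1 ≡ (k + 1) * 4
    quadruple = ℕSolver.solve-∀
  double-∣ : ∀ m → 2 ∣.∣ m + m
  double-∣ m = ∣.divides m (rearrange m)
    where
    rearrange : ∀ m → m + m ≡ m * 2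
    rearrange = ℕSolver.solve-∀
  even-case : ∀ {m} → 2 ∣.∣ m → (∃[ h ] (m ≡ h + h ⊎ m ≡ suc (h + h))) → R (+ (q ^ m))
  even-case 2∣m (h , inj₁ refl) = R-power-even h
  even-case 2∣m (h , inj₂ refl) = ⊥-elim (odd⇒2∤ (h , ≡.cong (λ z → suc (h + z)) (≡.sym (ℕ.+-identityʳ h))) 2∣m)
  odd-case : ∀ {m} → QuadraticNonresidue p q → ¬ (2 ∣.∣ m) → (∃[ h ] (m ≡ h + h ⊎ m ≡ suc (h + h))) → R (ℤ.- + (q ^ m))
  odd-case nr ¬2∣m (h , inj₁ refl) = ⊥-elim (¬2∣m (double-∣ h))
  odd-case nr ¬2∣m (h , inj₂ refl) = R-power-odd (quadraticNonresidue⇒R-neg nr) h
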